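{- Let $p>3$ be a prime. Then $$\sum_{k=1}^{(p-1)/2}\frac{\binom{2k}k\binom{4k}{2k}}{k\cdot 64^k}\equiv 6q_p(2)-p\big(3q_p(2)^2+2(-1)^{\frac{p-1}2}E_{p-3}\big)\pmod{p^2},$$ $$\sum_{k=1}^{(p-1)/2}\frac{\binom{2k}k\binom{3k}{k}}{k\cdot 27^k}\equiv 3q_p(3)-p\Big(\frac32q_p(3)^2+2\Big(\frac p3\Big)U_{p-3}\Big)\pmod{p^2},$$ $$\sum_{k=1}^{(p-1)/2}\frac{\binom{3k}k\binom{6k}{3k}}{k\cdot 432^k}\equiv 4q_p(2)+3q_p(3)-p\Big(2q_p(2)^2+\frac32q_p(3)^2+5\Big(\frac p3\Big)U_{p-3}\Big)\pmod{p^2}.$$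
   Context: $q_p(a)=(a^{p-1}-1)/p$ (Fermat quotient). $\big(\frac p3\big)$ is the Legendre symbol ($1$ if $p\equiv1\pmod3$, $-1$ if $p\equiv2\pmod3$). The Euler numbers are defined by $E_0=1$, $E_n=-\sum_{k=1}^{[n/2]}\binom n{2k}E_{n-2k}$ ($n\ge1$). The sequence $U_n$ is defined by $U_0=1$, $U_n=-2\sum_{k=1}^{[n/2]}\binom n{2k}U_{n-2k}$ ($n\ge1$). Congruences are in the ring of rationals with denominators prime to $p$. -}

module Defs where

open import Data.Nat as ℕ using (ℕ; zero; suc; _∸_)
open import Data.Nat.Combinatorics using (_C_)
open import Data.Nat.Divisibility as ℕD using ()
open import Data.Integer as ℤ using (ℤ; +_)
open import Data.Integer.Divisibility as ℤD using ()
open import Data.Rational as ℚ using (ℚ; _-_; _/_)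
open import Data.List using (List; []; _∷_; map; upTo; foldr)
open import Data.Fin using (Fin)
open import Relation.Nullary using (¬_)
open import Data.Product using (_×_)

-- Congruence in ℚ modulo m: x ≡ y (mod m) iff x - y = a/b (in lowest
-- terms) with m ∣ a and gcd(b, p) = 1; we take the modulus m = p^k and
-- the "denominator prime to p" requirement explicitly.

_≡_[mod_^_] : ℚ → ℚ → ℕ → ℕ → Set
x ≡ y [mod p ^ k ] =
  (+ (p ℕ.^ k)) ℤD.∣ ℚ.↥ (x - y) × ¬ (p ℕD.∣ ℚ.↧ₙ (x - y))

-- Sequences S with S_0 = 1, S_n = c * Σ_{k=1}^{⌊n/2⌋} C(n,2k) S_{n-2k}.
-- tableRev n = [S_n, S_{n-1}, ..., S_0]

private
  -- value at index i (i ≤ n) from the reversed table of length n+1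
  at : List ℤ → ℕ → ℕ → ℤ
  at tab n i = go tab (n ∸ i)
    where
    go : List ℤ → ℕ → ℤ
    go [] _ = + 0
    go (x ∷ _) zero = x
    go (_ ∷ xs) (suc j) = go xs j

tableRev : ℤ → ℕ → List ℤ
tableRev c zero = + 1 ∷ []
tableRev c (suc n) = next ∷ prev
  where
  prev = tableRev c n
  m = suc n
  next = c ℤ.* foldr ℤ._+_ (+ 0) (map (λ k → + (m C (2 ℕ.* k)) ℤ.* at prev n (m ∸ 2 ℕ.* k))
                        (map suc (upTo (m ℕ./ 2))))

seqS : ℤ → ℕ → ℤ
seqS c n with tableRev c n
... | [] = + 0
... | x ∷ _ = x

-- Euler numbers: E_0 = 1, E_n = - Σ_{k=1}^{⌊n/2⌋} C(n,2k) E_{n-2k}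
E : ℕ → ℤ
E = seqS (ℤ.- + 1)

U : ℕ → ℤ
U = seqS (ℤ.- + 2)

q : (p : ℕ) → .{{ℕ.NonZero p}} → ℕ → ℚ
q p a = (+ (a ℕ.^ (p ∸ 1)) ℤ.- + 1) / p

leg3 : ℕ → ℤ
leg3 p with p ℕ.% 3
... | 1 = + 1
... | 2 = ℤ.- + 1
... | _ = + 0

sgn : ℕ → ℤ
sgn n with n ℕ.% 2
... | 0 = + 1
... | _ = ℤ.- + 1

Σ[1…_] : ℕ → (ℕ → ℚ) → ℚ
Σ[1… n ] f = foldr ℚ._+_ ℚ.0ℚ (map (λ k → f (suc k)) (upTo n))

ℕ→ℚ : ℕ → ℚ
ℕ→ℚ n = + n / 1

-- a/b as a rational for naturals; only used with b ≠ 0 (b = 0 gives 0)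
_//_ : ℕ → ℕ → ℚ
a // zero = ℚ.0ℚ
a // suc b = + a / suc b

{-# OPTIONS --safe #-}
-- Write p = 2M + 1. The three sums are S(a) = Σ_{k ≤ M} C(a,k) C(-1-a,k)/k at a = -1/4, -1/3, -1/6. The difference
-- S(a) - S(a-1) telescopes to 2 (C(a-1,M) C(-a-1,M) - 1)/a, so starting from S(pt) ≡ 0 one finds
-- S(n + pt) ≡ -2 H_n + 4 p t H_n^(2) (mod p²) for n ≤ M, and the sums are governed by H_n and H_n^(2) for
-- n = [p/4], [p/3], [p/6].
-- Modulo p², H_[p/2] and H_[p/3] come from expanding Lerch's product for 2^(p-1) and 3^(p-1) modulo p³; splitting
-- 1, …, N into even numbers and odd numbers p - 2l then gives H_[p/4] and H_[p/6].
-- Modulo p, H_[p/4]^(2) and H_[p/3]^(2) are alternating sums of c^(p-3) by Fermat. The umbral functions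
-- g(c) = (E + c)^(p-3) and (U + c)^(p-3) are p-periodic modulo p and satisfy linear recurrences with right-hand side
-- c^(p-3), so going once around a period expresses E_{p-3} and U_{p-3} through these sums.

module Submission where

open import Defs
open import Data.Nat as ℕ using (ℕ; zero; suc; _>_; _<_; _≤_; _∸_; _*_; _^_; NonZero; z≤n; s≤s; s<s; z<s; _!) renaming (_/_ to _div_)
import Data.Nat.Properties as ℕ
open import Data.Nat.Properties using (_!*_!≢0)
import Data.Nat.DivMod as ℕ
import Data.Nat.Divisibility as ℕ
import Data.Nat.Tactic.RingSolver as ℕRing
open import Data.Nat.Divisibility using (_∣_; divides)
open import Data.Nat.Combinatorics using (_C_; nCk+nC[k+1]≡[n+1]C[k+1]; k>n⇒nCk≡0; nCk≡n!/k![n-k]!; nCn≡1; k![n∸k]!∣n!)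
open import Data.Nat.Coprimality using (Coprime; recompute)
open import Data.Nat.Primality using (Prime; euclidsLemma; prime⇒nonZero; prime⇒nonTrivial; prime⇒irreducible)
open import Data.Rational using (ℚ; 0ℚ; 1ℚ; ½; mkℚ; ↥_; ↧ₙ_; _+_; _-_; -_; _/_; toℚᵘ) renaming (_*_ to _·_)
import Data.Rational.Properties as ℚ
import Data.Rational.Unnormalised as ℚᵘ
import Data.Rational.Unnormalised.Properties as ℚᵘ
open import Data.Integer as ℤ using (ℤ; +_; ∣_∣) renaming (_*_ to _×ℤ_)
import Data.Integer.Properties as ℤ
import Data.Integer.Tactic.RingSolver as ℤRing
open import Data.Empty using (⊥-elim)
open import Data.List using (List; _∷_; foldr; map; upTo; applyUpTo)
import Data.List.Properties as List
open import Data.Product using (_×_; _,_; proj₁; proj₂; Σ-syntax)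
open import Data.Sum using (_⊎_; inj₁; inj₂)
open import Algebra using (CommutativeMonoid)
open import Relation.Nullary using (¬_)
open import Relation.Nullary.Decidable using (dec⇒maybe)
open import Relation.Binary.Bundles using (Setoid)
import Relation.Binary.Reasoning.Setoid
open import Relation.Binary.PropositionalEquality hiding (setoid)
open import Tactic.RingSolver using (solve-∀)
open import Tactic.RingSolver.Core.AlmostCommutativeRing using (AlmostCommutativeRing; fromCommutativeRing)

-- For an integer a with 1 ≤ a ≤ M the product C(a-1,M) C(-a-1,M) vanishes, so S(a) - S(a-1) is
-- exactly -2/a: hence the main term -2 H_n. The arguments that occur are not integers, but with t =
-- -1/m the point n + p t is -1/m if p = m n + 1, and the mirror image -1 + 1/m if p = m n + m - 1;
-- S takes equal values at a and -1 - a. The perturbation makes a times the product congruent to p t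
-- instead of 0, and expanding 1/a and 1/a² about the integer gives the correction 4 p t H_n^(2).
-- H_n^(2) always comes multiplied by p, so it is needed modulo p only. H_n is needed modulo p², and
-- Lerch's product contains it as p H_n, so the expansion must reach p³. The denominators fit the
-- sequences: for E the shifts by 1 and -1 combine to T² + 1, so steps of 2 and sums over odd
-- numbers arise; for U the operator T² - T + 1 divides T³ + 1, so steps of 3 arise that leave out
-- the multiples of 3. The value at [p/6] needs no third sequence because H_[p/6]^(2) ≡ 5
-- H_[p/3]^(2) modulo p.

ℚ-ring : AlmostCommutativeRing _ _
ℚ-ring = fromCommutativeRing ℚ.+-*-commutativeRing λ x → dec⇒maybe (0ℚ ℚ.≟ x)

-- Integers, naturals and reciprocals inside the rationals

toℚᵘ-/1 : ∀ z → toℚᵘ (z / 1) ℚᵘ.≃ ℚᵘ.mkℚᵘ z 0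
toℚᵘ-/1 z = ℚ.toℚᵘ-fromℚᵘ (ℚᵘ.mkℚᵘ z 0)

/1-+ : ∀ x y → (x ℤ.+ y) / 1 ≡ x / 1 + y / 1
/1-+ x y = ℚ.toℚᵘ-injective (begin
  toℚᵘ ((x ℤ.+ y) / 1)               ≈⟨ toℚᵘ-/1 (x ℤ.+ y) ⟩
  ℚᵘ.mkℚᵘ (x ℤ.+ y) 0                ≈⟨ ℚᵘ.*≡* (lemma x y) ⟩
  ℚᵘ.mkℚᵘ x 0 ℚᵘ.+ ℚᵘ.mkℚᵘ y 0       ≈⟨ ℚᵘ.+-cong (ℚᵘ.≃-sym (toℚᵘ-/1 x)) (ℚᵘ.≃-sym (toℚᵘ-/1 y)) ⟩
  toℚᵘ (x / 1) ℚᵘ.+ toℚᵘ (y / 1)     ≈⟨ ℚᵘ.≃-sym (ℚ.toℚᵘ-homo-+ (x / 1) (y / 1)) ⟩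
  toℚᵘ (x / 1 + y / 1)               ∎)
  where
  open ℚᵘ.≃-Reasoning
  lemma : ∀ x y → (x ℤ.+ y) ×ℤ + 1 ≡ (x ×ℤ + 1 ℤ.+ y ×ℤ + 1) ×ℤ + 1
  lemma = ℤRing.solve-∀

/1-* : ∀ x y → (x ×ℤ y) / 1 ≡ (x / 1) · (y / 1)
/1-* x y = ℚ.toℚᵘ-injective (begin
  toℚᵘ ((x ×ℤ y) / 1)                ≈⟨ toℚᵘ-/1 (x ×ℤ y) ⟩
  ℚᵘ.mkℚᵘ x 0 ℚᵘ.* ℚᵘ.mkℚᵘ y 0       ≈⟨ ℚᵘ.*-cong (ℚᵘ.≃-sym (toℚᵘ-/1 x)) (ℚᵘ.≃-sym (toℚᵘ-/1 y)) ⟩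
  toℚᵘ (x / 1) ℚᵘ.* toℚᵘ (y / 1)     ≈⟨ ℚᵘ.≃-sym (ℚ.toℚᵘ-homo-* (x / 1) (y / 1)) ⟩
  toℚᵘ ((x / 1) · (y / 1))           ∎)
  where open ℚᵘ.≃-Reasoning

/1-neg : ∀ x → (ℤ.- x) / 1 ≡ - (x / 1)
/1-neg x = begin
  (ℤ.- x) / 1                        ≡⟨ shift ((ℤ.- x) / 1) (x / 1) ⟩
  ((ℤ.- x) / 1 + x / 1) - x / 1      ≡⟨ cong (_- x / 1) (sym (/1-+ (ℤ.- x) x)) ⟩
  (ℤ.- x ℤ.+ x) / 1 - x / 1          ≡⟨ cong (λ z → z / 1 - x / 1) (ℤ.+-inverseˡ x) ⟩
  0ℚ - x / 1                         ≡⟨ ℚ.+-identityˡ _ ⟩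
  - (x / 1)                          ∎
  where
  open ≡-Reasoning
  shift : ∀ a b → a ≡ (a + b) - b
  shift = solve-∀ ℚ-ring

/1-injective : ∀ {x y} → x / 1 ≡ y / 1 → x ≡ y
/1-injective {x} {y} eq = begin
  x        ≡⟨ sym (ℤ.*-identityʳ x) ⟩
  x ×ℤ + 1 ≡⟨ ℚᵘ.drop-*≡* (ℚ.fromℚᵘ-injective {x = ℚᵘ.mkℚᵘ x 0} {y = ℚᵘ.mkℚᵘ y 0} eq) ⟩
  y ×ℤ + 1 ≡⟨ ℤ.*-identityʳ y ⟩
  y        ∎
  where open ≡-Reasoning

opaque
  -- Opacity keeps `ι n` an atom for the ring solver; numerals are exchanged for literals through
  -- `ι≡/1` where needed.
  ι : ℕ → ℚ
  ι = ℕ→ℚ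

  ι≡/1 : ∀ n → ι n ≡ + n / 1
  ι≡/1 n = refl

  ι-+ : ∀ m n → ι (m ℕ.+ n) ≡ ι m + ι n
  ι-+ m n = /1-+ (+ m) (+ n)

  ι-* : ∀ m n → ι (m * n) ≡ ι m · ι n
  ι-* m n = trans (cong (_/ 1) (ℤ.pos-* m n)) (/1-* (+ m) (+ n))

ι-suc : ∀ n → ι (suc n) ≡ 1ℚ + ι n
ι-suc n = trans (ι-+ 1 n) (cong (_+ ι n) (ι≡/1 1))

/-·-denominator : ∀ z d .{{_ : NonZero d}} → (z / d) · ι d ≡ z / 1
/-·-denominator z d@(suc d-1) = trans (cong ((z / d) ·_) (ι≡/1 d)) (ℚ.toℚᵘ-injective (begin
  toℚᵘ ((z / d) · (+ d / 1))         ≈⟨ ℚ.toℚᵘ-homo-* (z / d) (+ d / 1) ⟩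
  toℚᵘ (z / d) ℚᵘ.* toℚᵘ (+ d / 1)   ≈⟨ ℚᵘ.*-cong (ℚ.toℚᵘ-fromℚᵘ (ℚᵘ.mkℚᵘ z d-1)) (toℚᵘ-/1 (+ d)) ⟩
  ℚᵘ.mkℚᵘ z d-1 ℚᵘ.* ℚᵘ.mkℚᵘ (+ d) 0 ≈⟨ ℚᵘ.*≡* (trans (lemma z (+ d)) (cong (λ e → z ×ℤ + e) (sym (ℕ.*-identityʳ d)))) ⟩
  ℚᵘ.mkℚᵘ z 0                        ≈⟨ ℚᵘ.≃-sym (toℚᵘ-/1 z) ⟩
  toℚᵘ (z / 1)                       ∎))
  where
  open ℚᵘ.≃-Reasoning
  lemma : ∀ x y → (x ×ℤ y) ×ℤ + 1 ≡ x ×ℤ y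
  lemma = ℤRing.solve-∀

opaque
  -- The value 0 at 0 makes `rec-*` hold for all arguments, so no side conditions accompany it under
  -- sums and products.
  rec : ℕ → ℚ
  rec n = 1 // n

  rec-0 : rec 0 ≡ 0ℚ
  rec-0 = refl

  rec≡// : ∀ n → rec n ≡ 1 // n
  rec≡// n = refl

  ι·rec : ∀ n .{{_ : NonZero n}} → ι n · rec n ≡ 1ℚ
  ι·rec (suc n) = trans (ℚ.*-comm (ι (suc n)) (1 // suc n)) (/-·-denominator (+ 1) (suc n))

·-cancelˡ : ∀ {u v} → u · v ≡ 1ℚ → ∀ {x y} → u · x ≡ u · y → x ≡ y
·-cancelˡ {u} {v} uv≡1 {x} {y} ux≡uy = begin
  x             ≡⟨ step x ⟩
  v · (u · x)   ≡⟨ cong (v ·_) ux≡uy ⟩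
  v · (u · y)   ≡⟨ sym (step y) ⟩
  y             ∎
  where
  open ≡-Reasoning
  assoc : ∀ u v z → v · (u · z) ≡ (u · v) · z
  assoc = solve-∀ ℚ-ring
  step : ∀ z → z ≡ v · (u · z)
  step z = sym (trans (assoc u v z) (trans (cong (_· z) uv≡1) (ℚ.*-identityˡ z)))

ι-cancel : ∀ n .{{_ : NonZero n}} {x y} → ι n · x ≡ ι n · y → x ≡ y
ι-cancel n {x} {y} = ·-cancelˡ {ι n} {rec n} (ι·rec n) {x} {y}

//-rec : ∀ a b → a // b ≡ ι a · rec b
//-rec a zero = sym (trans (cong (ι a ·_) rec-0) (ℚ.*-zeroʳ (ι a)))
//-rec a b@(suc _) = ι-cancel b (begin
  ι b · (a // b)      ≡⟨ ℚ.*-comm (ι b) (a // b) ⟩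
  (a // b) · ι b      ≡⟨ /-·-denominator (+ a) b ⟩
  + a / 1             ≡⟨ sym (ι≡/1 a) ⟩
  ι a                 ≡⟨ sym (ℚ.*-identityʳ (ι a)) ⟩
  ι a · 1ℚ            ≡⟨ cong (ι a ·_) (sym (ι·rec b)) ⟩
  ι a · (ι b · rec b) ≡⟨ swap (ι a) (ι b) (rec b) ⟩
  ι b · (ι a · rec b) ∎)
  where
  open ≡-Reasoning
  swap : ∀ x y z → x · (y · z) ≡ y · (x · z)
  swap = solve-∀ ℚ-ring

rec-* : ∀ m n → rec (m * n) ≡ rec m · rec n
rec-* zero n rewrite rec-0 = sym (ℚ.*-zeroˡ (rec n))
rec-* m@(suc _) zero rewrite ℕ.*-zeroʳ m | rec-0 = sym (ℚ.*-zeroʳ (rec m))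
rec-* m@(suc _) n@(suc _) = ι-cancel (m * n) (begin
  ι (m * n) · rec (m * n)           ≡⟨ ι·rec (m * n) ⟩
  1ℚ · 1ℚ                           ≡⟨ sym (cong₂ _·_ (ι·rec m) (ι·rec n)) ⟩
  (ι m · rec m) · (ι n · rec n)     ≡⟨ interchange (ι m) (rec m) (ι n) (rec n) ⟩
  (ι m · ι n) · (rec m · rec n)     ≡⟨ cong (_· (rec m · rec n)) (sym (ι-* m n)) ⟩
  ι (m * n) · (rec m · rec n)       ∎)
  where
  open ≡-Reasoning
  interchange : ∀ a b c d → (a · b) · (c · d) ≡ (a · c) · (b · d)
  interchange = solve-∀ ℚ-ring

infixr 8 _^ℚ_
_^ℚ_ : ℚ → ℕ → ℚ
x ^ℚ zero  = 1ℚ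
x ^ℚ suc n = x · x ^ℚ n

^ℚ-+ : ∀ x m n → x ^ℚ (m ℕ.+ n) ≡ x ^ℚ m · x ^ℚ n
^ℚ-+ x zero    n = sym (ℚ.*-identityˡ _)
^ℚ-+ x (suc m) n = trans (cong (x ·_) (^ℚ-+ x m n)) (sym (ℚ.*-assoc x (x ^ℚ m) (x ^ℚ n)))

ι-^ : ∀ a n → ι (a ^ n) ≡ ι a ^ℚ n
ι-^ a zero    = ι≡/1 1
ι-^ a (suc n) = trans (ι-* a (a ^ n)) (cong (ι a ·_) (ι-^ a n))

-- Sums and products over initial segments

-- Harmonic sums and Lerch's products undergo the same splittings and reversals, which are therefore
-- proved once for an arbitrary commutative monoid.
module Fold {c} (M : CommutativeMonoid c c) where
  open CommutativeMonoid M using (Carrier; _≈_; _∙_; ε; ∙-cong; ∙-congˡ; ∙-congʳ; assoc; comm; identityˡ; identityʳ)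
    renaming (refl to ≈-refl; sym to ≈-sym; trans to ≈-trans)
  open import Relation.Binary.Reasoning.Setoid (CommutativeMonoid.setoid M)
  open import Algebra.Properties.CommutativeSemigroup (CommutativeMonoid.commutativeSemigroup M) using (interchange)

  fold : ℕ → (ℕ → Carrier) → Carrier
  fold zero    f = ε
  fold (suc n) f = fold n f ∙ f n

  fold-cong : ∀ n {f g : ℕ → Carrier} → (∀ i → i < n → f i ≈ g i) → fold n f ≈ fold n g
  fold-cong zero    eq = ≈-refl
  fold-cong (suc n) eq = ∙-cong (fold-cong n λ i i<n → eq i (ℕ.m<n⇒m<1+n i<n)) (eq n ℕ.≤-refl)

  fold-∙ : ∀ n (f g : ℕ → Carrier) → fold n (λ i → f i ∙ g i) ≈ fold n f ∙ fold n g
  fold-∙ zero    f g = ≈-sym (identityˡ ε)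
  fold-∙ (suc n) f g = ≈-trans (∙-congʳ (fold-∙ n f g)) (interchange _ _ _ _)

  fold-++ : ∀ m n (f : ℕ → Carrier) → fold (m ℕ.+ n) f ≈ fold m f ∙ fold n (λ i → f (m ℕ.+ i))
  fold-++ m zero    f rewrite ℕ.+-identityʳ m = ≈-sym (identityʳ _)
  fold-++ m (suc n) f rewrite ℕ.+-suc m n = ≈-trans (∙-congʳ (fold-++ m n f)) (assoc _ _ _)

  fold-front : ∀ n (f : ℕ → Carrier) → fold (suc n) f ≈ f 0 ∙ fold n (λ i → f (suc i))
  fold-front zero    f = comm ε (f 0)
  fold-front (suc n) f = ≈-trans (∙-congʳ (fold-front n f)) (assoc _ _ _)

  fold-flip : ∀ n (f : ℕ → Carrier) → fold n (λ i → f (suc i)) ≈ fold n (λ i → f (n ∸ i))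
  fold-flip zero    f = ≈-refl
  fold-flip (suc n) f = begin
    fold n (λ i → f (suc i)) ∙ f (suc n)             ≈⟨ comm _ _ ⟩
    f (suc n) ∙ fold n (λ i → f (suc i))             ≈⟨ ∙-congˡ (fold-flip n f) ⟩
    f (suc n) ∙ fold n (λ i → f (n ∸ i))     ≈⟨ ≈-sym (fold-front n (λ i → f (suc n ∸ i))) ⟩
    fold (suc n) (λ i → f (suc n ∸ i))       ∎

  -- Relating i and j by i + j = n avoids truncated subtraction: i runs up from 0 to n - 1 while j
  -- runs down from n to 1.
  fold-reflect : ∀ n {f g : ℕ → Carrier} → (∀ i j → i ℕ.+ j ≡ n → f i ≈ g j) → fold n f ≈ fold n (λ i → g (suc i))
  fold-reflect n {f} {g} eq = ≈-trans
    (fold-cong n λ i i<n → eq i (n ∸ i) (ℕ.m+[n∸m]≡n (ℕ.<⇒≤ i<n)))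
    (≈-sym (fold-flip n g))

  fold-2* : ∀ n (f : ℕ → Carrier) → fold (2 * n) f ≈ fold n (λ i → f (2 * i)) ∙ fold n (λ i → f (suc (2 * i)))
  fold-2* zero    f = ≈-sym (identityˡ ε)
  fold-2* (suc n) f rewrite ℕ.+-suc n (n ℕ.+ 0) = begin
    (fold (2 * n) f ∙ f (2 * n)) ∙ f (suc (2 * n))   ≈⟨ assoc _ _ _ ⟩
    fold (2 * n) f ∙ (f (2 * n) ∙ f (suc (2 * n)))   ≈⟨ ∙-congʳ (fold-2* n f) ⟩
    (fold n (λ i → f (2 * i)) ∙ fold n (λ i → f (suc (2 * i)))) ∙ (f (2 * n) ∙ f (suc (2 * n)))
      ≈⟨ interchange _ _ _ _ ⟩
    (fold n (λ i → f (2 * i)) ∙ f (2 * n)) ∙ (fold n (λ i → f (suc (2 * i))) ∙ f (suc (2 * n))) ∎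

  fold-3* : ∀ n (f : ℕ → Carrier) → fold (3 * n) f ≈
    (fold n (λ i → f (3 * i)) ∙ fold n (λ i → f (suc (3 * i)))) ∙ fold n (λ i → f (suc (suc (3 * i))))
  fold-3* zero    f = ≈-sym (≈-trans (identityʳ _) (identityˡ ε))
  fold-3* (suc n) f rewrite ℕ.+-suc n (n ℕ.+ 0) | ℕ.+-suc n (suc (n ℕ.+ (n ℕ.+ 0))) | ℕ.+-suc n (n ℕ.+ (n ℕ.+ 0)) = begin
    ((fold (3 * n) f ∙ f (3 * n)) ∙ f (suc (3 * n))) ∙ f (suc (suc (3 * n)))
      ≈⟨ ∙-congʳ (≈-trans (assoc _ _ _) (∙-congʳ (fold-3* n f))) ⟩
    (((_ ∙ _) ∙ _) ∙ (f (3 * n) ∙ f (suc (3 * n)))) ∙ f (suc (suc (3 * n)))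
      ≈⟨ ≈-trans (assoc _ _ _) (∙-congˡ (comm _ _)) ⟩
    ((_ ∙ _) ∙ _) ∙ (f (suc (suc (3 * n))) ∙ (f (3 * n) ∙ f (suc (3 * n))))
      ≈⟨ ≈-trans (assoc _ _ _) (∙-congˡ (≈-sym (assoc _ _ _))) ⟩
    (_ ∙ _) ∙ ((_ ∙ f (suc (suc (3 * n)))) ∙ (f (3 * n) ∙ f (suc (3 * n))))
      ≈⟨ ∙-congˡ (comm _ _) ⟩
    (_ ∙ _) ∙ ((f (3 * n) ∙ f (suc (3 * n))) ∙ (_ ∙ f (suc (suc (3 * n)))))
      ≈⟨ ≈-sym (assoc _ _ _) ⟩
    ((_ ∙ _) ∙ (f (3 * n) ∙ f (suc (3 * n)))) ∙ (_ ∙ f (suc (suc (3 * n))))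
      ≈⟨ ∙-congʳ (interchange _ _ _ _) ⟩
    ((fold n (λ i → f (3 * i)) ∙ f (3 * n)) ∙ (fold n (λ i → f (suc (3 * i))) ∙ f (suc (3 * n)))) ∙ (fold n (λ i → f (suc (suc (3 * i)))) ∙ f (suc (suc (3 * n)))) ∎

module Sum = Fold ℚ.+-0-commutativeMonoid
module Prod = Fold ℚ.*-1-commutativeMonoid

∑ ∏ : ℕ → (ℕ → ℚ) → ℚ
∑ = Sum.fold
∏ = Prod.fold

∑-scale : ∀ n a (f : ℕ → ℚ) → ∑ n (λ i → a · f i) ≡ a · ∑ n f
∑-scale zero    a f = sym (ℚ.*-zeroʳ a)
∑-scale (suc n) a f = trans (cong (_+ a · f n) (∑-scale n a f)) (sym (ℚ.*-distribˡ-+ a (∑ n f) (f n)))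

∑-linear : ∀ n a b (f g : ℕ → ℚ) → ∑ n (λ i → a · f i + b · g i) ≡ a · ∑ n f + b · ∑ n g
∑-linear n a b f g = trans (Sum.fold-∙ n _ _) (cong₂ _+_ (∑-scale n a f) (∑-scale n b g))

∑-tail : ∀ l m (f : ℕ → ℚ) → ∑ m (λ i → f (l ℕ.+ i)) ≡ ∑ (l ℕ.+ m) f - ∑ l f
∑-tail l m f = trans (lemma (∑ l f) _) (cong (_- ∑ l f) (sym (Sum.fold-++ l m f)))
  where
  lemma : ∀ a b → b ≡ (a + b) - a
  lemma = solve-∀ ℚ-ring

∏-const : ∀ n c → ∏ n (λ _ → c) ≡ c ^ℚ n
∏-const zero    c = refl
∏-const (suc n) c = trans (cong (_· c) (∏-const n c)) (ℚ.*-comm (c ^ℚ n) c)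

∏-unit : ∀ n → ∏ n (λ i → ι (suc i)) · ∏ n (λ i → rec (suc i)) ≡ 1ℚ
∏-unit zero    = refl
∏-unit (suc n) = trans (interchange (∏ n (λ i → ι (suc i))) (ι (suc n)) (∏ n (λ i → rec (suc i))) (rec (suc n))) (cong₂ _·_ (∏-unit n) (ι·rec (suc n)))
  where
  interchange : ∀ a b c d → (a · b) · (c · d) ≡ (a · c) · (b · d)
  interchange = solve-∀ ℚ-ring

-- Harmonic numbers of order one and two, and their splitting by parity

2ℚ 3ℚ 4ℚ 6ℚ ⅓ ¼ : ℚ
2ℚ = + 2 / 1
3ℚ = + 3 / 1
4ℚ = + 4 / 1
6ℚ = + 6 / 1
⅓ = + 1 / 3
¼ = + 1 / 4

rec² : ℕ → ℚ
rec² n = rec n · rec n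

H H² : ℕ → ℚ
H n  = ∑ n λ i → rec (suc i)
H² n = ∑ n λ i → rec² (suc i)

rec-2* : ∀ n → rec (2 * n) ≡ ½ · rec n
rec-2* n = trans (rec-* 2 n) (cong (_· rec n) (rec≡// 2))

rec²-2* : ∀ n → rec² (2 * n) ≡ ¼ · rec² n
rec²-2* n = trans (cong₂ _·_ (rec-2* n) (rec-2* n)) (lemma (rec n))
  where
  lemma : ∀ x → (½ · x) · (½ · x) ≡ ¼ · (x · x)
  lemma = solve-∀ ℚ-ring

-- Among 1, …, n there are e even and o odd numbers.
data Halves : ℕ → ℕ → ℕ → Set where
  even : ∀ n → Halves (2 * n) n n
  odd  : ∀ n → Halves (suc (2 * n)) n (suc n)

∑-halves : ∀ {n e o} → Halves n e o → (f : ℕ → ℚ) →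
  ∑ n (λ i → f (suc i)) ≡ ∑ e (λ i → f (2 * suc i)) + ∑ o (λ i → f (suc (2 * i)))
∑-halves (even n) f = begin
  ∑ (2 * n) (λ i → f (suc i))                                           ≡⟨ Sum.fold-2* n _ ⟩
  ∑ n (λ i → f (suc (2 * i))) + ∑ n (λ i → f (suc (suc (2 * i))))       ≡⟨ ℚ.+-comm (∑ n (λ i → f (suc (2 * i)))) (∑ n (λ i → f (suc (suc (2 * i))))) ⟩
  ∑ n (λ i → f (suc (suc (2 * i)))) + ∑ n (λ i → f (suc (2 * i)))
    ≡⟨ cong (_+ ∑ n (λ i → f (suc (2 * i)))) (Sum.fold-cong n λ i _ → cong f (lemma i)) ⟩
  ∑ n (λ i → f (2 * suc i)) + ∑ n (λ i → f (suc (2 * i)))               ∎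
  where
  open ≡-Reasoning
  lemma : ∀ i → suc (suc (2 * i)) ≡ 2 * suc i
  lemma = ℕRing.solve-∀
∑-halves (odd n) f = trans (cong (_+ f (suc (2 * n))) (∑-halves (even n) f)) (ℚ.+-assoc (∑ n (λ i → f (2 * suc i))) (∑ n (λ i → f (suc (2 * i)))) (f (suc (2 * n))))

-- Congruences modulo powers of p in the ring of p-integral rationals

module Local (p : ℕ) (p-prime : Prime p) where

  instance
    p≢0 : NonZero p
    p≢0 = prime⇒nonZero p-prime

  P : ℚ
  P = ι p

  -- Membership in the localisation of the integers at p. The fraction need not be in lowest terms,
  -- so sums and products simply multiply denominators, and Euclid's lemma keeps p out of them.
  record Int (x : ℚ) : Set where
    constructor int
    field
      numerator     : ℤ
      denominator   : ℕ
      p∤denominator : ¬ p ∣ denominator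
      equation      : x · ι denominator ≡ numerator / 1

  p∤1 : ¬ p ∣ 1
  p∤1 p∣1 with refl ← ℕ.∣1⇒≡1 p∣1 = ℕ.nonTrivial⇒≢1 {{prime⇒nonTrivial p-prime}} refl

  ∤⇒NonZero : ∀ {n} → ¬ p ∣ n → NonZero n
  ∤⇒NonZero {zero}  p∤0 = ⊥-elim (p∤0 (p ℕ.∣0))
  ∤⇒NonZero {suc n} _   = _

  ∤-* : ∀ {m n} → ¬ p ∣ m → ¬ p ∣ n → ¬ p ∣ m * n
  ∤-* {m} {n} p∤m p∤n p∣mn with euclidsLemma m n p-prime p∣mn
  ... | inj₁ p∣m = p∤m p∣m
  ... | inj₂ p∣n = p∤n p∣n

  ∤-< : ∀ {n} .{{_ : NonZero n}} → n < p → ¬ p ∣ n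
  ∤-< n<p p∣n = ℕ.<⇒≱ n<p (ℕ.∣⇒≤ p∣n)

  Int-/ : ∀ z d .{{_ : NonZero d}} → ¬ p ∣ d → Int (z / d)
  Int-/ z d p∤d = int z d p∤d (/-·-denominator z d)

  Int-/1 : ∀ z → Int (z / 1)
  Int-/1 z = Int-/ z 1 p∤1

  Int-ι : ∀ n → Int (ι n)
  Int-ι n = subst Int (sym (ι≡/1 n)) (Int-/1 (+ n))

  Int-0 : Int 0ℚ
  Int-0 = Int-/1 (+ 0)

  Int-1 : Int 1ℚ
  Int-1 = Int-/1 (+ 1)

  Int-rec : ∀ {n} → ¬ p ∣ n → Int (rec n)
  Int-rec {n} p∤n = int (+ 1) n p∤n (trans (ℚ.*-comm (rec n) (ι n)) (ι·rec n {{∤⇒NonZero p∤n}}))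

  Int-+ : ∀ {x y} → Int x → Int y → Int (x + y)
  Int-+ {x} {y} (int a b p∤b xb≡a) (int c d p∤d yd≡c) = int (a ×ℤ + d ℤ.+ c ×ℤ + b) (b * d) (∤-* p∤b p∤d) (begin
    (x + y) · ι (b * d)                             ≡⟨ cong ((x + y) ·_) (ι-* b d) ⟩
    (x + y) · (ι b · ι d)                           ≡⟨ expand x y (ι b) (ι d) ⟩
    (x · ι b) · ι d + (y · ι d) · ι b               ≡⟨ cong₂ (λ u v → u · ι d + v · ι b) xb≡a yd≡c ⟩
    (a / 1) · ι d + (c / 1) · ι b                   ≡⟨ cong₂ (λ u v → (a / 1) · u + (c / 1) · v) (ι≡/1 d) (ι≡/1 b) ⟩
    (a / 1) · (+ d / 1) + (c / 1) · (+ b / 1)       ≡⟨ sym (cong₂ _+_ (/1-* a (+ d)) (/1-* c (+ b))) ⟩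
    (a ×ℤ + d) / 1 + (c ×ℤ + b) / 1                 ≡⟨ sym (/1-+ (a ×ℤ + d) (c ×ℤ + b)) ⟩
    (a ×ℤ + d ℤ.+ c ×ℤ + b) / 1                     ∎)
    where
    open ≡-Reasoning
    expand : ∀ x y b d → (x + y) · (b · d) ≡ (x · b) · d + (y · d) · b
    expand = solve-∀ ℚ-ring

  Int-· : ∀ {x y} → Int x → Int y → Int (x · y)
  Int-· {x} {y} (int a b p∤b xb≡a) (int c d p∤d yd≡c) = int (a ×ℤ c) (b * d) (∤-* p∤b p∤d) (begin
    (x · y) · ι (b * d)         ≡⟨ cong ((x · y) ·_) (ι-* b d) ⟩
    (x · y) · (ι b · ι d)       ≡⟨ expand x y (ι b) (ι d) ⟩
    (x · ι b) · (y · ι d)       ≡⟨ cong₂ _·_ xb≡a yd≡c ⟩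
    (a / 1) · (c / 1)           ≡⟨ sym (/1-* a c) ⟩
    (a ×ℤ c) / 1                ∎)
    where
    open ≡-Reasoning
    expand : ∀ x y b d → (x · y) · (b · d) ≡ (x · b) · (y · d)
    expand = solve-∀ ℚ-ring

  Int-neg : ∀ {x} → Int x → Int (- x)
  Int-neg {x} (int a b p∤b xb≡a) = int (ℤ.- a) b p∤b
    (trans (sym (ℚ.neg-distribˡ-* x (ι b))) (trans (cong -_ xb≡a) (sym (/1-neg a))))

  Int-- : ∀ {x y} → Int x → Int y → Int (x - y)
  Int-- ix iy = Int-+ ix (Int-neg iy)

  Int-^ : ∀ {x} n → Int x → Int (x ^ℚ n)
  Int-^ zero    ix = Int-1
  Int-^ (suc n) ix = Int-· ix (Int-^ n ix)

  Int-∑ : ∀ n {f : ℕ → ℚ} → (∀ i → i < n → Int (f i)) → Int (∑ n f)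
  Int-∑ zero    i = Int-0
  Int-∑ (suc n) i = Int-+ (Int-∑ n λ j j<n → i j (ℕ.m<n⇒m<1+n j<n)) (i n ℕ.≤-refl)

  -- The ideal generated by p^k in the p-integral rationals; for k = 0 it is the whole ring.
  record Small (k : ℕ) (z : ℚ) : Set where
    constructor small
    field
      quotient : ℚ
      integral : Int quotient
      equation : z ≡ P ^ℚ k · quotient

  Small-resp : ∀ {k x y} → x ≡ y → Small k y → Small k x
  Small-resp refl s = s

  Int⇒Small : ∀ {z} → Int z → Small 0 z
  Int⇒Small {z} iz = small z iz (sym (ℚ.*-identityˡ z))

  Small⇒Int : ∀ {k z} → Small k z → Int z
  Small⇒Int {k} (small w iw refl) = Int-· (Int-^ k (Int-ι p)) iw

  Small-0 : ∀ {k} → Small k 0ℚ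
  Small-0 {k} = small 0ℚ Int-0 (sym (ℚ.*-zeroʳ (P ^ℚ k)))

  Small-P : Small 1 P
  Small-P = small 1ℚ Int-1 (lemma P)
    where
    lemma : ∀ P → P ≡ (P · 1ℚ) · 1ℚ
    lemma = solve-∀ ℚ-ring

  Small-+ : ∀ {k x y} → Small k x → Small k y → Small k (x + y)
  Small-+ {k} (small u iu refl) (small v iv refl) = small (u + v) (Int-+ iu iv) (sym (ℚ.*-distribˡ-+ (P ^ℚ k) u v))

  Small-neg : ∀ {k x} → Small k x → Small k (- x)
  Small-neg {k} (small u iu refl) = small (- u) (Int-neg iu) (ℚ.neg-distribʳ-* (P ^ℚ k) u)

  Small-· : ∀ {j k x y} → Small j x → Small k y → Small (j ℕ.+ k) (x · y)
  Small-· {j} {k} (small u iu refl) (small v iv refl) = small (u · v) (Int-· iu iv)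
    (trans (interchange (P ^ℚ j) u (P ^ℚ k) v) (cong (_· (u · v)) (sym (^ℚ-+ P j k))))
    where
    interchange : ∀ a b c d → (a · b) · (c · d) ≡ (a · c) · (b · d)
    interchange = solve-∀ ℚ-ring

  Small-Int· : ∀ {k c z} → Int c → Small k z → Small k (c · z)
  Small-Int· ic s = Small-· (Int⇒Small ic) s

  Small-P· : ∀ {k z} → Small k z → Small (suc k) (P · z)
  Small-P· s = Small-· Small-P s

  Small-cancel-P : ∀ {k z} → Small (suc k) (P · z) → Small k z
  Small-cancel-P {k} {z} (small w iw eq) = small w iw (ι-cancel p (trans eq (ℚ.*-assoc P (P ^ℚ k) w)))

  Small-pred : ∀ {k z} → Small (suc k) z → Small k z
  Small-pred {k} (small w iw refl) = small (P · w) (Int-· (Int-ι p) iw) (lemma P (P ^ℚ k) w)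
    where
    lemma : ∀ p q w → (p · q) · w ≡ q · (p · w)
    lemma = solve-∀ ℚ-ring

  infix 4 _~[_]_
  -- A record rather than a synonym for `Small k (x - y)`: subtraction is not injective, so x and y
  -- could not be inferred from the difference.
  record _~[_]_ (x : ℚ) (k : ℕ) (y : ℚ) : Set where
    constructor by
    field difference : Small k (x - y)
  open _~[_]_ public

  ~-reflexive : ∀ {k x y} → x ≡ y → x ~[ k ] y
  ~-reflexive {x = x} refl = by (Small-resp (ℚ.+-inverseʳ x) Small-0)

  ~-refl : ∀ {k x} → x ~[ k ] x
  ~-refl = ~-reflexive refl

  ~-sym : ∀ {k x y} → x ~[ k ] y → y ~[ k ] x
  ~-sym {x = x} {y} (by s) = by (Small-resp (lemma x y) (Small-neg s))
    where
    lemma : ∀ x y → y - x ≡ - (x - y)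
    lemma = solve-∀ ℚ-ring

  ~-trans : ∀ {k x y z} → x ~[ k ] y → y ~[ k ] z → x ~[ k ] z
  ~-trans {x = x} {y} {z} (by s) (by t) = by (Small-resp (lemma x y z) (Small-+ s t))
    where
    lemma : ∀ x y z → x - z ≡ (x - y) + (y - z)
    lemma = solve-∀ ℚ-ring

  ~-+ : ∀ {k x x' y y'} → x ~[ k ] x' → y ~[ k ] y' → x + y ~[ k ] x' + y'
  ~-+ {x = x} {x'} {y} {y'} (by s) (by t) = by (Small-resp (lemma x x' y y') (Small-+ s t))
    where
    lemma : ∀ x x' y y' → (x + y) - (x' + y') ≡ (x - x') + (y - y')
    lemma = solve-∀ ℚ-ring

  ~-neg : ∀ {k x x'} → x ~[ k ] x' → - x ~[ k ] - x'
  ~-neg {x = x} {x'} (by s) = by (Small-resp (lemma x x') (Small-neg s))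
    where
    lemma : ∀ x x' → - x - (- x') ≡ - (x - x')
    lemma = solve-∀ ℚ-ring

  ~-- : ∀ {k x x' y y'} → x ~[ k ] x' → y ~[ k ] y' → x - y ~[ k ] x' - y'
  ~-- s t = ~-+ s (~-neg t)

  ~-·ˡ : ∀ {k c x y} → Int c → x ~[ k ] y → c · x ~[ k ] c · y
  ~-·ˡ {c = c} {x} {y} ic (by s) = by (Small-resp (lemma c x y) (Small-Int· ic s))
    where
    lemma : ∀ c x y → c · x - c · y ≡ c · (x - y)
    lemma = solve-∀ ℚ-ring

  ~-·ʳ : ∀ {k c x y} → Int c → x ~[ k ] y → x · c ~[ k ] y · c
  ~-·ʳ {c = c} {x} {y} ic s = subst₂ (_~[ _ ]_) (ℚ.*-comm c x) (ℚ.*-comm c y) (~-·ˡ ic s)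

  ~-· : ∀ {k x x' y y'} → Int x → Int y' → x ~[ k ] x' → y ~[ k ] y' → x · y ~[ k ] x' · y'
  ~-· ix iy' s t = ~-trans (~-·ˡ ix t) (~-·ʳ iy' s)

  ~-P· : ∀ {k x y} → x ~[ k ] y → P · x ~[ suc k ] P · y
  ~-P· {x = x} {y} (by s) = by (Small-resp (lemma P x y) (Small-P· s))
    where
    lemma : ∀ c x y → c · x - c · y ≡ c · (x - y)
    lemma = solve-∀ ℚ-ring

  -- Dividing by p costs one power of the modulus.
  ~-cancel-P : ∀ {k x y} → P · x ~[ suc k ] P · y → x ~[ k ] y
  ~-cancel-P {x = x} {y} (by s) = by (Small-cancel-P (Small-resp (lemma P x y) s))
    where
    lemma : ∀ c x y → c · (x - y) ≡ c · x - c · y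
    lemma = solve-∀ ℚ-ring

  ~-cancel-unit : ∀ {k u v x y} → Int v → u · v ≡ 1ℚ → u · x ~[ k ] u · y → x ~[ k ] y
  ~-cancel-unit {k} {u} {v} {x} {y} iv uv≡1 s = subst₂ (_~[ k ]_) (absorb x) (absorb y) (~-·ˡ iv s)
    where
    assoc : ∀ u v z → v · (u · z) ≡ (u · v) · z
    assoc = solve-∀ ℚ-ring
    absorb : ∀ z → v · (u · z) ≡ z
    absorb z = trans (assoc u v z) (trans (cong (_· z) uv≡1) (ℚ.*-identityˡ z))

  ~-cancel-ι : ∀ {k n x y} → ¬ p ∣ n → ι n · x ~[ k ] ι n · y → x ~[ k ] y
  ~-cancel-ι {n = n} {x} {y} p∤n = ~-cancel-unit {u = ι n} {x = x} {y} (Int-rec p∤n) (ι·rec n {{∤⇒NonZero p∤n}})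

  ~-pred : ∀ {k x y} → x ~[ suc k ] y → x ~[ k ] y
  ~-pred (by s) = by (Small-pred s)

  ~-Int : ∀ {k x y} → x ~[ k ] y → Int y → Int x
  ~-Int {x = x} {y} (by s) iy = subst Int (lemma x y) (Int-+ (Small⇒Int s) iy)
    where
    lemma : ∀ x y → (x - y) + y ≡ x
    lemma = solve-∀ ℚ-ring

  ~-^ : ∀ {k x y} n → Int x → Int y → x ~[ k ] y → x ^ℚ n ~[ k ] y ^ℚ n
  ~-^ zero    ix iy s = ~-refl
  ~-^ (suc n) ix iy s = ~-· ix (Int-^ n iy) s (~-^ n ix iy s)

  ~-∑ : ∀ {k} n {f g : ℕ → ℚ} → (∀ i → i < n → f i ~[ k ] g i) → ∑ n f ~[ k ] ∑ n g
  ~-∑ zero    eq = ~-refl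
  ~-∑ (suc n) eq = ~-+ (~-∑ n λ i i<n → eq i (ℕ.m<n⇒m<1+n i<n)) (eq n ℕ.≤-refl)

  ~-setoid : ℕ → Setoid _ _
  ~-setoid k = record
    { Carrier = ℚ
    ; _≈_ = _~[ k ]_
    ; isEquivalence = record { refl = ~-refl ; sym = ~-sym ; trans = ~-trans }
    }

  module ~-Reasoning (k : ℕ) = Relation.Binary.Reasoning.Setoid (~-setoid k)

  -- Most congruences below are linear combinations of known ones. Once the difference of the two
  -- sides is written as a sum of known differences, only a ring identity is left to the solver.
  ~-combine : ∀ {k a b c d x y} → x - y ≡ (a - b) + (c - d) → a ~[ k ] b → c ~[ k ] d → x ~[ k ] y
  ~-combine eq (by s) (by t) = by (Small-resp eq (Small-+ s t))

  ~-transport : ∀ {k a b x y} → x - y ≡ a - b → a ~[ k ] b → x ~[ k ] y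
  ~-transport eq (by s) = by (Small-resp eq s)

  private
    -- The cofactor equation is returned together with the divisibility so that a second factor p
    -- can be split off in the same way.
    ∣ℕ : ∀ {m n k} → m ≡ p * k → ¬ p ∣ n → ∀ r → r * n ≡ m → Σ[ r' ∈ ℕ ] r ≡ p * r' × r' * n ≡ k
    ∣ℕ {m} {n} {k} m≡pk p∤n r rn≡m with euclidsLemma r n p-prime (divides k (trans rn≡m (trans m≡pk (ℕ.*-comm p k))))
    ... | inj₂ p∣n = ⊥-elim (p∤n p∣n)
    ... | inj₁ (divides r' refl) = r' , ℕ.*-comm r' p , ℕ.*-cancelˡ-≡ (r' * n) k p
        (trans (lemma p r' n) (trans rn≡m m≡pk))
      where
      lemma : ∀ p r n → p * (r * n) ≡ r * p * n
      lemma = ℕRing.solve-∀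

  -- Comparing the reduced fraction n/d with the p-integral representation gives n b = p² a d up to
  -- sign, with b prime to p, so Euclid's lemma applies twice. As p then divides n, lowest terms
  -- keep it out of d.
  ~⇒≡[mod²] : ∀ {x y} → x ~[ 2 ] y → x ≡ y [mod p ^ 2 ]
  ~⇒≡[mod²] {x} {y} (by (small w (int a b p∤b wb≡a) eq)) = p²∣n , p∤d
    where
    r = x - y
    n = ∣ ↥ r ∣
    d = ↧ₙ r
    open ≡-Reasoning
    rd≡n : r · ι d ≡ ↥ r / 1
    rd≡n = subst (λ q → q · ι d ≡ ↥ r / 1) (ℚ.↥p/↧p≡p r) (/-·-denominator (↥ r) d)
    swap : ∀ a b c → (a · b) · c ≡ (a · c) · b
    swap = solve-∀ ℚ-ring
    regroup : ∀ P w b → ((P · (P · 1ℚ)) · w) · b ≡ (P · P) · (w · b)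
    regroup = solve-∀ ℚ-ring
    toℚ : (↥ r ×ℤ + b) / 1 ≡ ((+ (p * p) ×ℤ a) ×ℤ + d) / 1
    toℚ = begin
      (↥ r ×ℤ + b) / 1                     ≡⟨ /1-* (↥ r) (+ b) ⟩
      (↥ r / 1) · (+ b / 1)                ≡⟨ cong₂ _·_ (sym rd≡n) (sym (ι≡/1 b)) ⟩
      (r · ι d) · ι b                      ≡⟨ swap r (ι d) (ι b) ⟩
      (r · ι b) · ι d                      ≡⟨ cong (λ z → (z · ι b) · ι d) eq ⟩
      (((P · (P · 1ℚ)) · w) · ι b) · ι d   ≡⟨ cong (_· ι d) (regroup P w (ι b)) ⟩
      ((P · P) · (w · ι b)) · ι d          ≡⟨ cong₂ (λ u v → (u · v) · ι d) (trans (sym (ι-* p p)) (ι≡/1 (p * p))) wb≡a ⟩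
      ((+ (p * p) / 1) · (a / 1)) · ι d    ≡⟨ cong₂ _·_ (sym (/1-* (+ (p * p)) a)) (ι≡/1 d) ⟩
      ((+ (p * p) ×ℤ a) / 1) · (+ d / 1)   ≡⟨ sym (/1-* (+ (p * p) ×ℤ a) (+ d)) ⟩
      ((+ (p * p) ×ℤ a) ×ℤ + d) / 1        ∎
    nb≡ : n * b ≡ p * (p * (∣ a ∣ * d))
    nb≡ = begin
      n * b                                ≡⟨ sym (ℤ.abs-* (↥ r) (+ b)) ⟩
      ∣ ↥ r ×ℤ + b ∣                       ≡⟨ cong ∣_∣ (/1-injective {↥ r ×ℤ + b} {(+ (p * p) ×ℤ a) ×ℤ + d} toℚ) ⟩
      ∣ (+ (p * p) ×ℤ a) ×ℤ + d ∣          ≡⟨ ℤ.abs-* (+ (p * p) ×ℤ a) (+ d) ⟩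
      ∣ + (p * p) ×ℤ a ∣ * d               ≡⟨ cong (_* d) (ℤ.abs-* (+ (p * p)) a) ⟩
      p * p * ∣ a ∣ * d                    ≡⟨ lemma p ∣ a ∣ d ⟩
      p * (p * (∣ a ∣ * d))                ∎
      where
      lemma : ∀ p a d → p * p * a * d ≡ p * (p * (a * d))
      lemma = ℕRing.solve-∀
    first = ∣ℕ refl p∤b n nb≡
    second = ∣ℕ refl p∤b (proj₁ first) (proj₂ (proj₂ first))
    p²∣n : p ^ 2 ∣ n
    p²∣n = divides (proj₁ second) (begin
      n                           ≡⟨ proj₁ (proj₂ first) ⟩
      p * proj₁ first             ≡⟨ cong (p *_) (proj₁ (proj₂ second)) ⟩
      p * (p * proj₁ second)      ≡⟨ lemma p (proj₁ second) ⟩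
      proj₁ second * p ^ 2        ∎)
      where
      lemma : ∀ p s → p * (p * s) ≡ s * (p * (p * 1))
      lemma = ℕRing.solve-∀
    coprime : ∀ q → Coprime ∣ ↥ q ∣ (↧ₙ q)
    coprime (mkℚ _ _ c) = recompute c
    p∤d : ¬ p ∣ d
    p∤d p∣d = p∤1 (subst (p ∣_) (coprime r (p∣n , p∣d)) (ℕ.∣-refl {p}))
      where
      p∣n : p ∣ n
      p∣n = divides (proj₁ first) (trans (proj₁ (proj₂ first)) (ℕ.*-comm p (proj₁ first)))

-- Harmonic sums

module Harmonic (p : ℕ) (p-prime : Prime p) (M : ℕ) (p≡ : p ≡ suc (2 * M)) (3<p : 3 < p) where
  open Local p p-prime public

  p∤2 : ¬ p ∣ 2
  p∤2 = ∤-< (ℕ.<-trans (ℕ.n<1+n 2) 3<p)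

  p∤3 : ¬ p ∣ 3
  p∤3 = ∤-< 3<p

  p∤4 : ¬ p ∣ 4
  p∤4 = ∤-* {2} {2} p∤2 p∤2

  Int-½ : Int ½
  Int-½ = Int-/ (+ 1) 2 p∤2

  Int-⅓ : Int ⅓
  Int-⅓ = Int-/ (+ 1) 3 p∤3

  Int-¼ : Int ¼
  Int-¼ = Int-/ (+ 1) 4 p∤4

  ∤-suc : ∀ {i} → i < 2 * M → ¬ p ∣ suc i
  ∤-suc i<2M = ∤-< (subst (_ <_) (sym p≡) (s<s i<2M))

  Int-rec-suc : ∀ {n} → n ≤ 2 * M → ∀ i → i < n → Int (rec (suc i))
  Int-rec-suc n≤2M i i<n = Int-rec (∤-suc (ℕ.≤-trans i<n n≤2M))

  Int-rec² : ∀ {n} → ¬ p ∣ n → Int (rec² n)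
  Int-rec² p∤n = Int-· (Int-rec p∤n) (Int-rec p∤n)

  Int-H : ∀ {n} → n ≤ 2 * M → Int (H n)
  Int-H {n} n≤2M = Int-∑ n (Int-rec-suc n≤2M)

  Int-H² : ∀ {n} → n ≤ 2 * M → Int (H² n)
  Int-H² {n} n≤2M = Int-∑ n λ i i<n → Int-· (Int-rec-suc n≤2M i i<n) (Int-rec-suc n≤2M i i<n)

  ∤-complement : ∀ {k l} → k ℕ.+ l ≡ p → ¬ p ∣ k → ¬ p ∣ l
  ∤-complement {k} {l} k+l≡p p∤k p∣l =
    p∤k (ℕ.∣m+n∣m⇒∣n (subst (p ∣_) (trans (sym k+l≡p) (ℕ.+-comm k l)) ℕ.∣-refl) p∣l)

  rec-+-rec : ∀ {k l} → k ℕ.+ l ≡ p → ¬ p ∣ k → rec k + rec l ≡ P · (rec k · rec l)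
  rec-+-rec {k} {l} k+l≡p p∤k = begin
    rec k + rec l                                             ≡⟨ cong₂ _+_ (sym (ℚ.*-identityʳ (rec k))) (sym (ℚ.*-identityʳ (rec l))) ⟩
    rec k · 1ℚ + rec l · 1ℚ                                   ≡⟨ cong₂ (λ u v → rec k · u + rec l · v) (sym (ι·rec l {{∤⇒NonZero (∤-complement k+l≡p p∤k)}})) (sym (ι·rec k {{∤⇒NonZero p∤k}})) ⟩
    rec k · (ι l · rec l) + rec l · (ι k · rec k)             ≡⟨ lemma (rec k) (rec l) (ι k) (ι l) ⟩
    (ι k + ι l) · (rec k · rec l)                             ≡⟨ cong (_· (rec k · rec l)) (trans (sym (ι-+ k l)) (cong ι k+l≡p)) ⟩
    P · (rec k · rec l)                                       ∎
    where
    open ≡-Reasoning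
    lemma : ∀ x y k l → x · (l · y) + y · (k · x) ≡ (k + l) · (x · y)
    lemma = solve-∀ ℚ-ring

  rec-reflect₁ : ∀ k l → k ℕ.+ l ≡ p → ¬ p ∣ k → rec k ~[ 1 ] - rec l
  rec-reflect₁ k l k+l≡p p∤k = by (Small-resp (trans (lemma (rec k) (rec l)) (rec-+-rec k+l≡p p∤k))
    (Small-P· (Int⇒Small (Int-· (Int-rec p∤k) (Int-rec (∤-complement k+l≡p p∤k))))))
    where
    lemma : ∀ x y → x - (- y) ≡ x + y
    lemma = solve-∀ ℚ-ring

  -- In the exact formula 1/k = -1/l + p/(k l) the last 1/k carries a factor p and may be replaced
  -- by -1/l.
  rec-reflect₂ : ∀ k l → k ℕ.+ l ≡ p → ¬ p ∣ k → rec k ~[ 2 ] - rec l - P · rec² l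
  rec-reflect₂ k l k+l≡p p∤k = by (Small-resp
    (trans (expand (rec k) (rec l) P) (trans (cong (_+ P · rec² l) (rec-+-rec k+l≡p p∤k)) (factor (rec k) (rec l) P)))
    (Small-P· (Small-Int· (Int-rec (∤-complement k+l≡p p∤k)) (difference (rec-reflect₁ k l k+l≡p p∤k)))))
    where
    expand : ∀ x y P → x - (- y - P · (y · y)) ≡ (x + y) + P · (y · y)
    expand = solve-∀ ℚ-ring
    factor : ∀ x y P → P · (x · y) + P · (y · y) ≡ P · (y · (x - (- y)))
    factor = solve-∀ ℚ-ring

  rec²-reflect : ∀ k l → k ℕ.+ l ≡ p → ¬ p ∣ k → rec² k ~[ 1 ] rec² l
  rec²-reflect k l k+l≡p p∤k = ~-trans
    (~-· (Int-rec p∤k) (Int-neg (Int-rec (∤-complement k+l≡p p∤k))) (rec-reflect₁ k l k+l≡p p∤k) (rec-reflect₁ k l k+l≡p p∤k))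
    (~-reflexive (lemma (rec l)))
    where
    lemma : ∀ x → (- x) · (- x) ≡ x · x
    lemma = solve-∀ ℚ-ring

  ∑-flip~ : ∀ {k} n {f g : ℕ → ℚ} → (∀ i j → i < n → i ℕ.+ j ≡ n → f i ~[ k ] g j) →
    ∑ n f ~[ k ] ∑ n (λ i → g (suc i))
  ∑-flip~ n {f} {g} eq = ~-trans
    (~-∑ n λ i i<n → eq i (n ∸ i) i<n (ℕ.m+[n∸m]≡n (ℕ.<⇒≤ i<n)))
    (~-reflexive (sym (Sum.fold-flip n g)))

  -- The map a ↦ p - a carries the block n < a ≤ n + m onto r < b ≤ r + m.
  ∑-reflect : ∀ {k} n m r → n ℕ.+ m ℕ.+ r ≡ 2 * M → {f g : ℕ → ℚ} →
    (∀ a b → a ℕ.+ b ≡ p → ¬ p ∣ a → f a ~[ k ] g b) →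
    ∑ m (λ i → f (suc (n ℕ.+ i))) ~[ k ] ∑ m (λ i → g (suc (r ℕ.+ i)))
  ∑-reflect {k} n m r n+m+r {f} {g} eq = ~-trans
    (∑-flip~ m {g = λ j → g (r ℕ.+ j)} λ i j i<m i+j≡m → eq (suc (n ℕ.+ i)) (r ℕ.+ j)
      (trans (shuffle n i r j) (trans (cong (λ m → suc (n ℕ.+ m ℕ.+ r)) i+j≡m) (trans (cong suc n+m+r) (sym p≡))))
      (∤-suc (ℕ.<-≤-trans (ℕ.+-monoʳ-< n i<m) (subst (n ℕ.+ m ≤_) n+m+r (ℕ.m≤m+n (n ℕ.+ m) r)))))
    (~-reflexive (Sum.fold-cong m λ i _ → cong g (ℕ.+-suc r i)))
    where
    shuffle : ∀ n i r j → suc (n ℕ.+ i) ℕ.+ (r ℕ.+ j) ≡ suc (n ℕ.+ (i ℕ.+ j) ℕ.+ r)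
    shuffle = ℕRing.solve-∀

  -- The odd numbers below 2 m are the p - 2 b with l < b ≤ M, so a sum over odd numbers becomes a
  -- sum over an interval.
  ∑-odd : ∀ {k} l m → l ℕ.+ m ≡ M → {f g : ℕ → ℚ} →
    (∀ a b → a ℕ.+ 2 * b ≡ p → ¬ p ∣ a → f a ~[ k ] g b) →
    ∑ m (λ i → f (suc (2 * i))) ~[ k ] ∑ m (λ i → g (suc (l ℕ.+ i)))
  ∑-odd l m l+m≡M {f} {g} eq = ~-trans
    (∑-flip~ m {g = λ j → g (l ℕ.+ j)} λ i j i<m i+j≡m → eq (suc (2 * i)) (l ℕ.+ j)
      (trans (shuffle i j l) (trans (cong (λ m → suc (2 * (l ℕ.+ m))) i+j≡m) (trans (cong (λ m → suc (2 * m)) l+m≡M) (sym p≡))))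
      (∤-suc (ℕ.*-monoʳ-< 2 (ℕ.<-≤-trans i<m (subst (m ≤_) l+m≡M (ℕ.m≤n+m m l))))))
    (~-reflexive (Sum.fold-cong m λ i _ → cong g (ℕ.+-suc l i)))
    where
    shuffle : ∀ i j l → suc (2 * i) ℕ.+ 2 * (l ℕ.+ j) ≡ suc (2 * (l ℕ.+ (i ℕ.+ j)))
    shuffle = ℕRing.solve-∀

  H²-halves : ∀ {n e o} → Halves n e o → ∀ l → l ℕ.+ o ≡ M → H² n ~[ 1 ] ¼ · H² e + ¼ · (H² M - H² l)
  H²-halves {n} {e} {o} halves l l+o≡M = begin
    H² n                                                          ≡⟨ ∑-halves halves rec² ⟩
    ∑ e (λ i → rec² (2 * suc i)) + ∑ o (λ i → rec² (suc (2 * i)))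
      ≈⟨ ~-+ (~-reflexive (trans (Sum.fold-cong e λ i _ → rec²-2* (suc i)) (∑-scale e ¼ (λ i → rec² (suc i)))))
             (∑-odd l o l+o≡M {g = λ b → ¼ · rec² b} λ a b a+2b≡p p∤a →
               ~-trans (rec²-reflect a (2 * b) a+2b≡p p∤a) (~-reflexive (rec²-2* b))) ⟩
    ¼ · H² e + ∑ o (λ i → ¼ · rec² (suc (l ℕ.+ i)))               ≡⟨ cong (_+_ (¼ · H² e)) (∑-scale o ¼ (λ i → rec² (suc (l ℕ.+ i)))) ⟩
    ¼ · H² e + ¼ · ∑ o (λ i → rec² (suc (l ℕ.+ i)))               ≡⟨ cong (λ z → ¼ · H² e + ¼ · z) (∑-tail l o (λ i → rec² (suc i))) ⟩
    ¼ · H² e + ¼ · (H² (l ℕ.+ o) - H² l)                          ≡⟨ cong (λ m → ¼ · H² e + ¼ · (H² m - H² l)) l+o≡M ⟩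
    ¼ · H² e + ¼ · (H² M - H² l)                                  ∎
    where open ~-Reasoning 1

  -- An odd number p - 2 b has the reciprocal -1/(2 b) - p/(4 b²) modulo p²; the even numbers
  -- contribute half of `H e` exactly.
  H-halves : ∀ {n e o} → Halves n e o → ∀ l → l ℕ.+ o ≡ M →
    H n ~[ 2 ] ½ · H e + ((- ½) · (H M - H l) + (- (P · ¼)) · (H² M - H² l))
  H-halves {n} {e} {o} halves l l+o≡M = begin
    H n                                                           ≡⟨ ∑-halves halves rec ⟩
    ∑ e (λ i → rec (2 * suc i)) + ∑ o (λ i → rec (suc (2 * i)))
      ≈⟨ ~-+ (~-reflexive (trans (Sum.fold-cong e λ i _ → rec-2* (suc i)) (∑-scale e ½ (λ i → rec (suc i)))))
             (∑-odd l o l+o≡M {g = λ b → (- ½) · rec b + (- (P · ¼)) · rec² b} λ a b a+2b≡p p∤a →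
               ~-trans (rec-reflect₂ a (2 * b) a+2b≡p p∤a)
                 (~-reflexive (trans (cong₂ (λ x y → - x - P · y) (rec-2* b) (rec²-2* b)) (lemma (rec b) (rec² b) P)))) ⟩
    ½ · H e + ∑ o (λ i → (- ½) · rec (suc (l ℕ.+ i)) + (- (P · ¼)) · rec² (suc (l ℕ.+ i)))
      ≡⟨ cong (_+_ (½ · H e)) (∑-linear o (- ½) (- (P · ¼)) (λ i → rec (suc (l ℕ.+ i))) (λ i → rec² (suc (l ℕ.+ i)))) ⟩
    ½ · H e + ((- ½) · ∑ o (λ i → rec (suc (l ℕ.+ i))) + (- (P · ¼)) · ∑ o (λ i → rec² (suc (l ℕ.+ i))))
      ≡⟨ cong₂ (λ x y → ½ · H e + ((- ½) · x + (- (P · ¼)) · y)) (∑-tail l o (λ i → rec (suc i))) (∑-tail l o (λ i → rec² (suc i))) ⟩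
    ½ · H e + ((- ½) · (H (l ℕ.+ o) - H l) + (- (P · ¼)) · (H² (l ℕ.+ o) - H² l))
      ≡⟨ cong (λ m → ½ · H e + ((- ½) · (H m - H l) + (- (P · ¼)) · (H² m - H² l))) l+o≡M ⟩
    ½ · H e + ((- ½) · (H M - H l) + (- (P · ¼)) · (H² M - H² l)) ∎
    where
    open ~-Reasoning 2
    lemma : ∀ x y P → - (½ · x) - P · (¼ · y) ≡ (- ½) · x + (- (P · ¼)) · y
    lemma = solve-∀ ℚ-ring

  H²-reflect : ∀ n m → n ℕ.+ m ≡ 2 * M → H² (2 * M) ~[ 1 ] H² n + H² m
  H²-reflect n m n+m≡2M = begin
    H² (2 * M)                                      ≡⟨ cong H² (sym n+m≡2M) ⟩
    H² (n ℕ.+ m)                                    ≡⟨ Sum.fold-++ n m (λ i → rec² (suc i)) ⟩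
    H² n + ∑ m (λ i → rec² (suc (n ℕ.+ i)))
      ≈⟨ ~-+ (~-refl {x = H² n}) (∑-reflect n m 0 (trans (ℕ.+-identityʳ (n ℕ.+ m)) n+m≡2M) {rec²} {rec²} rec²-reflect) ⟩
    H² n + H² m                                     ∎
    where open ~-Reasoning 1

  -- Both halves of 1, …, 2M contribute H² M, and so do the even and the odd numbers up to a factor ¼.
  H²-M : H² M ~[ 1 ] 0ℚ
  H²-M = ~-cancel-unit {u = + 3 / 2} {v = + 2 / 3} {x = H² M} {y = 0ℚ} (Int-/ (+ 2) 3 p∤3) refl
    (~-transport (lemma (H² M))
      (~-trans (~-sym (H²-reflect M M (cong (M ℕ.+_) (sym (ℕ.+-identityʳ M))))) (H²-halves (even M) 0 refl)))
    where
    lemma : ∀ x → (+ 3 / 2) · x - (+ 3 / 2) · 0ℚ ≡ (x + x) - (¼ · x + ¼ · (x - 0ℚ))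
    lemma = solve-∀ ℚ-ring

  -- The full sum is twice `H² M` modulo p, hence 0, and reflection splits it into the two parts.
  H²-complement : ∀ n m → n ℕ.+ m ≡ 2 * M → H² m ~[ 1 ] - H² n
  H²-complement n m n+m≡2M = ~-transport (lemma (H² n) (H² m) (H² M))
    (~-trans (~-sym (H²-reflect n m n+m≡2M)) (~-trans (H²-reflect M M (cong (M ℕ.+_) (sym (ℕ.+-identityʳ M)))) (~-+ H²-M H²-M)))
    where
    lemma : ∀ x y z → y - (- x) ≡ (x + y) - (0ℚ + 0ℚ)
    lemma = solve-∀ ℚ-ring

  middle² : ∀ n c → n ℕ.+ c ℕ.+ n ≡ 2 * M → ∑ c (λ i → rec² (suc (n ℕ.+ i))) ~[ 1 ] - (2ℚ · H² n)
  middle² n c n+c+n≡2M = ~-trans (~-reflexive (∑-tail n c (λ i → rec² (suc i))))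
    (~-transport (lemma (H² n) (H² (n ℕ.+ c))) (H²-complement n (n ℕ.+ c) (trans (ℕ.+-comm n (n ℕ.+ c)) n+c+n≡2M)))
    where
    lemma : ∀ x y → (y - x) - (- (2ℚ · x)) ≡ y - (- x)
    lemma = solve-∀ ℚ-ring

  -- The block is invariant under k ↦ p - k, so K ≡ - K - P · `K²`, and `middle²` evaluates the sum
  -- `K²` of squared reciprocals.
  middle : ∀ n c → n ℕ.+ c ℕ.+ n ≡ 2 * M → ∑ c (λ i → rec (suc (n ℕ.+ i))) ~[ 2 ] P · H² n
  middle n c n+c+n≡2M = ~-cancel-unit {u = 2ℚ} {v = ½} {x = K} {y = P · H² n} Int-½ refl
    (~-combine (lemma K K² P (H² n))
      (~-trans (∑-reflect n c n n+c+n≡2M {rec} {λ b → (- 1ℚ) · rec b + (- P) · rec² b} λ a b a+b≡p p∤a →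
          ~-trans (rec-reflect₂ a b a+b≡p p∤a) (~-reflexive (rearrange (rec b) (rec² b) P)))
        (~-reflexive (∑-linear c (- 1ℚ) (- P) (λ i → rec (suc (n ℕ.+ i))) (λ i → rec² (suc (n ℕ.+ i))))))
      (~-neg (~-P· (middle² n c n+c+n≡2M))))
    where
    K  = ∑ c (λ i → rec (suc (n ℕ.+ i)))
    K² = ∑ c (λ i → rec² (suc (n ℕ.+ i)))
    rearrange : ∀ x y P → - x - P · y ≡ (- 1ℚ) · x + (- P) · y
    rearrange = solve-∀ ℚ-ring
    lemma : ∀ K K² P s → 2ℚ · K - 2ℚ · (P · s) ≡ (K - ((- 1ℚ) · K + (- P) · K²)) + (- (P · K²) - (- (P · (- (2ℚ · s)))))
    lemma = solve-∀ ℚ-ring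

-- Fermat quotients from Lerch's product

module FermatQuotients (p : ℕ) (p-prime : Prime p) (M : ℕ) (p≡ : p ≡ suc (2 * M)) (3<p : 3 < p) where
  open Harmonic p p-prime M p≡ 3<p

  -- Elementary symmetric functions up to degree two, the second one rewritten in power sums by
  -- Newton's identity. Each further factor creates a single error term, of order p³.
  ∏-expand : ∀ n (x : ℕ → ℚ) → (∀ i → i < n → Int (x i)) →
    ∏ n (λ i → 1ℚ - P · x i) ~[ 3 ] (1ℚ - P · ∑ n x) + P · (P · (½ · (∑ n x · ∑ n x - ∑ n (λ i → x i · x i))))
  ∏-expand zero    x ix = ~-reflexive (lemma P)
    where
    lemma : ∀ P → 1ℚ ≡ (1ℚ - P · 0ℚ) + P · (P · (½ · (0ℚ · 0ℚ - 0ℚ)))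
    lemma = solve-∀ ℚ-ring
  ∏-expand (suc n) x ix = ~-trans
    (~-·ʳ (Int-- Int-1 (Int-· (Int-ι p) ixₙ)) (∏-expand n x ix'))
    (by (Small-resp (lemma P (∑ n x) (∑ n (λ i → x i · x i)) (x n))
      (Small-P· (Small-P· (Small-P· (Int⇒Small (Int-· (Int-neg Int-½) (Int-· (Int-- (Int-· ie ie) is) ixₙ))))))))
    where
    ix' : ∀ i → i < n → Int (x i)
    ix' i i<n = ix i (ℕ.m<n⇒m<1+n i<n)
    ixₙ = ix n ℕ.≤-refl
    ie = Int-∑ n ix'
    is = Int-∑ n λ i i<n → Int-· (ix' i i<n) (ix' i i<n)
    lemma : ∀ P e s y →
      ((1ℚ - P · e) + P · (P · (½ · (e · e - s)))) · (1ℚ - P · y)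
        - ((1ℚ - P · (e + y)) + P · (P · (½ · ((e + y) · (e + y) - (s + y · y)))))
      ≡ P · (P · (P · ((- ½) · ((e · e - s) · y))))
    lemma = solve-∀ ℚ-ring

  -- `residues` sorts 1, …, p - 1 by residue class modulo μ: the multiples of μ, the p - μ l with l ≤ n, and the
  -- μ k - p with n < k ≤ n + c. Multiplying 1, …, p - 1 by μ instead and comparing yields μ^(p-1).
  module Lerch (μ : ℕ) .{{_ : NonZero μ}} (n c : ℕ) (n+c+n≡2M : n ℕ.+ c ℕ.+ n ≡ 2 * M)
    (residues : (ι μ ^ℚ n · ∏ n (λ i → ι (suc i))) · (∏ n (λ i → P - ι μ · ι (suc i)) · ∏ c (λ i → ι μ · ι (suc (n ℕ.+ i)) - P))
      ≡ ∏ (2 * M) (λ i → ι (suc i)))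
    where
    private
      m = ι μ
      r = rec μ
      F = ∏ n (λ i → ι (suc i))
      F⁻¹ = ∏ n (λ i → rec (suc i))
      X X' Y Y' D D' : ℚ
      X  = ∏ n (λ i → P - m · ι (suc i))
      X' = ∏ c (λ i → m · ι (suc (n ℕ.+ i)) - P)
      Y  = ∏ n (λ i → P - ι (suc i))
      Y' = ∏ c (λ i → ι (suc (n ℕ.+ i)))
      D  = ∏ n (λ i → - (r · rec (suc i)))
      D' = ∏ c (λ i → r · rec (suc (n ℕ.+ i)))

      -- The blocks l, k and p - l, with l ≤ n and n < k ≤ n + c, are those of `residues` before
      -- multiplication by μ.
      factorial : ∏ (2 * M) (λ i → ι (suc i)) ≡ F · (Y' · Y)
      factorial = begin
        ∏ (2 * M) (λ i → ι (suc i))                                          ≡⟨ cong (λ N → ∏ N (λ i → ι (suc i))) (sym n+c+n≡2M) ⟩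
        ∏ (n ℕ.+ c ℕ.+ n) (λ i → ι (suc i))                                  ≡⟨ Prod.fold-++ (n ℕ.+ c) n (λ i → ι (suc i)) ⟩
        ∏ (n ℕ.+ c) (λ i → ι (suc i)) · ∏ n (λ i → ι (suc (n ℕ.+ c ℕ.+ i)))  ≡⟨ cong₂ _·_ (Prod.fold-++ n c (λ i → ι (suc i))) (Prod.fold-reflect n reflect) ⟩
        (F · Y') · Y                                                         ≡⟨ ℚ.*-assoc F Y' Y ⟩
        F · (Y' · Y)                                                         ∎
        where
        open ≡-Reasoning
        shift : ∀ a b → a ≡ (a + b) - b
        shift = solve-∀ ℚ-ring
        reflect : ∀ i j → i ℕ.+ j ≡ n → ι (suc (n ℕ.+ c ℕ.+ i)) ≡ P - ι j
        reflect i j i+j≡n = begin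
          ι (suc (n ℕ.+ c ℕ.+ i))                   ≡⟨ shift _ (ι j) ⟩
          (ι (suc (n ℕ.+ c ℕ.+ i)) + ι j) - ι j     ≡⟨ cong (_- ι j) (sym (ι-+ (suc (n ℕ.+ c ℕ.+ i)) j)) ⟩
          ι (suc (n ℕ.+ c ℕ.+ i) ℕ.+ j) - ι j       ≡⟨ cong (λ z → ι (suc z) - ι j) (trans (ℕ.+-assoc (n ℕ.+ c) i j) (trans (cong (n ℕ.+ c ℕ.+_) i+j≡n) n+c+n≡2M)) ⟩
          ι (suc (2 * M)) - ι j                     ≡⟨ cong (λ z → ι z - ι j) (sym p≡) ⟩
          P - ι j                                   ∎

      -- Both factorisations of (2M)! contain n!; cancelling it leaves the blocks to be compared.
      mⁿXX'≡YY' : m ^ℚ n · (X · X') ≡ Y · Y'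
      mⁿXX'≡YY' = ·-cancelˡ {F} {F⁻¹} (∏-unit n) (begin
        F · (m ^ℚ n · (X · X'))   ≡⟨ lemma F (m ^ℚ n) (X · X') ⟩
        (m ^ℚ n · F) · (X · X')   ≡⟨ trans residues factorial ⟩
        F · (Y' · Y)              ≡⟨ cong (F ·_) (ℚ.*-comm Y' Y) ⟩
        F · (Y · Y')              ∎)
        where
        open ≡-Reasoning
        lemma : ∀ F a b → F · (a · b) ≡ (a · F) · b
        lemma = solve-∀ ℚ-ring

      scale : ∀ k b x y z → (∀ i → m · x i · y i ≡ z i) → b ≡ m ^ℚ k → b · (∏ k x · ∏ k y) ≡ ∏ k z
      scale k b x y z eq refl = begin
        m ^ℚ k · (∏ k x · ∏ k y)                ≡⟨ sym (ℚ.*-assoc (m ^ℚ k) (∏ k x) (∏ k y)) ⟩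
        m ^ℚ k · ∏ k x · ∏ k y                  ≡⟨ cong (λ z → z · ∏ k x · ∏ k y) (sym (∏-const k m)) ⟩
        ∏ k (λ _ → m) · ∏ k x · ∏ k y           ≡⟨ cong (_· ∏ k y) (sym (Prod.fold-∙ k (λ _ → m) x)) ⟩
        ∏ k (λ i → m · x i) · ∏ k y             ≡⟨ sym (Prod.fold-∙ k (λ i → m · x i) y) ⟩
        ∏ k (λ i → m · x i · y i)               ≡⟨ Prod.fold-cong k (λ i _ → eq i) ⟩
        ∏ k z                                   ∎
        where open ≡-Reasoning

      mr≡1 : m · r ≡ 1ℚ
      mr≡1 = ι·rec μ

    -- Still an exact identity: multiplying the factors of `mⁿXX'≡YY'` by -1/(μ l) and 1/(μ k)
    -- brings them into the form 1 - p x, ready for expansion, while the middle block on the right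
    -- becomes 1.
    product : m ^ℚ (2 * M) · (∏ n (λ i → 1ℚ - P · (r · rec (suc i))) · ∏ c (λ i → 1ℚ - P · (r · rec (suc (n ℕ.+ i)))))
      ≡ ∏ n (λ i → 1ℚ - P · rec (suc i))
    product = begin
      m ^ℚ (2 * M) · (A · A')                            ≡⟨ cong₂ (λ a b → m ^ℚ (2 * M) · (a · b)) (sym XD) (sym X'D') ⟩
      m ^ℚ (2 * M) · ((X · D) · (X' · D'))               ≡⟨ cong (λ N → m ^ℚ N · ((X · D) · (X' · D'))) (sym n+c+n≡2M) ⟩
      m ^ℚ (n ℕ.+ c ℕ.+ n) · ((X · D) · (X' · D'))       ≡⟨ cong (_· ((X · D) · (X' · D'))) (trans (^ℚ-+ m (n ℕ.+ c) n) (cong (_· m ^ℚ n) (^ℚ-+ m n c))) ⟩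
      ((m ^ℚ n · m ^ℚ c) · m ^ℚ n) · ((X · D) · (X' · D')) ≡⟨ lemma₁ (m ^ℚ n) (m ^ℚ c) X D X' D' ⟩
      ((m ^ℚ n · m ^ℚ c) · (D · D')) · (m ^ℚ n · (X · X')) ≡⟨ cong (((m ^ℚ n · m ^ℚ c) · (D · D')) ·_) mⁿXX'≡YY' ⟩
      ((m ^ℚ n · m ^ℚ c) · (D · D')) · (Y · Y')          ≡⟨ lemma₂ (m ^ℚ n) (m ^ℚ c) Y D Y' D' ⟩
      (m ^ℚ n · (Y · D)) · (m ^ℚ c · (Y' · D'))          ≡⟨ cong₂ _·_ YD Y'D' ⟩
      B · ∏ c (λ _ → 1ℚ)                                 ≡⟨ cong (B ·_) (∏-1 c) ⟩
      B · 1ℚ                                             ≡⟨ ℚ.*-identityʳ B ⟩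
      B                                                  ∎
      where
      open ≡-Reasoning
      A A' B : ℚ
      A  = ∏ n (λ i → 1ℚ - P · (r · rec (suc i)))
      A' = ∏ c (λ i → 1ℚ - P · (r · rec (suc (n ℕ.+ i))))
      B  = ∏ n (λ i → 1ℚ - P · rec (suc i))
      ∏-1 : ∀ k → ∏ k (λ _ → 1ℚ) ≡ 1ℚ
      ∏-1 zero    = refl
      ∏-1 (suc k) = cong (_· 1ℚ) (∏-1 k)
      lemma₁ : ∀ a b X D X' D' → ((a · b) · a) · ((X · D) · (X' · D')) ≡ ((a · b) · (D · D')) · (a · (X · X'))
      lemma₁ = solve-∀ ℚ-ring
      lemma₂ : ∀ a b X D X' D' → ((a · b) · (D · D')) · (X · X') ≡ (a · (X · D)) · (b · (X' · D'))
      lemma₂ = solve-∀ ℚ-ring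
      XD : X · D ≡ A
      XD = trans (sym (Prod.fold-∙ n _ _)) (Prod.fold-cong n λ i _ →
        trans (factor₁ P m r (ι (suc i)) (rec (suc i)))
          (cong₂ (λ a b → a · b - P · (r · rec (suc i))) mr≡1 (ι·rec (suc i))))
        where
        factor₁ : ∀ P m r l l⁻¹ → (P - m · l) · (- (r · l⁻¹)) ≡ (m · r) · (l · l⁻¹) - P · (r · l⁻¹)
        factor₁ = solve-∀ ℚ-ring
      X'D' : X' · D' ≡ A'
      X'D' = trans (sym (Prod.fold-∙ c _ _)) (Prod.fold-cong c λ i _ →
        trans (factor₂ P m r (ι (suc (n ℕ.+ i))) (rec (suc (n ℕ.+ i))))
          (cong₂ (λ a b → a · b - P · (r · rec (suc (n ℕ.+ i)))) mr≡1 (ι·rec (suc (n ℕ.+ i)))))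
        where
        factor₂ : ∀ P m r l l⁻¹ → (m · l - P) · (r · l⁻¹) ≡ (m · r) · (l · l⁻¹) - P · (r · l⁻¹)
        factor₂ = solve-∀ ℚ-ring
      YD : m ^ℚ n · (Y · D) ≡ B
      YD = scale n (m ^ℚ n) (λ i → P - ι (suc i)) (λ i → - (r · rec (suc i))) (λ i → 1ℚ - P · rec (suc i))
        (λ i → trans (factor₃ P m r (ι (suc i)) (rec (suc i)))
          (trans (cong₂ (λ a b → a · b - a · (P · rec (suc i))) mr≡1 (ι·rec (suc i))) (cong (λ z → 1ℚ - z) (ℚ.*-identityˡ (P · rec (suc i)))))) refl
        where
        factor₃ : ∀ P m r l l⁻¹ → m · (P - l) · (- (r · l⁻¹)) ≡ (m · r) · (l · l⁻¹) - (m · r) · (P · l⁻¹)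
        factor₃ = solve-∀ ℚ-ring
      Y'D' : m ^ℚ c · (Y' · D') ≡ ∏ c (λ _ → 1ℚ)
      Y'D' = scale c (m ^ℚ c) (λ i → ι (suc (n ℕ.+ i))) (λ i → r · rec (suc (n ℕ.+ i))) (λ _ → 1ℚ)
        (λ i → trans (factor₄ m r (ι (suc (n ℕ.+ i))) (rec (suc (n ℕ.+ i))))
          (cong₂ _·_ mr≡1 (ι·rec (suc (n ℕ.+ i))))) refl
        where
        factor₄ : ∀ m r l l⁻¹ → m · l · (r · l⁻¹) ≡ (m · r) · (l · l⁻¹)
        factor₄ = solve-∀ ℚ-ring

    module Asymptotics (p∤μ : ¬ p ∣ μ) (q : ℚ) (Pq≡ : P · q ≡ m ^ℚ (2 * M) - 1ℚ) where
      private
        n≤2M : n ≤ 2 * M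
        n≤2M = subst (n ≤_) n+c+n≡2M (ℕ.m≤n+m n (n ℕ.+ c))
        h s K K² A A' B a₂ b₂ : ℚ
        h  = H n
        s  = H² n
        K  = ∑ c (λ i → rec (suc (n ℕ.+ i)))
        K² = ∑ c (λ i → rec² (suc (n ℕ.+ i)))
        a₂ = ½ · (r · r · (h · h - s))
        -- By `middle` the linear term - P · (r · K) contributes -p² r s, and by `middle²` the
        -- quadratic term contributes p² r² s; the square of K drops out because p divides K.
        b₂ = s · (r · r - r)
        A  = (1ℚ - P · (r · h)) + P · (P · a₂)
        A' = 1ℚ + P · (P · b₂)
        B  = (1ℚ - P · h) + P · (P · (½ · (h · h - s)))
        ir = Int-rec p∤μ
        ih = Int-H n≤2M
        is = Int-H² n≤2M
        iK = ~-Int (middle n c n+c+n≡2M) (Int-· (Int-ι p) is)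
        ia₂ : Int a₂
        ia₂ = Int-· Int-½ (Int-· (Int-· ir ir) (Int-- (Int-· ih ih) is))
        ib₂ : Int b₂
        ib₂ = Int-· is (Int-- (Int-· ir ir) ir)
        iP = Int-ι p
        iA : Int A
        iA = Int-+ (Int-- Int-1 (Int-· iP (Int-· ir ih))) (Int-· iP (Int-· iP ia₂))
        iA' : Int A'
        iA' = Int-+ Int-1 (Int-· iP (Int-· iP ib₂))
        irec : ∀ i → i < n → Int (rec (suc i))
        irec = Int-rec-suc n≤2M
        irec' : ∀ i → i < c → Int (rec (suc (n ℕ.+ i)))
        irec' i i<c = Int-rec (∤-suc (ℕ.<-≤-trans (ℕ.+-monoʳ-< n i<c) (subst (n ℕ.+ c ≤_) n+c+n≡2M (ℕ.m≤m+n (n ℕ.+ c) n))))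

        ∑-square : ∀ k (f : ℕ → ℚ) → ∑ k (λ i → (r · f i) · (r · f i)) ≡ (r · r) · ∑ k (λ i → f i · f i)
        ∑-square k f = trans (Sum.fold-cong k λ i _ → lemma r (f i)) (∑-scale k (r · r) (λ i → f i · f i))
          where
          lemma : ∀ r x → (r · x) · (r · x) ≡ (r · r) · (x · x)
          lemma = solve-∀ ℚ-ring

        expand-scaled : ∀ k (f : ℕ → ℚ) → (∀ i → i < k → Int (f i)) →
          ∏ k (λ i → 1ℚ - P · (r · f i)) ~[ 3 ]
            (1ℚ - P · (r · ∑ k f)) + P · (P · (½ · (r · r · (∑ k f · ∑ k f - ∑ k (λ i → f i · f i)))))
        expand-scaled k f if = ~-trans (∏-expand k (λ i → r · f i) (λ i i<k → Int-· ir (if i i<k)))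
          (~-reflexive (trans
            (cong₂ (λ e t → (1ℚ - P · e) + P · (P · (½ · (e · e - t)))) (∑-scale k r f) (∑-square k f))
            (lemma P r (∑ k f) (∑ k (λ i → f i · f i)))))
          where
          lemma : ∀ P r e t → (1ℚ - P · (r · e)) + P · (P · (½ · ((r · e) · (r · e) - (r · r) · t)))
            ≡ (1ℚ - P · (r · e)) + P · (P · (½ · (r · r · (e · e - t))))
          lemma = solve-∀ ℚ-ring

        expand-middle : ∏ c (λ i → 1ℚ - P · (r · rec (suc (n ℕ.+ i)))) ~[ 3 ] A'
        expand-middle = ~-trans (expand-scaled c (λ i → rec (suc (n ℕ.+ i))) irec')
          (~-combine (lemma P r K K² s)
            (~-P· (~-neg (~-·ˡ ir (middle n c n+c+n≡2M))))
            (~-P· (~-P· (~-·ˡ (Int-· Int-½ (Int-· ir ir)) (~-- K²~0 (middle² n c n+c+n≡2M))))))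
          where
          K²~0 : K · K ~[ 1 ] 0ℚ
          K²~0 = ~-trans (~-·ˡ iK (~-pred (middle n c n+c+n≡2M)))
            (by (Small-resp (lemma₀ K P s) (Small-P· (Int⇒Small (Int-· iK is)))))
            where
            lemma₀ : ∀ K P s → K · (P · s) - 0ℚ ≡ P · (K · s)
            lemma₀ = solve-∀ ℚ-ring
          lemma : ∀ P r K K² s →
            ((1ℚ - P · (r · K)) + P · (P · (½ · (r · r · (K · K - K²))))) - (1ℚ + P · (P · (s · (r · r - r))))
            ≡ (P · (- (r · K)) - P · (- (r · (P · s))))
            + (P · (P · ((½ · (r · r)) · (K · K - K²))) - P · (P · ((½ · (r · r)) · (0ℚ - (- (2ℚ · s))))))
          lemma = solve-∀ ℚ-ring

        Q : ℚ
        Q = m ^ℚ (2 * M)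
        iQ : Int Q
        iQ = Int-^ (2 * M) (Int-ι μ)

        product~ : Q · (A · A') ~[ 3 ] B
        product~ = ~-trans (~-sym (~-·ˡ iQ (~-· iProd iA' (expand-scaled n (λ i → rec (suc i)) irec) expand-middle)))
          (~-trans (~-reflexive product) (∏-expand n (λ i → rec (suc i)) irec))
          where
          iProd = ~-Int (expand-scaled n (λ i → rec (suc i)) irec) iA

        unit : ∀ {x} y → Int y → x - 1ℚ ≡ P · y → x ~[ 1 ] 1ℚ
        unit y iy eq = by (Small-resp eq (Small-P· (Int⇒Small iy)))

        A~1 : A ~[ 1 ] 1ℚ
        A~1 = unit (P · a₂ - r · h) (Int-- (Int-· iP ia₂) (Int-· ir ih)) (lemma P (r · h) a₂)
          where
          lemma : ∀ P x y → ((1ℚ - P · x) + P · (P · y)) - 1ℚ ≡ P · (P · y - x)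
          lemma = solve-∀ ℚ-ring
        A'~1 : A' ~[ 1 ] 1ℚ
        A'~1 = unit (P · b₂) (Int-· iP ib₂) (lemma P b₂)
          where
          lemma : ∀ P y → (1ℚ + P · (P · y)) - 1ℚ ≡ P · (P · y)
          lemma = solve-∀ ℚ-ring
        B~1 : B ~[ 1 ] 1ℚ
        B~1 = unit (P · (½ · (h · h - s)) - h) (Int-- (Int-· iP (Int-· Int-½ (Int-- (Int-· ih ih) is))) ih) (lemma P h (½ · (h · h - s)))
          where
          lemma : ∀ P x y → ((1ℚ - P · x) + P · (P · y)) - 1ℚ ≡ P · (P · y - x)
          lemma = solve-∀ ℚ-ring

      -- Fermat's little theorem for μ as a by-product: the other three products are all 1 modulo p.
      Q~1 : m ^ℚ (2 * M) ~[ 1 ] 1ℚ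
      Q~1 = begin
        Q               ≡⟨ lemma Q ⟩
        Q · (1ℚ · 1ℚ)   ≈⟨ ~-·ˡ iQ (~-sym (~-· iA Int-1 A~1 A'~1)) ⟩
        Q · (A · A')    ≈⟨ ~-pred (~-pred product~) ⟩
        B               ≈⟨ B~1 ⟩
        1ℚ              ∎
        where
        open ~-Reasoning 1
        lemma : ∀ x → x ≡ x · (1ℚ · 1ℚ)
        lemma = solve-∀ ℚ-ring

      Int-q : Int q
      Int-q = Small⇒Int (Small-cancel-P (Small-resp Pq≡ (difference Q~1)))

      private
        y W : ℚ
        y = (1ℚ - r) · h
        W = (½ · (1ℚ - r · r)) · (h · h) + r · (q · h) - ½ · ((1ℚ - r) · (1ℚ - r) · s)

        -- In (1 + p q) A A' ≡ B modulo p³ the constant terms cancel; dividing by p leaves q + y in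
        -- order 0 and W in order 1.
        first-order : q + y ~[ 2 ] P · W
        first-order = ~-cancel-P {x = q + y} {y = P · W} (~-combine (trans (lemma P q r h s) (cong (λ z → (((z) · (A · A')) - B) + (0ℚ - R)) Q≡))
          product~ (~-sym R~0))
          where
          R : ℚ
          -- All terms of order p³ and higher in the expanded product.
          R = P · (P · (P · ((q · a₂ + q · b₂ - r · h · b₂) + P · (a₂ · b₂ - q · (r · h) · b₂) + P · (P · (q · a₂ · b₂)))))
          Q≡ : 1ℚ + P · q ≡ Q
          Q≡ = trans (cong (λ z → 1ℚ + z) Pq≡) (lemma₁ Q)
            where
            lemma₁ : ∀ x → 1ℚ + (x - 1ℚ) ≡ x
            lemma₁ = solve-∀ ℚ-ring
          R~0 : R ~[ 3 ] 0ℚ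
          R~0 = by (Small-resp (lemma₂ R) (Small-P· (Small-P· (Small-P· (Int⇒Small
            (Int-+ (Int-+ (Int-- (Int-+ (Int-· Int-q ia₂) (Int-· Int-q ib₂)) (Int-· (Int-· ir ih) ib₂))
              (Int-· iP (Int-- (Int-· ia₂ ib₂) (Int-· (Int-· Int-q (Int-· ir ih)) ib₂))))
              (Int-· iP (Int-· iP (Int-· (Int-· Int-q ia₂) ib₂)))))))))
            where
            lemma₂ : ∀ x → x - 0ℚ ≡ x
            lemma₂ = solve-∀ ℚ-ring
          lemma : ∀ P q r h s → P · (q + (1ℚ - r) · h) - P · (P · ((½ · (1ℚ - r · r)) · (h · h) + r · (q · h) - ½ · ((1ℚ - r) · (1ℚ - r) · s)))
            ≡ ((1ℚ + P · q) · (((1ℚ - P · (r · h)) + P · (P · (½ · (r · r · (h · h - s))))) · (1ℚ + P · (P · (s · (r · r - r)))))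
                - ((1ℚ - P · h) + P · (P · (½ · (h · h - s)))))
              + (0ℚ - P · (P · (P · ((q · (½ · (r · r · (h · h - s))) + q · (s · (r · r - r)) - r · h · (s · (r · r - r)))
                  + P · ((½ · (r · r · (h · h - s))) · (s · (r · r - r)) - q · (r · h) · (s · (r · r - r)))
                  + P · (P · (q · (½ · (r · r · (h · h - s))) · (s · (r · r - r))))))))
          lemma = solve-∀ ℚ-ring

        iW : Int W
        iW = Int-- (Int-+ (Int-· (Int-· Int-½ (Int-- Int-1 (Int-· ir ir))) (Int-· ih ih)) (Int-· ir (Int-· Int-q ih)))
          (Int-· Int-½ (Int-· (Int-· i1-r i1-r) is))
          where i1-r = Int-- Int-1 ir

        y~-q : y ~[ 1 ] - q
        y~-q = by (Small-resp (lemma y q (P · W)) (Small-+ (difference (~-pred first-order)) (Small-P· (Int⇒Small iW))))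
          where
          lemma : ∀ y q w → y - (- q) ≡ ((q + y) - w) + w
          lemma = solve-∀ ℚ-ring

      -- Multiplied by 1 - r, the quadratic part of W is a polynomial in q and y, and y ~[1] - q.
      asymptotics : ∀ {u} → Int u → (1ℚ - r) · u ≡ 1ℚ →
        (1ℚ - r) · H n ~[ 2 ] - q + P · (½ · (q · q) - ½ · ((1ℚ - r) · (1ℚ - r) · H² n))
      asymptotics {u} iu u-inverse = ~-combine (lemma₁ q y P W V) first-order
        (~-P· (~-cancel-unit {u = 1ℚ - r} {x = W} {y = V} iu u-inverse
          (~-combine (lemma₂ q r h s)
            (~-·ˡ (Int-· Int-½ (Int-+ Int-1 ir)) (~-· iy (Int-neg Int-q) y~-q y~-q))
            (~-·ˡ (Int-· ir Int-q) y~-q))))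
        where
        V : ℚ
        V = ½ · (q · q) - ½ · ((1ℚ - r) · (1ℚ - r) · s)
        iy : Int y
        iy = Int-· (Int-- Int-1 ir) ih
        lemma₁ : ∀ q y P W V → y - (- q + P · V) ≡ ((q + y) - P · W) + (P · W - P · V)
        lemma₁ = solve-∀ ℚ-ring
        lemma₂ : ∀ q r h s →
          (1ℚ - r) · ((½ · (1ℚ - r · r)) · (h · h) + r · (q · h) - ½ · ((1ℚ - r) · (1ℚ - r) · s))
            - (1ℚ - r) · (½ · (q · q) - ½ · ((1ℚ - r) · (1ℚ - r) · s))
          ≡ ((½ · (1ℚ + r)) · (((1ℚ - r) · h) · ((1ℚ - r) · h)) - (½ · (1ℚ + r)) · ((- q) · (- q)))
            + ((r · q) · ((1ℚ - r) · h) - (r · q) · (- q))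
        lemma₂ = solve-∀ ℚ-ring

-- Harmonic numbers at [p/2], [p/3], [p/4] and [p/6]

module FractionalHarmonic (p : ℕ) (p-prime : Prime p) (M : ℕ) (p≡ : p ≡ suc (2 * M)) (3<p : 3 < p) where
  open Harmonic p p-prime M p≡ 3<p public
  open FermatQuotients p p-prime M p≡ 3<p

  P·q : ∀ a → P · q p a ≡ ι a ^ℚ (2 * M) - 1ℚ
  P·q a = begin
    P · q p a                                     ≡⟨ ℚ.*-comm P (q p a) ⟩
    q p a · ι p                                   ≡⟨ /-·-denominator (+ (a ^ (p ∸ 1)) ℤ.- + 1) p ⟩
    (+ (a ^ (p ∸ 1)) ℤ.- + 1) / 1                 ≡⟨ /1-+ (+ (a ^ (p ∸ 1))) (ℤ.- + 1) ⟩
    + (a ^ (p ∸ 1)) / 1 + (ℤ.- + 1) / 1           ≡⟨ cong₂ _+_ (sym (ι≡/1 (a ^ (p ∸ 1)))) refl ⟩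
    ι (a ^ (p ∸ 1)) - 1ℚ                          ≡⟨ cong (λ n → ι (a ^ (n ∸ 1)) - 1ℚ) p≡ ⟩
    ι (a ^ (2 * M)) - 1ℚ                          ≡⟨ cong (_- 1ℚ) (ι-^ a (2 * M)) ⟩
    ι a ^ℚ (2 * M) - 1ℚ                           ∎
    where open ≡-Reasoning

  ι-difference : ∀ {a b c} → a ℕ.+ b ≡ c → ι a ≡ ι c - ι b
  ι-difference {a} {b} refl = trans (lemma (ι a) (ι b)) (cong (_- ι b) (sym (ι-+ a b)))
    where
    lemma : ∀ a b → a ≡ (a + b) - b
    lemma = solve-∀ ℚ-ring

  ∏-multiples : ∀ μ n → ι μ ^ℚ n · ∏ n (λ i → ι (suc i)) ≡ ∏ n (λ i → ι (μ * suc i))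
  ∏-multiples μ n = begin
    ι μ ^ℚ n · ∏ n (λ i → ι (suc i))              ≡⟨ cong (_· ∏ n (λ i → ι (suc i))) (sym (∏-const n (ι μ))) ⟩
    ∏ n (λ _ → ι μ) · ∏ n (λ i → ι (suc i))       ≡⟨ sym (Prod.fold-∙ n (λ _ → ι μ) (λ i → ι (suc i))) ⟩
    ∏ n (λ i → ι μ · ι (suc i))                   ≡⟨ Prod.fold-cong n (λ i _ → sym (ι-* μ (suc i))) ⟩
    ∏ n (λ i → ι (μ * suc i))                     ∎
    where open ≡-Reasoning

  -- The p - μ l decrease with l while f lists the same numbers in increasing order, hence the index
  -- condition i + j = n.
  ∏-complements : ∀ μ n (f : ℕ → ℕ) → (∀ i j → i ℕ.+ j ≡ n → f i ℕ.+ μ * j ≡ p) →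
    ∏ n (λ i → P - ι μ · ι (suc i)) ≡ ∏ n (λ i → ι (f i))
  ∏-complements μ n f eq = sym (Prod.fold-reflect n λ i j i+j≡n →
    trans (ι-difference (eq i j i+j≡n)) (cong (λ z → P - z) (ι-* μ j)))

  ∏-excesses : ∀ μ n c (f : ℕ → ℕ) → (∀ i → f i ℕ.+ p ≡ μ * suc (n ℕ.+ i)) →
    ∏ c (λ i → ι μ · ι (suc (n ℕ.+ i)) - P) ≡ ∏ c (λ i → ι (f i))
  ∏-excesses μ n c f eq = Prod.fold-cong c λ i _ →
    sym (trans (ι-difference (eq i)) (cong (_- P) (ι-* μ (suc (n ℕ.+ i)))))

  -- For μ = 2 there is no middle block: the even numbers are 2 l and the odd ones p - 2 l, both
  -- with l ≤ M.
  residues₂ : (ι 2 ^ℚ M · ∏ M (λ i → ι (suc i))) · (∏ M (λ i → P - ι 2 · ι (suc i)) · 1ℚ) ≡ ∏ (2 * M) (λ i → ι (suc i))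
  residues₂ = begin
    (ι 2 ^ℚ M · ∏ M (λ i → ι (suc i))) · (∏ M (λ i → P - ι 2 · ι (suc i)) · 1ℚ)
      ≡⟨ cong₂ (λ x y → x · (y · 1ℚ)) (∏-multiples 2 M) (∏-complements 2 M (λ i → suc (2 * i)) complement) ⟩
    ∏ M (λ i → ι (2 * suc i)) · (∏ M (λ i → ι (suc (2 * i))) · 1ℚ)
      ≡⟨ lemma (∏ M (λ i → ι (2 * suc i))) (∏ M (λ i → ι (suc (2 * i)))) ⟩
    ∏ M (λ i → ι (suc (2 * i))) · ∏ M (λ i → ι (2 * suc i))
      ≡⟨ cong (∏ M (λ i → ι (suc (2 * i))) ·_) (Prod.fold-cong M λ i _ → cong ι (double i)) ⟩
    ∏ M (λ i → ι (suc (2 * i))) · ∏ M (λ i → ι (suc (suc (2 * i))))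
      ≡⟨ sym (Prod.fold-2* M (λ i → ι (suc i))) ⟩
    ∏ (2 * M) (λ i → ι (suc i)) ∎
    where
    open ≡-Reasoning
    lemma : ∀ x y → x · (y · 1ℚ) ≡ y · x
    lemma = solve-∀ ℚ-ring
    double : ∀ i → 2 * suc i ≡ suc (suc (2 * i))
    double = ℕRing.solve-∀
    complement : ∀ i j → i ℕ.+ j ≡ M → suc (2 * i) ℕ.+ 2 * j ≡ p
    complement i j i+j≡M = trans (distrib i j) (trans (cong (λ m → suc (2 * m)) i+j≡M) (sym p≡))
      where
      distrib : ∀ i j → suc (2 * i) ℕ.+ 2 * j ≡ suc (2 * (i ℕ.+ j))
      distrib = ℕRing.solve-∀

  M+0+M : M ℕ.+ 0 ℕ.+ M ≡ 2 * M
  M+0+M = lemma M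
    where
    lemma : ∀ M → M ℕ.+ 0 ℕ.+ M ≡ 2 * M
    lemma = ℕRing.solve-∀

  module Halving = Lerch 2 M 0 M+0+M residues₂
  module HalvingQ = Halving.Asymptotics p∤2 (q p 2) (P·q 2)

  -- This is the case r = 1/2 of the asymptotics, where `H²-M` removes the harmonic sum of order
  -- two.
  H-M : H M ~[ 2 ] P · (q p 2 · q p 2) - 2ℚ · q p 2
  H-M = ~-cancel-unit {u = ½} {v = 2ℚ} {x = H M} {y = P · (q p 2 · q p 2) - 2ℚ · q p 2} (Int-/1 (+ 2)) refl
    (~-combine (lemma (H M) (q p 2) P (H² M))
      (subst (λ r → (1ℚ - r) · H M ~[ 2 ] - q p 2 + P · (½ · (q p 2 · q p 2) - ½ · ((1ℚ - r) · (1ℚ - r) · H² M)))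
        (rec≡// 2) (HalvingQ.asymptotics {2ℚ} (Int-/1 (+ 2)) (cong (λ r → (1ℚ - r) · 2ℚ) (rec≡// 2))))
      (~-neg (~-P· (~-·ˡ (Int-· Int-½ Int-¼) H²-M))))
    where
    lemma : ∀ h q P s → ½ · h - ½ · (P · (q · q) - 2ℚ · q)
      ≡ (((1ℚ - ½) · h - (- q + P · (½ · (q · q) - ½ · ((1ℚ - ½) · (1ℚ - ½) · s))))
        + (- (P · ((½ · ¼) · s)) - (- (P · ((½ · ¼) · 0ℚ)))))
    lemma = solve-∀ ℚ-ring

  data Third (n : ℕ) : Set where
    one : p ≡ suc (3 * n) → Third n
    two : p ≡ suc (suc (3 * n)) → Third n

  -- The number of k with p < 3 k < 2 p.
  middle-length : ∀ {n} → Third n → ℕ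
  middle-length {n} (one _) = n
  middle-length {n} (two _) = suc n

  third-sum : ∀ {n} (t : Third n) → n ℕ.+ middle-length t ℕ.+ n ≡ 2 * M
  third-sum {n} (one eq) = ℕ.suc-injective (trans (cong suc (lemma n)) (trans (sym eq) p≡))
    where
    lemma : ∀ n → n ℕ.+ n ℕ.+ n ≡ 3 * n
    lemma = ℕRing.solve-∀
  third-sum {n} (two eq) = ℕ.suc-injective (trans (cong suc (lemma n)) (trans (sym eq) p≡))
    where
    lemma : ∀ n → n ℕ.+ suc n ℕ.+ n ≡ suc (3 * n)
    lemma = ℕRing.solve-∀

  -- The numbers p - 3 l are congruent to p modulo 3 and the 3 k - p to -p, so they fill the two
  -- nonzero classes; which class is which depends on p modulo 3.
  residues₃ : ∀ {n} (t : Third n) →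
    (ι 3 ^ℚ n · ∏ n (λ i → ι (suc i))) ·
      (∏ n (λ i → P - ι 3 · ι (suc i)) · ∏ (middle-length t) (λ i → ι 3 · ι (suc (n ℕ.+ i)) - P))
    ≡ ∏ (2 * M) (λ i → ι (suc i))
  residues₃ {n} (one eq) = begin
    (ι 3 ^ℚ n · ∏ n (λ i → ι (suc i))) · (∏ n (λ i → P - ι 3 · ι (suc i)) · ∏ n (λ i → ι 3 · ι (suc (n ℕ.+ i)) - P))
      ≡⟨ cong₂ _·_ (∏-multiples 3 n) (cong₂ _·_ (∏-complements 3 n (λ i → suc (3 * i)) complement) (∏-excesses 3 n n (λ i → suc (suc (3 * i))) excess)) ⟩
    c₃ · (c₁ · c₂)    ≡⟨ ℚ.*-comm c₃ (c₁ · c₂) ⟩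
    c₁ · c₂ · c₃      ≡⟨ cong (c₁ · c₂ ·_) (Prod.fold-cong n λ i _ → cong ι (triple i)) ⟩
    c₁ · c₂ · ∏ n (λ i → ι (suc (suc (suc (3 * i)))))
                      ≡⟨ sym (Prod.fold-3* n (λ i → ι (suc i))) ⟩
    ∏ (3 * n) (λ i → ι (suc i))  ≡⟨ cong (λ N → ∏ N (λ i → ι (suc i))) (ℕ.suc-injective (trans (sym eq) p≡)) ⟩
    ∏ (2 * M) (λ i → ι (suc i))  ∎
    where
    open ≡-Reasoning
    c₁ c₂ c₃ : ℚ
    c₁ = ∏ n (λ i → ι (suc (3 * i)))
    c₂ = ∏ n (λ i → ι (suc (suc (3 * i))))
    c₃ = ∏ n (λ i → ι (3 * suc i))
    triple : ∀ i → 3 * suc i ≡ suc (suc (suc (3 * i)))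
    triple = ℕRing.solve-∀
    complement : ∀ i j → i ℕ.+ j ≡ n → suc (3 * i) ℕ.+ 3 * j ≡ p
    complement i j i+j≡n = trans (lemma i j) (trans (cong (λ m → suc (3 * m)) i+j≡n) (sym eq))
      where
      lemma : ∀ i j → suc (3 * i) ℕ.+ 3 * j ≡ suc (3 * (i ℕ.+ j))
      lemma = ℕRing.solve-∀
    excess : ∀ i → suc (suc (3 * i)) ℕ.+ p ≡ 3 * suc (n ℕ.+ i)
    excess i = trans (cong (suc (suc (3 * i)) ℕ.+_) eq) (lemma i n)
      where
      lemma : ∀ i n → suc (suc (3 * i)) ℕ.+ suc (3 * n) ≡ 3 * suc (n ℕ.+ i)
      lemma = ℕRing.solve-∀
  residues₃ {n} (two eq) = begin
    (ι 3 ^ℚ n · ∏ n (λ i → ι (suc i))) · (∏ n (λ i → P - ι 3 · ι (suc i)) · ∏ (suc n) (λ i → ι 3 · ι (suc (n ℕ.+ i)) - P))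
      ≡⟨ cong₂ _·_ (∏-multiples 3 n) (cong₂ _·_ (∏-complements 3 n (λ i → suc (suc (3 * i))) complement) (∏-excesses 3 n (suc n) (λ i → suc (3 * i)) excess)) ⟩
    c₃ · (c₂ · (c₁ · ι (suc (3 * n))))    ≡⟨ lemma c₁ c₂ c₃ (ι (suc (3 * n))) ⟩
    c₁ · c₂ · c₃ · ι (suc (3 * n))        ≡⟨ cong (λ c → c₁ · c₂ · c · ι (suc (3 * n))) (Prod.fold-cong n λ i _ → cong ι (triple i)) ⟩
    c₁ · c₂ · ∏ n (λ i → ι (suc (suc (suc (3 * i))))) · ι (suc (3 * n))
                      ≡⟨ cong (_· ι (suc (3 * n))) (sym (Prod.fold-3* n (λ i → ι (suc i)))) ⟩
    ∏ (suc (3 * n)) (λ i → ι (suc i))  ≡⟨ cong (λ N → ∏ N (λ i → ι (suc i))) (ℕ.suc-injective (trans (sym eq) p≡)) ⟩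
    ∏ (2 * M) (λ i → ι (suc i))  ∎
    where
    open ≡-Reasoning
    c₁ c₂ c₃ : ℚ
    c₁ = ∏ n (λ i → ι (suc (3 * i)))
    c₂ = ∏ n (λ i → ι (suc (suc (3 * i))))
    c₃ = ∏ n (λ i → ι (3 * suc i))
    lemma : ∀ c₁ c₂ c₃ x → c₃ · (c₂ · (c₁ · x)) ≡ c₁ · c₂ · c₃ · x
    lemma = solve-∀ ℚ-ring
    triple : ∀ i → 3 * suc i ≡ suc (suc (suc (3 * i)))
    triple = ℕRing.solve-∀
    complement : ∀ i j → i ℕ.+ j ≡ n → suc (suc (3 * i)) ℕ.+ 3 * j ≡ p
    complement i j i+j≡n = trans (lemma' i j) (trans (cong (λ m → suc (suc (3 * m))) i+j≡n) (sym eq))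
      where
      lemma' : ∀ i j → suc (suc (3 * i)) ℕ.+ 3 * j ≡ suc (suc (3 * (i ℕ.+ j)))
      lemma' = ℕRing.solve-∀
    excess : ∀ i → suc (3 * i) ℕ.+ p ≡ 3 * suc (n ℕ.+ i)
    excess i = trans (cong (suc (3 * i) ℕ.+_) eq) (lemma' i n)
      where
      lemma' : ∀ i n → suc (3 * i) ℕ.+ suc (suc (3 * n)) ≡ 3 * suc (n ℕ.+ i)
      lemma' = ℕRing.solve-∀

  module _ {n} (t : Third n) where
    private
      module Thirds = Lerch 3 n (middle-length t) (third-sum t) (residues₃ t)
      module ThirdsQ = Thirds.Asymptotics p∤3 (q p 3) (P·q 3)

    H-third : H n ~[ 2 ] (- (+ 3 / 2)) · q p 3 + P · ((+ 3 / 4) · (q p 3 · q p 3) - ⅓ · H² n)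
    H-third = ~-cancel-unit {u = + 2 / 3} {v = + 3 / 2} {x = H n} {y = (- (+ 3 / 2)) · q p 3 + P · ((+ 3 / 4) · (q p 3 · q p 3) - ⅓ · H² n)}
      i3/2 refl
      (~-transport (lemma (H n) (q p 3) P (H² n))
        (subst (λ r → (1ℚ - r) · H n ~[ 2 ] - q p 3 + P · (½ · (q p 3 · q p 3) - ½ · ((1ℚ - r) · (1ℚ - r) · H² n)))
          (rec≡// 3) (ThirdsQ.asymptotics {+ 3 / 2} i3/2 (cong (λ r → (1ℚ - r) · (+ 3 / 2)) (rec≡// 3)))))
      where
      i3/2 : Int (+ 3 / 2)
      i3/2 = Int-/ (+ 3) 2 p∤2
      lemma : ∀ h q P s → (+ 2 / 3) · h - (+ 2 / 3) · ((- (+ 3 / 2)) · q + P · ((+ 3 / 4) · (q · q) - ⅓ · s))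
        ≡ (1ℚ - ⅓) · h - (- q + P · (½ · (q · q) - ½ · ((1ℚ - ⅓) · (1ℚ - ⅓) · s)))
      lemma = solve-∀ ℚ-ring

    module _ {e o} (halves : Halves n e o) (n+o≡M : n ℕ.+ o ≡ M) where

      -- As n + o = M, the odd numbers up to n are the p - 2 b with n < b ≤ M. Since H² M ≡ 0 they
      -- contribute - H² n / 4, and the equation can be solved for `H² e`.
      H²-sixth : H² e ~[ 1 ] (+ 5 / 1) · H² n
      H²-sixth = ~-sym (~-cancel-unit {u = ¼} {v = 4ℚ} {x = (+ 5 / 1) · H² n} {y = H² e} (Int-/1 (+ 4)) refl
        (~-combine (lemma (H² n) (H² e) (H² M)) (H²-halves halves n n+o≡M) (~-·ˡ Int-¼ H²-M)))
        where
        lemma : ∀ s t u → ¼ · ((+ 5 / 1) · s) - ¼ · t ≡ (s - (¼ · t + ¼ · (u - s))) + (¼ · u - ¼ · 0ℚ)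
        lemma = solve-∀ ℚ-ring

      H-sixth : H e ~[ 2 ] H n + H M - ½ · (P · H² n)
      H-sixth = ~-sym (~-cancel-unit {u = ½} {v = 2ℚ} {x = H n + H M - ½ · (P · H² n)} {y = H e} (Int-/1 (+ 2)) refl
        (~-combine (lemma (H n) (H e) (H M) P (H² n) (H² M)) (H-halves halves n n+o≡M) (~-neg (~-P· (~-·ˡ Int-¼ H²-M)))))
        where
        lemma : ∀ h k m P s u → ½ · (h + m - ½ · (P · s)) - ½ · k
          ≡ (h - (½ · k + ((- ½) · (m - h) + (- (P · ¼)) · (u - s)))) + (- (P · (¼ · u)) - (- (P · (¼ · 0ℚ))))
        lemma = solve-∀ ℚ-ring

  -- Here 1, ..., M itself is split; its odd members are the p - 2 b with e < b ≤ M, so `H M` and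
  -- `H e` occur on both sides.
  H-quarter : ∀ {e o} → Halves M e o → e ℕ.+ o ≡ M → H e ~[ 2 ] (+ 3 / 2) · H M - ¼ · (P · H² e)
  H-quarter {e} halves e+o≡M = ~-sym (~-combine (lemma (H M) (H e) P (H² e) (H² M)) (H-halves halves e e+o≡M) (~-neg (~-P· (~-·ˡ Int-¼ H²-M))))
    where
    lemma : ∀ m k P s u → ((+ 3 / 2) · m - ¼ · (P · s)) - k
      ≡ (m - (½ · k + ((- ½) · (m - k) + (- (P · ¼)) · (u - s)))) + (- (P · (¼ · u)) - (- (P · (¼ · 0ℚ))))
    lemma = solve-∀ ℚ-ring

-- The sums S(a)

-- w a k = C(a,k) C(-1-a,k), v a k = C(a,k) C(-a,k), R a k = C(a-1,k) C(-a-1,k).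
w v R : ℚ → ℕ → ℚ
w a k = ∏ k λ i → (ι i - a) · (ι (suc i) + a) · rec² (suc i)
v a k = ∏ k λ i → (ι i - a) · (ι i + a) · rec² (suc i)
R a k = ∏ k λ i → (ι (suc i) - a) · (ι (suc i) + a) · rec² (suc i)

S : ℕ → ℚ → ℚ
S n a = ∑ n λ i → w a (suc i) · rec (suc i)

-- The reflection exchanges the two binomial coefficients in w.
w-sym : ∀ a k → w (- 1ℚ - a) k ≡ w a k
w-sym a k = Prod.fold-cong k λ i _ → trans
  (cong (λ z → (ι i - (- 1ℚ - a)) · (z + (- 1ℚ - a)) · rec² (suc i)) (ι-suc i))
  (trans (lemma (ι i) a (rec² (suc i))) (cong (λ z → (ι i - a) · (z + a) · rec² (suc i)) (sym (ι-suc i))))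
  where
  lemma : ∀ k a r → (k - (- 1ℚ - a)) · ((1ℚ + k) + (- 1ℚ - a)) · r ≡ (k - a) · ((1ℚ + k) + a) · r
  lemma = solve-∀ ℚ-ring

S-sym : ∀ n a → S n (- 1ℚ - a) ≡ S n a
S-sym n a = Sum.fold-cong n λ i _ → cong (_· rec (suc i)) (w-sym a (suc i))

ι-0 : ι 0 ≡ 0ℚ
ι-0 = ι≡/1 0

-- This is C(-1-a,k) = (a+k)/a · C(-a,k) without division. With `w-v-pred` it turns a (w a k - w (a
-- - 1) k) into 2 k v a k, whose factor k cancels the 1/k in S.
w-v : ∀ a k → a · w a k ≡ (a + ι k) · v a k
w-v a zero    = cong (_· 1ℚ) (sym (trans (cong (λ z → a + z) ι-0) (ℚ.+-identityʳ a)))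
w-v a (suc k) = begin
  a · (w a k · f)                                   ≡⟨ sym (ℚ.*-assoc a (w a k) f) ⟩
  a · w a k · f                                     ≡⟨ cong (_· f) (w-v a k) ⟩
  (a + ι k) · v a k · f                             ≡⟨ lemma a (ι k) (ι (suc k)) (v a k) (rec² (suc k)) ⟩
  (a + ι (suc k)) · v a (suc k)                     ∎
  where
  open ≡-Reasoning
  f = (ι k - a) · (ι (suc k) + a) · rec² (suc k)
  lemma : ∀ a k k' v r → (a + k) · v · ((k - a) · (k' + a) · r) ≡ (a + k') · (v · ((k - a) · (k + a) · r))
  lemma = solve-∀ ℚ-ring

w-v-pred : ∀ a k → a · w (a - 1ℚ) k ≡ (a - ι k) · v a k
w-v-pred a zero    = cong (_· 1ℚ) (sym (trans (cong (λ z → a - z) ι-0) (ℚ.+-identityʳ a)))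
w-v-pred a (suc k) = begin
  a · (w (a - 1ℚ) k · f)                            ≡⟨ sym (ℚ.*-assoc a (w (a - 1ℚ) k) f) ⟩
  a · w (a - 1ℚ) k · f                              ≡⟨ cong (_· f) (w-v-pred a k) ⟩
  (a - ι k) · v a k · f                             ≡⟨ cong (λ z → (a - ι k) · v a k · ((ι k - (a - 1ℚ)) · (z + (a - 1ℚ)) · rec² (suc k))) (ι-suc k) ⟩
  (a - ι k) · v a k · ((ι k - (a - 1ℚ)) · ((1ℚ + ι k) + (a - 1ℚ)) · rec² (suc k))
                                                    ≡⟨ lemma a (ι k) (v a k) (rec² (suc k)) ⟩
  (a - (1ℚ + ι k)) · v a (suc k)                    ≡⟨ cong (λ z → (a - z) · v a (suc k)) (sym (ι-suc k)) ⟩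
  (a - ι (suc k)) · v a (suc k)                     ∎
  where
  open ≡-Reasoning
  f = (ι k - (a - 1ℚ)) · (ι (suc k) + (a - 1ℚ)) · rec² (suc k)
  lemma : ∀ a k v r → (a - k) · v · ((k - (a - 1ℚ)) · ((1ℚ + k) + (a - 1ℚ)) · r) ≡ (a - (1ℚ + k)) · (v · ((k - a) · (k + a) · r))
  lemma = solve-∀ ℚ-ring

-- The numerator of v at i = 0 is -a²; the other numerators are those of R, and one denominator is
-- left over.
v-R : ∀ a k → v a (suc k) ≡ - (a · a) · R a k · rec² (suc k)
v-R a zero    = trans (cong (λ z → 1ℚ · ((z - a) · (z + a) · rec² 1)) ι-0) (lemma a (rec² 1))
  where
  lemma : ∀ a r → 1ℚ · ((0ℚ - a) · (0ℚ + a) · r) ≡ - (a · a) · 1ℚ · r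
  lemma = solve-∀ ℚ-ring
v-R a (suc k) = trans (cong (_· ((ι (suc k) - a) · (ι (suc k) + a) · rec² (suc (suc k)))) (v-R a k))
  (lemma (a · a) (R a k) (rec² (suc k)) ((ι (suc k) - a) · (ι (suc k) + a)) (rec² (suc (suc k))))
  where
  lemma : ∀ b R r x r' → - b · R · r · (x · r') ≡ - b · (R · (x · r)) · r'
  lemma = solve-∀ ℚ-ring

-- The new factor of R is 1 - a²/(k+1)², and `v-R` recognises the second part. Hence R a n is the
-- sum of v a k over k ≤ n, which is what makes the difference of S telescope.
R-suc : ∀ a k → R a (suc k) ≡ R a k + v a (suc k)
R-suc a k = begin
  R a k · ((ι (suc k) - a) · (ι (suc k) + a) · rec² (suc k))
    ≡⟨ lemma a (R a k) (ι (suc k)) (rec (suc k)) ⟩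
  (ι (suc k) · rec (suc k)) · (ι (suc k) · rec (suc k)) · R a k + - (a · a) · R a k · rec² (suc k)
    ≡⟨ cong₂ (λ x y → x · x · R a k + y) (ι·rec (suc k)) (sym (v-R a k)) ⟩
  1ℚ · 1ℚ · R a k + v a (suc k)
    ≡⟨ cong (_+ v a (suc k)) (ℚ.*-identityˡ (R a k)) ⟩
  R a k + v a (suc k) ∎
  where
  open ≡-Reasoning
  lemma : ∀ a R k r → R · ((k - a) · (k + a) · (r · r)) ≡ (k · r) · (k · r) · R + - (a · a) · R · (r · r)
  lemma = solve-∀ ℚ-ring

S-difference : ∀ n a → a · (S n a - S n (a - 1ℚ)) ≡ 2ℚ · (R a n - 1ℚ)
S-difference zero    a = lemma a
  where
  lemma : ∀ a → a · (0ℚ - 0ℚ) ≡ 2ℚ · (1ℚ - 1ℚ)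
  lemma = solve-∀ ℚ-ring
S-difference (suc n) a = begin
  a · ((S n a + w a (suc n) · r) - (S n (a - 1ℚ) + w (a - 1ℚ) (suc n) · r))
    ≡⟨ lemma₁ a (S n a) (S n (a - 1ℚ)) (w a (suc n)) (w (a - 1ℚ) (suc n)) r ⟩
  a · (S n a - S n (a - 1ℚ)) + (a · w a (suc n) - a · w (a - 1ℚ) (suc n)) · r
    ≡⟨ cong₂ (λ x y → x + y · r) (S-difference n a) (cong₂ _-_ (w-v a (suc n)) (w-v-pred a (suc n))) ⟩
  2ℚ · (R a n - 1ℚ) + ((a + ι (suc n)) · v a (suc n) - (a - ι (suc n)) · v a (suc n)) · r
    ≡⟨ lemma₂ a (R a n) (ι (suc n)) (v a (suc n)) r ⟩
  2ℚ · (R a n + (ι (suc n) · r) · v a (suc n) - 1ℚ)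
    ≡⟨ cong (λ x → 2ℚ · (R a n + x · v a (suc n) - 1ℚ)) (ι·rec (suc n)) ⟩
  2ℚ · (R a n + 1ℚ · v a (suc n) - 1ℚ)
    ≡⟨ cong (λ x → 2ℚ · (x - 1ℚ)) (trans (cong (λ z → R a n + z) (ℚ.*-identityˡ (v a (suc n)))) (sym (R-suc a n))) ⟩
  2ℚ · (R a (suc n) - 1ℚ) ∎
  where
  open ≡-Reasoning
  r = rec (suc n)
  lemma₁ : ∀ a S S' w w' r → a · ((S + w · r) - (S' + w' · r)) ≡ a · (S - S') + (a · w - a · w') · r
  lemma₁ = solve-∀ ℚ-ring
  lemma₂ : ∀ a R k v r → 2ℚ · (R - 1ℚ) + ((a + k) · v - (a - k) · v) · r ≡ 2ℚ · (R + (k · r) · v - 1ℚ)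
  lemma₂ = solve-∀ ℚ-ring

-- In the quotient of R (a + 1) by R a the factors are shifted against each other and all but the
-- outermost cancel.
R-shift : ∀ a n → R (a + 1ℚ) n · ((a + 1ℚ) · (ι n - a)) ≡ - (ι n + 1ℚ + a) · (a · R a n)
R-shift a zero    = trans (cong (λ z → 1ℚ · ((a + 1ℚ) · (z - a))) ι-0) (trans (lemma a) (cong (λ z → - (z + 1ℚ + a) · (a · 1ℚ)) (sym ι-0)))
  where
  lemma : ∀ a → 1ℚ · ((a + 1ℚ) · (0ℚ - a)) ≡ - (0ℚ + 1ℚ + a) · (a · 1ℚ)
  lemma = solve-∀ ℚ-ring
R-shift a (suc n) = subst
  (λ m → R (a + 1ℚ) n · ((m - (a + 1ℚ)) · (m + (a + 1ℚ)) · r²) · ((a + 1ℚ) · (m - a))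
       ≡ - (m + 1ℚ + a) · (a · (R a n · ((m - a) · (m + a) · r²))))
  (sym (ι-suc n))
  (trans (lemma₁ a (ι n) (R (a + 1ℚ) n) r²)
    (trans (cong (λ z → z · ((1ℚ + ι n + 1ℚ + a) · (1ℚ + ι n - a) · r²)) (R-shift a n))
      (lemma₂ a (ι n) (R a n) r²)))
  where
  r² = rec² (suc n)
  lemma₁ : ∀ a k R r → R · (((1ℚ + k) - (a + 1ℚ)) · ((1ℚ + k) + (a + 1ℚ)) · r) · ((a + 1ℚ) · ((1ℚ + k) - a))
    ≡ R · ((a + 1ℚ) · (k - a)) · ((1ℚ + k + 1ℚ + a) · (1ℚ + k - a) · r)
  lemma₁ = solve-∀ ℚ-ring
  lemma₂ : ∀ a k R r → - (k + 1ℚ + a) · (a · R) · ((1ℚ + k + 1ℚ + a) · (1ℚ + k - a) · r)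
    ≡ - ((1ℚ + k) + 1ℚ + a) · (a · (R · (((1ℚ + k) - a) · ((1ℚ + k) + a) · r)))
  lemma₂ = solve-∀ ℚ-ring

-- The values S(n + p t) modulo p²

module BinomialSum (p : ℕ) (p-prime : Prime p) (M : ℕ) (p≡ : p ≡ suc (2 * M)) (3<p : 3 < p) (t : ℚ) (it : Local.Int p p-prime t) where
  open Harmonic p p-prime M p≡ 3<p

  α : ℕ → ℚ
  α j = ι j + P · t

  M≤2M : M ≤ 2 * M
  M≤2M = ℕ.m≤m+n M (M ℕ.+ 0)

  Int-P·t : Int (P · t)
  Int-P·t = Int-· (Int-ι p) it

  Int-α : ∀ j → Int (α j)
  Int-α j = Int-+ (Int-ι j) Int-P·t

  Int-∏ : ∀ n {f : ℕ → ℚ} → (∀ i → i < n → Int (f i)) → Int (∏ n f)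
  Int-∏ zero    i = Int-1
  Int-∏ (suc n) i = Int-· (Int-∏ n λ j j<n → i j (ℕ.m<n⇒m<1+n j<n)) (i n ℕ.≤-refl)

  Int-rec²-suc : ∀ {k} → k ≤ M → ∀ i → i < k → Int (rec² (suc i))
  Int-rec²-suc k≤M i i<k = Int-rec² (∤-suc (ℕ.≤-trans i<k (ℕ.≤-trans k≤M M≤2M)))

  Int-w : ∀ a k → Int a → k ≤ M → Int (w a k)
  Int-w a k ia k≤M = Int-∏ k λ i i<k →
    Int-· (Int-· (Int-- (Int-ι i) ia) (Int-+ (Int-ι (suc i)) ia)) (Int-rec²-suc k≤M i i<k)

  Int-R : ∀ a → Int a → Int (R a M)
  Int-R a ia = Int-∏ M λ i i<k →
    Int-· (Int-· (Int-- (Int-ι (suc i)) ia) (Int-+ (Int-ι (suc i)) ia)) (Int-rec²-suc ℕ.≤-refl i i<k)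

  Int-S : ∀ a → Int a → Int (S M a)
  Int-S a ia = Int-∑ M λ i i<M → Int-· (Int-w a (suc i) ia i<M) (Int-rec-suc M≤2M i i<M)

  -- Cancelling n modulo p first gives x ≡ y modulo p. Then the terms with p τ agree modulo p², and
  -- n can be cancelled there too, without an explicit inverse of n + p τ.
  ~-cancel-perturbed : ∀ {n} τ x y → ¬ p ∣ n → Int τ → Int x → Int y →
    (ι n + P · τ) · x ~[ 2 ] (ι n + P · τ) · y → x ~[ 2 ] y
  ~-cancel-perturbed {n} τ x y p∤n iτ ix iy s = ~-cancel-ι {n = n} {x} {y} p∤n
    (~-combine (lemma (ι n) P τ x y) s (~-P· (~-neg (~-·ˡ iτ x~y))))
    where
    lemma : ∀ n P τ x y → n · x - n · y ≡ ((n + P · τ) · x - (n + P · τ) · y) + (P · (- (τ · x)) - P · (- (τ · y)))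
    lemma = solve-∀ ℚ-ring
    lemma₁ : ∀ n P τ x y → n · x - n · y ≡ ((n + P · τ) · x - (n + P · τ) · y) + ((- P) · (τ · (x - y)) - 0ℚ)
    lemma₁ = solve-∀ ℚ-ring
    lemma₂ : ∀ P z → (- P) · z - 0ℚ ≡ P · (- z)
    lemma₂ = solve-∀ ℚ-ring
    x~y : x ~[ 1 ] y
    x~y = ~-cancel-ι {n = n} {x} {y} p∤n (~-combine {c = (- P) · (τ · (x - y))} {0ℚ} (lemma₁ (ι n) P τ x y) (~-pred s)
      (by (Small-resp (lemma₂ P (τ · (x - y))) (Small-P· (Int⇒Small (Int-neg (Int-· iτ (Int-- ix iy))))))))

  R-α0 : ∀ k → k ≤ M → R (α 0) k ~[ 1 ] 1ℚ
  R-α0 zero    k≤M = ~-refl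
  R-α0 (suc k) k≤M = ~-trans (~-· (Int-∏ k λ i i<k → Int-· (Int-· (Int-- (Int-ι (suc i)) (Int-α 0)) (Int-+ (Int-ι (suc i)) (Int-α 0))) (Int-rec²-suc (ℕ.<⇒≤ k≤M) i i<k))
      Int-1 (R-α0 k (ℕ.<⇒≤ k≤M)) factor~1) (~-reflexive refl)
    where
    m = ι (suc k)
    r = rec (suc k)
    ir = Int-rec-suc M≤2M k k≤M
    lemma : ∀ m r P t → (m - (0ℚ + P · t)) · (m + (0ℚ + P · t)) · (r · r) - (m · r) · (m · r) ≡ P · (- (P · (t · t · (r · r))))
    lemma = solve-∀ ℚ-ring
    factor~1 : (m - α 0) · (m + α 0) · (r · r) ~[ 1 ] 1ℚ
    factor~1 = ~-trans
      (by (Small-resp (trans (cong (λ z → (m - (z + P · t)) · (m + (z + P · t)) · (r · r) - (m · r) · (m · r)) ι-0) (lemma m r P t))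
        (Small-P· (Int⇒Small (Int-neg (Int-· (Int-ι p) (Int-· (Int-· it it) (Int-· ir ir))))))))
      (~-reflexive (cong₂ _·_ (ι·rec (suc k)) (ι·rec (suc k))))

  α-suc : ∀ j → α (suc j) ≡ α j + 1ℚ
  α-suc j = trans (cong (_+ P · t) (ι-suc j)) (lemma (ι j) (P · t))
    where
    lemma : ∀ j x → 1ℚ + j + x ≡ j + x + 1ℚ
    lemma = solve-∀ ℚ-ring

  P≡ : P ≡ 1ℚ + (ι M + ι M)
  P≡ = trans (cong ι p≡) (trans (ι-suc (2 * M)) (cong (λ z → 1ℚ + z) (trans (cong (λ k → ι (M ℕ.+ k)) (ℕ.+-identityʳ M)) (ι-+ M M))))

  -- R-shift preserves this congruence because M + 1 + a = p - (M - a).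
  α·R : ∀ j → j ≤ M → α j · R (α j) M ~[ 2 ] P · t
  α·R zero    j≤M = ~-trans (~-reflexive (trans (cong (λ z → (z + P · t) · R (α 0) M) ι-0) (lemma₁ P t (R (α 0) M))))
    (~-trans (~-P· (~-·ˡ it (R-α0 M ℕ.≤-refl))) (~-reflexive (cong (P ·_) (ℚ.*-identityʳ t))))
    where
    lemma₁ : ∀ P t R → (0ℚ + P · t) · R ≡ P · (t · R)
    lemma₁ = solve-∀ ℚ-ring
  α·R (suc j) j<M = ~-cancel-perturbed {M ∸ j} (- t) (β · R β M) (P · t) (∤-< {{ℕ.>-nonZero (ℕ.m<n⇒0<n∸m j<M)}} M-j<p)
      (Int-neg it) (Int-· (Int-α (suc j)) (Int-R β (Int-α (suc j)))) Int-P·t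
    (~-combine eq
      (~-·ˡ (Int-neg (Int-+ (Int-+ (Int-ι M) Int-1) (Int-α j))) (α·R j (ℕ.<⇒≤ j<M)))
      (~-sym P²~0))
    where
    a β : ℚ
    a = α j
    β = α (suc j)
    M-j<p : M ∸ j < p
    M-j<p = ℕ.≤-<-trans (ℕ.m∸n≤m M j) (subst (M <_) (sym p≡) (s<s M≤2M))
    P²~0 : P · (P · t) ~[ 2 ] 0ℚ
    P²~0 = by (Small-resp (lemma₂ (P · (P · t))) (Small-P· (Small-P· (Int⇒Small it))))
      where
      lemma₂ : ∀ x → x - 0ℚ ≡ x
      lemma₂ = solve-∀ ℚ-ring
    ι-M∸j : ι (M ∸ j) ≡ ι M - ι j
    ι-M∸j = trans (shift (ι (M ∸ j)) (ι j)) (cong (_- ι j) (trans (sym (ι-+ (M ∸ j) j)) (cong ι (ℕ.m∸n+n≡m (ℕ.<⇒≤ j<M)))))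
      where
      shift : ∀ x y → x ≡ (x + y) - y
      shift = solve-∀ ℚ-ring
    lemma₃ : ∀ m j P t β R' → ((m - j) + P · (- t)) · (β · R') ≡ R' · (β · (m - (j + P · t)))
    lemma₃ = solve-∀ ℚ-ring
    shifted : (ι (M ∸ j) + P · (- t)) · (β · R β M) ≡ - (ι M + 1ℚ + a) · (a · R a M)
    shifted = trans (cong (λ z → (z + P · (- t)) · (β · R β M)) ι-M∸j) (trans (lemma₃ (ι M) (ι j) P t β (R β M))
      (trans (cong (λ β → R β M · (β · (ι M - a))) (α-suc j)) (R-shift a M)))
    lemma₄ : ∀ m j P t → ((m - j) + P · (- t)) · (P · t) ≡ (- (m + 1ℚ + (j + P · t))) · (P · t) + ((1ℚ + (m + m)) · (P · t))
    lemma₄ = solve-∀ ℚ-ring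
    target : (ι (M ∸ j) + P · (- t)) · (P · t) ≡ (- (ι M + 1ℚ + a)) · (P · t) + P · (P · t)
    target = trans (cong (λ z → (z + P · (- t)) · (P · t)) ι-M∸j)
      (trans (lemma₄ (ι M) (ι j) P t) (cong (λ z → (- (ι M + 1ℚ + a)) · (P · t) + z · (P · t)) (sym P≡)))
    lemma₅ : ∀ x y z → x - (y + z) ≡ (x - y) + (0ℚ - z)
    lemma₅ = solve-∀ ℚ-ring
    eq : (ι (M ∸ j) + P · (- t)) · (β · R β M) - (ι (M ∸ j) + P · (- t)) · (P · t)
       ≡ ((- (ι M + 1ℚ + a)) · (a · R a M) - (- (ι M + 1ℚ + a)) · (P · t)) + (0ℚ - P · (P · t))
    eq = trans (cong₂ _-_ shifted target) (lemma₅ (- (ι M + 1ℚ + a) · (a · R a M)) ((- (ι M + 1ℚ + a)) · (P · t)) (P · (P · t)))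

  -- `S-difference` and `α·R` give β² D ≡ 2 p t - 2 β. Dividing twice by β = m + p t, where 1/β ≡
  -- 1/m - p t/m², yields 4 p t/m² - 2/m.
  S-step : ∀ j → j < M → S M (α (suc j)) - S M (α j) ~[ 2 ] 4ℚ · (P · t) · rec² (suc j) - 2ℚ · rec (suc j)
  S-step j j<M = ~-cancel-perturbed {suc j} t D X p∤j it iD iX
    (~-cancel-perturbed {suc j} t (β · D) (β · X) p∤j it (Int-· iβ iD) (Int-· iβ iX)
      (~-trans (~-reflexive β²D) (~-combine eq (~-·ˡ (Int-/1 (+ 2)) (α·R (suc j) j<M)) (~-sym P²Y~0))))
    where
    β r D X m Y : ℚ
    β = α (suc j)
    r = rec (suc j)
    m = ι (suc j)
    D = S M β - S M (α j)
    X = 4ℚ · (P · t) · (r · r) - 2ℚ · r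
    -- The excess of β² X over 2 p t - 2 β, divided by p².
    Y = t · t · ((8ℚ - 2ℚ) · r + 4ℚ · (P · t) · (r · r))
      where 8ℚ = 4ℚ + 4ℚ
    p∤j : ¬ p ∣ suc j
    p∤j = ∤-suc (ℕ.<-≤-trans j<M M≤2M)
    ir = Int-rec p∤j
    iβ = Int-α (suc j)
    iD : Int D
    iD = Int-- (Int-S β iβ) (Int-S (α j) (Int-α j))
    iX : Int X
    iX = Int-- (Int-· (Int-· (Int-/1 (+ 4)) Int-P·t) (Int-· ir ir)) (Int-· (Int-/1 (+ 2)) ir)
    α-pred : β - 1ℚ ≡ α j
    α-pred = trans (cong (_- 1ℚ) (α-suc j)) (lemma (α j))
      where
      lemma : ∀ x → x + 1ℚ - 1ℚ ≡ x
      lemma = solve-∀ ℚ-ring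
    β²D : β · (β · D) ≡ 2ℚ · (β · R β M) - 2ℚ · β
    β²D = trans (cong (λ z → β · (β · (S M β - S M z))) (sym α-pred))
      (trans (cong (β ·_) (S-difference M β)) (lemma β (R β M)))
      where
      lemma : ∀ b R → b · (2ℚ · (R - 1ℚ)) ≡ 2ℚ · (b · R) - 2ℚ · b
      lemma = solve-∀ ℚ-ring
    P²Y~0 : P · (P · Y) ~[ 2 ] 0ℚ
    P²Y~0 = by (Small-resp (lemma (P · (P · Y))) (Small-P· (Small-P· (Int⇒Small
      (Int-· (Int-· it it) (Int-+ (Int-· (Int-- (Int-+ (Int-/1 (+ 4)) (Int-/1 (+ 4))) (Int-/1 (+ 2))) ir) (Int-· (Int-· (Int-/1 (+ 4)) Int-P·t) (Int-· ir ir))))))))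
      where
      lemma : ∀ x → x - 0ℚ ≡ x
      lemma = solve-∀ ℚ-ring
    lemma₁ : ∀ m r P t R → (2ℚ · ((m + P · t) · R) - 2ℚ · (m + P · t)) - (m + P · t) · ((m + P · t) · (4ℚ · (P · t) · (r · r) - 2ℚ · r))
      ≡ (2ℚ · ((m + P · t) · R) - 2ℚ · (P · t)) + (0ℚ - P · (P · (t · t · (((4ℚ + 4ℚ) · (m · r) - 2ℚ) · r + 4ℚ · (P · t) · (r · r)))))
        + (2ℚ · m · (m · r - 1ℚ) + 4ℚ · (P · t) · ((m · r) - (m · r) · (m · r)))
    lemma₁ = solve-∀ ℚ-ring
    lemma₂ : ∀ A P t m r → A + (0ℚ - P · (P · (t · t · (((4ℚ + 4ℚ) · 1ℚ - 2ℚ) · r + 4ℚ · (P · t) · (r · r)))))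
        + (2ℚ · m · (1ℚ - 1ℚ) + 4ℚ · (P · t) · (1ℚ - 1ℚ · 1ℚ))
      ≡ A + (0ℚ - P · (P · (t · t · (((4ℚ + 4ℚ) - 2ℚ) · r + 4ℚ · (P · t) · (r · r)))))
    lemma₂ = solve-∀ ℚ-ring
    eq : (2ℚ · (β · R β M) - 2ℚ · β) - β · (β · X) ≡ (2ℚ · (β · R β M) - 2ℚ · (P · t)) + (0ℚ - P · (P · Y))
    eq = trans (lemma₁ m r P t (R β M))
      (trans (cong (λ z → (2ℚ · (β · R β M) - 2ℚ · (P · t)) + (0ℚ - P · (P · (t · t · (((4ℚ + 4ℚ) · z - 2ℚ) · r + 4ℚ · (P · t) · (r · r)))))
        + (2ℚ · m · (z - 1ℚ) + 4ℚ · (P · t) · (z - z · z))) (ι·rec (suc j)))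
        (lemma₂ (2ℚ · (β · R β M) - 2ℚ · (P · t)) P t m r))

  -- The factor with i = 0 contains p, so the others matter only modulo p, where they are i/(i + 1)
  -- and telescope.
  w-α0 : ∀ k → k < M → w (α 0) (suc k) ~[ 2 ] P · (- t · rec (suc k))
  w-α0 zero    0<M = ~-trans (~-reflexive (cong₂ (λ z o → 1ℚ · ((z - (z + P · t)) · (o + (z + P · t)) · rec² 1)) ι-0 (ι≡/1 1)))
    (~-trans (~-reflexive (cong (λ z → 1ℚ · ((0ℚ - (0ℚ + P · t)) · (1ℚ + (0ℚ + P · t)) · (z · z))) (rec≡// 1)))
      (~-trans (by (Small-resp (lemma P t) (Small-P· (Small-P· (Int⇒Small (Int-neg (Int-· it it)))))))
        (~-reflexive (cong (λ z → P · (- t · z)) (sym (rec≡// 1))))))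
    where
    lemma : ∀ P t → 1ℚ · ((0ℚ - (0ℚ + P · t)) · (1ℚ + (0ℚ + P · t)) · (1ℚ · 1ℚ)) - P · (- t · 1ℚ) ≡ P · (P · (- (t · t)))
    lemma = solve-∀ ℚ-ring
  w-α0 (suc k) k<M = ~-trans
    (~-·ʳ (Int-· (Int-· (Int-- (Int-ι (suc k)) (Int-α 0)) (Int-+ (Int-ι (suc (suc k))) (Int-α 0))) (Int-· ir' ir')) (w-α0 k (ℕ.<⇒≤ k<M)))
    (~-trans (~-reflexive (cong (λ z → P · (- t · r) · ((m - (z + P · t)) · (m' + (z + P · t)) · (r' · r'))) ι-0))
      (~-trans (by (Small-resp (lemma₁ P t m m' r r')
          (Small-P· (Small-P· (Int⇒Small (Int-· (Int-· (Int-neg it) (Int-· ir (Int-· ir' ir')))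
            (Int-· it (Int-- (Int-- (Int-ι (suc k)) (Int-ι (suc (suc k)))) Int-P·t))))))))
        (~-reflexive (trans (cong₂ (λ x y → P · (- t · (x · (y · r')))) (ι·rec (suc k)) (ι·rec (suc (suc k)))) (lemma₂ P t r')))))
    where
    m m' r r' : ℚ
    m = ι (suc k)
    m' = ι (suc (suc k))
    r = rec (suc k)
    r' = rec (suc (suc k))
    ir = Int-rec-suc M≤2M k (ℕ.<⇒≤ k<M)
    ir' = Int-rec-suc M≤2M (suc k) k<M
    lemma₁ : ∀ P t m m' r r' → P · (- t · r) · ((m - (0ℚ + P · t)) · (m' + (0ℚ + P · t)) · (r' · r')) - P · (- t · ((m · r) · ((m' · r') · r')))
      ≡ P · (P · ((- t) · (r · (r' · r')) · (t · (m - m' - P · t))))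
    lemma₁ = solve-∀ ℚ-ring
    lemma₂ : ∀ P t r → P · (- t · (1ℚ · (1ℚ · r))) ≡ P · (- t · r)
    lemma₂ = solve-∀ ℚ-ring

  -- The sum of -p t/k² over k ≤ M is - p t · H² M, and p divides `H² M`.
  S-α0 : S M (α 0) ~[ 2 ] 0ℚ
  S-α0 = begin
    S M (α 0)                                              ≈⟨ ~-∑ M (λ i i<M → ~-·ʳ (Int-rec-suc M≤2M i i<M) (w-α0 i i<M)) ⟩
    ∑ M (λ i → P · (- t · rec (suc i)) · rec (suc i))      ≡⟨ Sum.fold-cong M (λ i _ → lemma P t (rec (suc i))) ⟩
    ∑ M (λ i → P · - t · rec² (suc i))                     ≡⟨ ∑-scale M (P · - t) (λ i → rec² (suc i)) ⟩
    P · - t · H² M                                         ≡⟨ ℚ.*-assoc P (- t) (H² M) ⟩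
    P · (- t · H² M)                                       ≈⟨ ~-P· (~-·ˡ (Int-neg it) H²-M) ⟩
    P · (- t · 0ℚ)                                         ≡⟨ lemma₀ P t ⟩
    0ℚ                                                     ∎
    where
    open ~-Reasoning 2
    lemma : ∀ P t r → P · (- t · r) · r ≡ P · - t · (r · r)
    lemma = solve-∀ ℚ-ring
    lemma₀ : ∀ P t → P · (- t · 0ℚ) ≡ 0ℚ
    lemma₀ = solve-∀ ℚ-ring

  S-α : ∀ n → n ≤ M → S M (α n) ~[ 2 ] 4ℚ · (P · t) · H² n - 2ℚ · H n
  S-α zero    n≤M = ~-trans S-α0 (~-reflexive (lemma (4ℚ · (P · t))))
    where
    lemma : ∀ x → 0ℚ ≡ x · 0ℚ - 2ℚ · 0ℚ
    lemma = solve-∀ ℚ-ring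
  S-α (suc n) n<M = ~-combine (lemma (S M (α (suc n))) (S M (α n)) (4ℚ · (P · t)) (H² n) (H n) (rec² (suc n)) (rec (suc n)))
    (S-α n (ℕ.<⇒≤ n<M)) (S-step n n<M)
    where
    lemma : ∀ S' S x s h r² r → S' - (x · (s + r²) - 2ℚ · (h + r)) ≡ (S - (x · s - 2ℚ · h)) + ((S' - S) - (x · r² - 2ℚ · r))
    lemma = solve-∀ ℚ-ring

-- Umbral calculus of the Euler numbers and of U

-- `Defs` keeps the table lookup private; the underscores below are solved by unification with it.
mutual
  entry : List ℤ → ℕ → ℕ → ℤ
  entry = _

  seqS-suc : ∀ c n → seqS c (suc n) ≡ c ×ℤ foldr ℤ._+_ (+ 0)
    (map (λ k → + (suc n C (2 * k)) ×ℤ entry (tableRev c n) n k) (map suc (upTo (suc n div 2))))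
  seqS-suc c n with tableRev c n
  ... | xs = refl

mutual
  entryAt : List ℤ → ℕ → ℕ → ℕ → ℤ
  entryAt = _

  entry≡entryAt : ∀ xs n k → entry xs n k ≡ entryAt xs n (suc n ∸ 2 * k) (n ∸ (suc n ∸ 2 * k))
  entry≡entryAt xs n k with suc n ∸ 2 * k | n ∸ (suc n ∸ 2 * k)
  ... | i | j = refl

mutual
  lookupRev : List ℤ → ℕ → ℕ → List ℤ → ℕ → ℤ
  lookupRev = _

  entryAt-suc : ∀ x xs n i j → entryAt (x ∷ xs) n i (suc j) ≡ lookupRev (x ∷ xs) n i xs j
  entryAt-suc x xs n i j with x ∷ xs
  ... | tab = refl

-- `tab`, `m` and `i` belong to the scope around the local search; they stay fixed while the search
-- descends to a shorter table, so they must be independent of n.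
lookup-table : ∀ c tab m i n j → j ≤ n → lookupRev tab m i (tableRev c n) j ≡ seqS c (n ∸ j)
lookup-table c tab m i zero    zero    _         = refl
lookup-table c tab m i (suc n) zero    _         = refl
lookup-table c tab m i (suc n) (suc j) (s≤s j≤n) = lookup-table c tab m i n j j≤n

-- From 0 < k follows n + 1 - 2 k ≤ n, so the two truncated subtractions cancel.
entry-table : ∀ c n k → 0 < k → entry (tableRev c n) n k ≡ seqS c (suc n ∸ 2 * k)
entry-table c n k 0<k = trans (lookup-table c (tableRev c n) n (suc n ∸ 2 * k) n _ (ℕ.m∸n≤m n (suc n ∸ 2 * k)))
  (cong (seqS c) (ℕ.m∸[m∸n]≡n (ℕ.∸-monoʳ-≤ {m = 1} {n = 2 * k} (suc n) (ℕ.≤-trans 0<k (ℕ.m≤m+n k (k ℕ.+ 0))))))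

∑-applyUpTo : ∀ n (f : ℕ → ℚ) → foldr _+_ 0ℚ (applyUpTo f n) ≡ ∑ n f
∑-applyUpTo zero    f = refl
∑-applyUpTo (suc n) f = trans (cong (λ z → f 0 + z) (∑-applyUpTo n (λ i → f (suc i)))) (sym (Sum.fold-front n f))

/1-∑ : ∀ n (f : ℕ → ℤ) → foldr ℤ._+_ (+ 0) (applyUpTo f n) / 1 ≡ ∑ n (λ i → f i / 1)
/1-∑ zero    f = refl
/1-∑ (suc n) f = trans (/1-+ (f 0) (foldr ℤ._+_ (+ 0) (applyUpTo (λ i → f (suc i)) n)))
  (trans (cong (λ z → f 0 / 1 + z) (/1-∑ n (λ i → f (suc i)))) (sym (Sum.fold-front n (λ i → f i / 1))))

ŝ : ℤ → ℕ → ℚ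
ŝ c n = seqS c n / 1

ŝ-suc : ∀ c n → ŝ c (suc n) ≡ (c / 1) · ∑ (suc n div 2) (λ i → ι (suc n C (2 * suc i)) · ŝ c (suc n ∸ 2 * suc i))
ŝ-suc c n = begin
  seqS c (suc n) / 1          ≡⟨ cong (_/ 1) (seqS-suc c n) ⟩
  (c ×ℤ total) / 1            ≡⟨ /1-* c total ⟩
  (c / 1) · (total / 1)       ≡⟨ cong (λ l → (c / 1) · (foldr ℤ._+_ (+ 0) l / 1)) (trans (cong (map term) (List.map-upTo suc (suc n div 2))) (List.map-applyUpTo suc term (suc n div 2))) ⟩
  (c / 1) · (foldr ℤ._+_ (+ 0) (applyUpTo (λ i → term (suc i)) (suc n div 2)) / 1)
                              ≡⟨ cong ((c / 1) ·_) (/1-∑ (suc n div 2) (λ i → term (suc i))) ⟩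
  (c / 1) · ∑ (suc n div 2) (λ i → term (suc i) / 1)
                              ≡⟨ cong ((c / 1) ·_) (Sum.fold-cong (suc n div 2) λ i _ → term-≡ i) ⟩
  (c / 1) · ∑ (suc n div 2) (λ i → ι (suc n C (2 * suc i)) · ŝ c (suc n ∸ 2 * suc i)) ∎
  where
  open ≡-Reasoning
  term : ℕ → ℤ
  term k = + (suc n C (2 * k)) ×ℤ entry (tableRev c n) n k
  total : ℤ
  total = foldr ℤ._+_ (+ 0) (map term (map suc (upTo (suc n div 2))))
  term-≡ : ∀ i → term (suc i) / 1 ≡ ι (suc n C (2 * suc i)) · ŝ c (suc n ∸ 2 * suc i)
  term-≡ i = trans (/1-* (+ (suc n C (2 * suc i))) (entry (tableRev c n) n (suc i)))
    (cong₂ _·_ (sym (ι≡/1 (suc n C (2 * suc i)))) (cong (_/ 1) (entry-table c n (suc i) (s≤s z≤n))))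

-- B b s n applies (σ + b)^n to the sequence s and evaluates at 0, where σ is the shift: the umbral calculus of s.
B : ℚ → (ℕ → ℚ) → ℕ → ℚ
B b s zero    = s 0
B b s (suc n) = B b (λ m → s (suc m) + b · s m) n

B-cong : ∀ b {s t} n → (∀ m → s m ≡ t m) → B b s n ≡ B b t n
B-cong b zero    eq = eq 0
B-cong b (suc n) eq = B-cong b n λ m → cong₂ (λ x y → x + b · y) (eq (suc m)) (eq m)

B-linear : ∀ b n x y s t → B b (λ m → x · s m + y · t m) n ≡ x · B b s n + y · B b t n
B-linear b zero    x y s t = refl
B-linear b (suc n) x y s t = trans
  (B-cong b n λ m → lemma x y b (s m) (t m) (s (suc m)) (t (suc m)))
  (B-linear b n x y (λ m → s (suc m) + b · s m) (λ m → t (suc m) + b · t m))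
  where
  lemma : ∀ x y b s t s' t' → (x · s' + y · t') + b · (x · s + y · t) ≡ x · (s' + b · s) + y · (t' + b · t)
  lemma = solve-∀ ℚ-ring

-- The shift of the sequence m ↦ (σ + b)^m is multiplication by σ + b, so adding c to it amounts to
-- σ + b + c.
B-∘ : ∀ b c s n → B c (B b s) n ≡ B (b + c) s n
B-∘ b c s zero    = refl
B-∘ b c s (suc n) = trans (B-cong c n λ m → begin
  B b (λ m → s (suc m) + b · s m) m + c · B b s m              ≡⟨ cong (_+ c · B b s m) (sym (ℚ.*-identityˡ (B b (λ m → s (suc m) + b · s m) m))) ⟩
  1ℚ · B b (λ m → s (suc m) + b · s m) m + c · B b s m         ≡⟨ sym (B-linear b m 1ℚ c (λ m → s (suc m) + b · s m) s) ⟩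
  B b (λ m → 1ℚ · (s (suc m) + b · s m) + c · s m) m           ≡⟨ B-cong b m (λ m → lemma b c (s m) (s (suc m))) ⟩
  B b (λ m → s (suc m) + (b + c) · s m) m                      ∎)
  (B-∘ b c (λ m → s (suc m) + (b + c) · s m) n)
  where
  open ≡-Reasoning
  lemma : ∀ b c s s' → 1ℚ · (s' + b · s) + c · s ≡ s' + (b + c) · s
  lemma = solve-∀ ℚ-ring

-- On the sequence y x^m the shift acts as multiplication by x.
B-geometric : ∀ b x y n → B b (λ m → y · x ^ℚ m) n ≡ y · (x + b) ^ℚ n
B-geometric b x y zero    = refl
B-geometric b x y (suc n) = trans (B-cong b n λ m → lemma x y b (x ^ℚ m))
  (trans (B-geometric b x (y · (x + b)) n) (ℚ.*-assoc y (x + b) ((x + b) ^ℚ n)))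
  where
  lemma : ∀ x y b z → y · (x · z) + b · (y · z) ≡ y · (x + b) · z
  lemma = solve-∀ ℚ-ring

B-binomial : ∀ b s n → B b s n ≡ ∑ (suc n) (λ k → ι (n C k) · b ^ℚ k · s (n ∸ k))
B-binomial b s zero    = sym (trans (ℚ.+-identityˡ _) (trans (cong (λ z → z · 1ℚ · s 0) (ι≡/1 1)) (ℚ.*-identityˡ (s 0))))
B-binomial b s (suc n) = begin
  B b (λ m → s (suc m) + b · s m) n
    ≡⟨ B-binomial b (λ m → s (suc m) + b · s m) n ⟩
  ∑ (suc n) (λ k → ι (n C k) · b ^ℚ k · (s (suc (n ∸ k)) + b · s (n ∸ k)))
    ≡⟨ Sum.fold-cong (suc n) (λ k k≤n → trans (cong (λ m → ι (n C k) · b ^ℚ k · (s m + b · s (n ∸ k))) (sym (ℕ.+-∸-assoc 1 (ℕ.≤-pred k≤n))))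
         (lemma (ι (n C k)) b (b ^ℚ k) (s (suc n ∸ k)) (s (n ∸ k)))) ⟩
  ∑ (suc n) (λ k → f k + g k)
    ≡⟨ Sum.fold-∙ (suc n) f g ⟩
  ∑ (suc n) f + ∑ (suc n) g
    ≡⟨ cong (_+ ∑ (suc n) g) (trans (sym (ℚ.+-identityʳ (∑ (suc n) f))) (cong (λ z → ∑ (suc n) f + z) (sym f-last))) ⟩
  ∑ (suc (suc n)) f + ∑ (suc n) g
    ≡⟨ cong (_+ ∑ (suc n) g) (Sum.fold-front (suc n) f) ⟩
  (f 0 + ∑ (suc n) (λ k → f (suc k))) + ∑ (suc n) g
    ≡⟨ ℚ.+-assoc (f 0) (∑ (suc n) (λ k → f (suc k))) (∑ (suc n) g) ⟩
  f 0 + (∑ (suc n) (λ k → f (suc k)) + ∑ (suc n) g)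
    ≡⟨ cong (λ z → h 0 + z) (sym (Sum.fold-∙ (suc n) (λ k → f (suc k)) g)) ⟩
  h 0 + ∑ (suc n) (λ k → f (suc k) + g k)
    ≡⟨ cong (λ z → h 0 + z) (Sum.fold-cong (suc n) λ k _ → pascal k) ⟩
  h 0 + ∑ (suc n) (λ k → h (suc k))
    ≡⟨ sym (Sum.fold-front (suc n) h) ⟩
  ∑ (suc (suc n)) h ∎
  where
  open ≡-Reasoning
  f g h : ℕ → ℚ
  f k = ι (n C k) · b ^ℚ k · s (suc n ∸ k)
  g k = ι (n C k) · b ^ℚ suc k · s (n ∸ k)
  h k = ι (suc n C k) · b ^ℚ k · s (suc n ∸ k)
  lemma : ∀ c b x y z → c · x · (y + b · z) ≡ c · x · y + c · (b · x) · z
  lemma = solve-∀ ℚ-ring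
  collect : ∀ c c' x y → c' · x · y + c · x · y ≡ (c + c') · x · y
  collect = solve-∀ ℚ-ring
  f-last : f (suc n) ≡ 0ℚ
  f-last = trans (cong (λ c → ι c · b ^ℚ suc n · s (suc n ∸ suc n)) (k>n⇒nCk≡0 (ℕ.n<1+n n)))
    (trans (cong (λ z → z · b ^ℚ suc n · s (suc n ∸ suc n)) ι-0) (annihilate (b ^ℚ suc n) (s (suc n ∸ suc n))))
    where
    annihilate : ∀ x y → 0ℚ · x · y ≡ 0ℚ
    annihilate = solve-∀ ℚ-ring
  pascal : ∀ k → f (suc k) + g k ≡ h (suc k)
  pascal k = trans (collect (ι (n C k)) (ι (n C suc k)) (b ^ℚ suc k) (s (n ∸ k)))
    (cong (λ c → c · b ^ℚ suc k · s (n ∸ k)) (trans (sym (ι-+ (n C k) (n C suc k))) (cong ι (nCk+nC[k+1]≡[n+1]C[k+1] n k))))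

sign : ℕ → ℚ
sign n = (- 1ℚ) ^ℚ n

sign-2* : ∀ n → sign (2 * n) ≡ 1ℚ
sign-2* zero    = refl
sign-2* (suc n) = trans (cong (λ k → - 1ℚ · sign k) (ℕ.+-suc n (n ℕ.+ 0))) (cong (λ z → - 1ℚ · (- 1ℚ · z)) (sign-2* n))

sign-suc-2* : ∀ n → sign (suc (2 * n)) ≡ - 1ℚ
sign-suc-2* n = cong (- 1ℚ ·_) (sign-2* n)

1^ℚ : ∀ n → 1ℚ ^ℚ n ≡ 1ℚ
1^ℚ zero    = refl
1^ℚ (suc n) = cong (1ℚ ·_) (1^ℚ n)

halves : ∀ n → Σ[ o ∈ ℕ ] Halves n (n div 2) o
halves n with n ℕ.% 2 | ℕ.m≡m%n+[m/n]*n n 2 | ℕ.m%n<n n 2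
... | 0 | eq | _ = _ , subst (λ m → Halves m (n div 2) (n div 2)) (sym (trans eq (ℕ.*-comm (n div 2) 2))) (even (n div 2))
... | 1 | eq | _ = _ , subst (λ m → Halves m (n div 2) (suc (n div 2))) (sym (trans eq (cong suc (ℕ.*-comm (n div 2) 2)))) (odd (n div 2))
... | suc (suc _) | _ | s≤s (s≤s ())

-- The odd powers of 1 and -1 cancel and the even ones double. What remains in the bracket is the
-- expression governed by the recurrence of `ŝ c`.
B-even : ∀ c n → B 1ℚ (ŝ c) n + B (- 1ℚ) (ŝ c) n ≡ 2ℚ · (ŝ c n + ∑ (n div 2) (λ i → ι (n C (2 * suc i)) · ŝ c (n ∸ 2 * suc i)))
B-even c n = begin
  B 1ℚ s n + B (- 1ℚ) s n
    ≡⟨ cong₂ _+_ (B-binomial 1ℚ s n) (B-binomial (- 1ℚ) s n) ⟩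
  ∑ (suc n) (λ k → ι (n C k) · 1ℚ ^ℚ k · s (n ∸ k)) + ∑ (suc n) (λ k → ι (n C k) · sign k · s (n ∸ k))
    ≡⟨ sym (Sum.fold-∙ (suc n) _ _) ⟩
  ∑ (suc n) (λ k → ι (n C k) · 1ℚ ^ℚ k · s (n ∸ k) + ι (n C k) · sign k · s (n ∸ k))
    ≡⟨ Sum.fold-cong (suc n) (λ k _ → trans (cong (λ z → ι (n C k) · z · s (n ∸ k) + ι (n C k) · sign k · s (n ∸ k)) (1^ℚ k))
         (collect (ι (n C k)) (sign k) (s (n ∸ k)))) ⟩
  ∑ (suc n) f
    ≡⟨ Sum.fold-front n f ⟩
  f 0 + ∑ n (λ k → f (suc k))
    ≡⟨ cong (λ z → f 0 + z) (∑-halves (proj₂ (halves n)) f) ⟩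
  f 0 + (∑ (n div 2) (λ i → f (2 * suc i)) + ∑ (proj₁ (halves n)) (λ i → f (suc (2 * i))))
    ≡⟨ cong₂ (λ x y → f 0 + (x + y)) evens odds ⟩
  f 0 + (2ℚ · T + 0ℚ)
    ≡⟨ cong (λ z → (1ℚ + 1ℚ) · (z · s n) + (2ℚ · T + 0ℚ)) (ι≡/1 1) ⟩
  (1ℚ + 1ℚ) · (1ℚ · s n) + (2ℚ · T + 0ℚ)
    ≡⟨ lemma (s n) T ⟩
  2ℚ · (s n + T) ∎
  where
  open ≡-Reasoning
  s : ℕ → ℚ
  s = ŝ c
  f : ℕ → ℚ
  f k = (1ℚ + sign k) · (ι (n C k) · s (n ∸ k))
  T : ℚ
  T = ∑ (n div 2) (λ i → ι (n C (2 * suc i)) · s (n ∸ 2 * suc i))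
  collect : ∀ c x y → c · 1ℚ · y + c · x · y ≡ (1ℚ + x) · (c · y)
  collect = solve-∀ ℚ-ring
  lemma : ∀ s T → (1ℚ + 1ℚ) · (1ℚ · s) + (2ℚ · T + 0ℚ) ≡ 2ℚ · (s + T)
  lemma = solve-∀ ℚ-ring
  evens : ∑ (n div 2) (λ i → f (2 * suc i)) ≡ 2ℚ · T
  evens = trans (Sum.fold-cong (n div 2) λ i _ → cong (λ z → (1ℚ + z) · (ι (n C (2 * suc i)) · s (n ∸ 2 * suc i))) (sign-2* (suc i)))
    (∑-scale (n div 2) 2ℚ (λ i → ι (n C (2 * suc i)) · s (n ∸ 2 * suc i)))
  odds : ∑ (proj₁ (halves n)) (λ i → f (suc (2 * i))) ≡ 0ℚ
  odds = trans (Sum.fold-cong (proj₁ (halves n)) λ i _ → cong (λ z → (1ℚ + z) · (ι (n C suc (2 * i)) · s (n ∸ suc (2 * i)))) (sign-suc-2* i))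
    (trans (∑-scale (proj₁ (halves n)) 0ℚ (λ i → ι (n C suc (2 * i)) · s (n ∸ suc (2 * i)))) (ℚ.*-zeroˡ (∑ (proj₁ (halves n)) (λ i → ι (n C suc (2 * i)) · s (n ∸ suc (2 * i))))))

-- The recurrence in umbral form, (E + 1)^m + (E - 1)^m = 2 · 0^m; the convention 0^0 = 1 encodes
-- the initial value.
B-E : ∀ m → B 1ℚ (ŝ (ℤ.- + 1)) m + B (- 1ℚ) (ŝ (ℤ.- + 1)) m ≡ 2ℚ · 0ℚ ^ℚ m
B-E zero    = refl
B-E (suc m) = trans (B-even (ℤ.- + 1) (suc m)) (trans (cong (λ z → 2ℚ · (z + T)) (ŝ-suc (ℤ.- + 1) m)) (lemma T (0ℚ ^ℚ m)))
  where
  T = ∑ (suc m div 2) (λ i → ι (suc m C (2 * suc i)) · ŝ (ℤ.- + 1) (suc m ∸ 2 * suc i))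
  lemma : ∀ T z → 2ℚ · ((- 1ℚ) · T + T) ≡ 2ℚ · (0ℚ · z)
  lemma = solve-∀ ℚ-ring

-- In umbral form (U + 1)^m + (U - 1)^m - U^m = 0^m: for m > 0 the factor -2 of the recurrence makes
-- the right side of `B-even` equal to U_m.
B-U : ∀ m → (B 1ℚ (ŝ (ℤ.- + 2)) m + B (- 1ℚ) (ŝ (ℤ.- + 2)) m) - ŝ (ℤ.- + 2) m ≡ 1ℚ · 0ℚ ^ℚ m
B-U zero    = refl
B-U (suc m) = trans (cong (_- ŝ (ℤ.- + 2) (suc m)) (B-even (ℤ.- + 2) (suc m)))
  (trans (cong (λ z → 2ℚ · (z + T) - z) (ŝ-suc (ℤ.- + 2) m)) (lemma T (0ℚ ^ℚ m)))
  where
  T = ∑ (suc m div 2) (λ i → ι (suc m C (2 * suc i)) · ŝ (ℤ.- + 2) (suc m ∸ 2 * suc i))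
  lemma : ∀ T z → 2ℚ · ((- 2ℚ) · T + T) - (- 2ℚ) · T ≡ 1ℚ · (0ℚ · z)
  lemma = solve-∀ ℚ-ring

-- Translation by c: (σ + c)^N is applied to both sides of `B-E` and turns 2 · 0^m into 2 c^N.
E-functional : ∀ N c → B (1ℚ + c) (ŝ (ℤ.- + 1)) N + B (- 1ℚ + c) (ŝ (ℤ.- + 1)) N ≡ 2ℚ · c ^ℚ N
E-functional N c = begin
  B (1ℚ + c) s N + B (- 1ℚ + c) s N                      ≡⟨ sym (cong₂ _+_ (B-∘ 1ℚ c s N) (B-∘ (- 1ℚ) c s N)) ⟩
  B c (B 1ℚ s) N + B c (B (- 1ℚ) s) N                    ≡⟨ unitary (B c (B 1ℚ s) N) (B c (B (- 1ℚ) s) N) ⟩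
  1ℚ · B c (B 1ℚ s) N + 1ℚ · B c (B (- 1ℚ) s) N          ≡⟨ sym (B-linear c N 1ℚ 1ℚ (B 1ℚ s) (B (- 1ℚ) s)) ⟩
  B c (λ m → 1ℚ · B 1ℚ s m + 1ℚ · B (- 1ℚ) s m) N        ≡⟨ B-cong c N (λ m → trans (sym (unitary (B 1ℚ s m) (B (- 1ℚ) s m))) (B-E m)) ⟩
  B c (λ m → 2ℚ · 0ℚ ^ℚ m) N                             ≡⟨ B-geometric c 0ℚ 2ℚ N ⟩
  2ℚ · (0ℚ + c) ^ℚ N                                     ≡⟨ cong (λ z → 2ℚ · z ^ℚ N) (ℚ.+-identityˡ c) ⟩
  2ℚ · c ^ℚ N                                            ∎
  where
  open ≡-Reasoning
  s = ŝ (ℤ.- + 1)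
  unitary : ∀ x y → x + y ≡ 1ℚ · x + 1ℚ · y
  unitary = solve-∀ ℚ-ring

U-functional : ∀ N c → (B (1ℚ + c) (ŝ (ℤ.- + 2)) N + B (- 1ℚ + c) (ŝ (ℤ.- + 2)) N) - B c (ŝ (ℤ.- + 2)) N ≡ c ^ℚ N
U-functional N c = begin
  (B (1ℚ + c) s N + B (- 1ℚ + c) s N) - B c s N          ≡⟨ sym (cong₂ (λ x y → (x + y) - B c s N) (B-∘ 1ℚ c s N) (B-∘ (- 1ℚ) c s N)) ⟩
  (B c (B 1ℚ s) N + B c (B (- 1ℚ) s) N) - B c s N        ≡⟨ unitary (B c (B 1ℚ s) N) (B c (B (- 1ℚ) s) N) (B c s N) ⟩
  1ℚ · (1ℚ · B c (B 1ℚ s) N + 1ℚ · B c (B (- 1ℚ) s) N) + (- 1ℚ) · B c s N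
    ≡⟨ cong (λ z → 1ℚ · z + (- 1ℚ) · B c s N) (sym (B-linear c N 1ℚ 1ℚ (B 1ℚ s) (B (- 1ℚ) s))) ⟩
  1ℚ · B c (λ m → 1ℚ · B 1ℚ s m + 1ℚ · B (- 1ℚ) s m) N + (- 1ℚ) · B c s N
    ≡⟨ sym (B-linear c N 1ℚ (- 1ℚ) (λ m → 1ℚ · B 1ℚ s m + 1ℚ · B (- 1ℚ) s m) s) ⟩
  B c (λ m → 1ℚ · (1ℚ · B 1ℚ s m + 1ℚ · B (- 1ℚ) s m) + (- 1ℚ) · s m) N
    ≡⟨ B-cong c N (λ m → trans (sym (unitary (B 1ℚ s m) (B (- 1ℚ) s m) (s m))) (B-U m)) ⟩
  B c (λ m → 1ℚ · 0ℚ ^ℚ m) N                             ≡⟨ B-geometric c 0ℚ 1ℚ N ⟩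
  1ℚ · (0ℚ + c) ^ℚ N                                     ≡⟨ trans (ℚ.*-identityˡ _) (cong (_^ℚ N) (ℚ.+-identityˡ c)) ⟩
  c ^ℚ N                                                 ∎
  where
  open ≡-Reasoning
  s = ŝ (ℤ.- + 2)
  unitary : ∀ x y z → (x + y) - z ≡ 1ℚ · (1ℚ · x + 1ℚ · y) + (- 1ℚ) · z
  unitary = solve-∀ ℚ-ring

-- With T the shift by 1, multiplying (T² - T + 1) g = T F by T + 1 gives (T³ + 1) g = (T² + T) F.
U-functional₃ : ∀ N c → B (3ℚ + c) (ŝ (ℤ.- + 2)) N + B c (ŝ (ℤ.- + 2)) N ≡ (1ℚ + c) ^ℚ N + (2ℚ + c) ^ℚ N
U-functional₃ N c = begin
  g (3ℚ + c) + g c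
    ≡⟨ lemma (g (3ℚ + c)) (g (2ℚ + c)) (g (1ℚ + c)) (g c) ⟩
  ((g (2ℚ + c) + g c) - g (1ℚ + c)) + ((g (3ℚ + c) + g (1ℚ + c)) - g (2ℚ + c))
    ≡⟨ cong₂ _+_
        (cong₂ (λ x y → (g x + g y) - g (1ℚ + c)) (shift₁ c) (shift₂ c))
        (cong₂ (λ x y → (g x + g y) - g (2ℚ + c)) (shift₃ c) (shift₄ c)) ⟩
  ((g (1ℚ + (1ℚ + c)) + g (- 1ℚ + (1ℚ + c))) - g (1ℚ + c)) + ((g (1ℚ + (2ℚ + c)) + g (- 1ℚ + (2ℚ + c))) - g (2ℚ + c))
    ≡⟨ cong₂ _+_ (U-functional N (1ℚ + c)) (U-functional N (2ℚ + c)) ⟩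
  (1ℚ + c) ^ℚ N + (2ℚ + c) ^ℚ N ∎
  where
  open ≡-Reasoning
  g : ℚ → ℚ
  g c = B c (ŝ (ℤ.- + 2)) N
  lemma : ∀ x₃ x₂ x₁ x₀ → x₃ + x₀ ≡ ((x₂ + x₀) - x₁) + ((x₃ + x₁) - x₂)
  lemma = solve-∀ ℚ-ring
  shift₁ : ∀ c → 2ℚ + c ≡ 1ℚ + (1ℚ + c)
  shift₁ = solve-∀ ℚ-ring
  shift₂ : ∀ c → c ≡ - 1ℚ + (1ℚ + c)
  shift₂ = solve-∀ ℚ-ring
  shift₃ : ∀ c → 3ℚ + c ≡ 1ℚ + (2ℚ + c)
  shift₃ = solve-∀ ℚ-ring
  shift₄ : ∀ c → 1ℚ + c ≡ - 1ℚ + (2ℚ + c)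
  shift₄ = solve-∀ ℚ-ring

-- Factorials, signs and alternating sums

C-factorial : ∀ {n k} → k ≤ n → (n C k) * (k ! * (n ∸ k) !) ≡ n !
C-factorial {n} {k} k≤n = trans (cong (_* (k ! * (n ∸ k) !)) (nCk≡n!/k![n-k]! k≤n)) (ℕ.m/n*n≡m (k![n∸k]!∣n! k≤n))
  where instance _ = k !* n ∸ k !≢0

B-0 : ∀ s n → B 0ℚ s n ≡ s n
B-0 s zero    = refl
B-0 s (suc n) = trans (B-cong 0ℚ n λ m → lemma (s (suc m)) (s m)) (B-0 (λ m → s (suc m)) n)
  where
  lemma : ∀ x y → x + 0ℚ · y ≡ x
  lemma = solve-∀ ℚ-ring

neg-^ℚ : ∀ x n → (- x) ^ℚ n ≡ sign n · x ^ℚ n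
neg-^ℚ x zero    = refl
neg-^ℚ x (suc n) = trans (cong ((- x) ·_) (neg-^ℚ x n)) (lemma x (sign n) (x ^ℚ n))
  where
  lemma : ∀ x s y → (- x) · (s · y) ≡ (- 1ℚ · s) · (x · y)
  lemma = solve-∀ ℚ-ring

sign² : ∀ n → sign n · sign n ≡ 1ℚ
sign² n = trans (sym (^ℚ-+ (- 1ℚ) n n)) (trans (cong (λ k → sign (n ℕ.+ k)) (sym (ℕ.+-identityʳ n))) (sign-2* n))

-- Evens minus odds is twice the evens minus everything, and the evens contribute H² e / 4.
alternating-rec² : ∀ {n e o} → Halves n e o → ∑ n (λ i → sign (suc i) · rec² (suc i)) ≡ ½ · H² e - H² n
alternating-rec² {n} {e} {o} hs = begin
  ∑ n (λ i → sign (suc i) · rec² (suc i))           ≡⟨ ∑-halves hs (λ k → sign k · rec² k) ⟩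
  ∑ e (λ i → sign (2 * suc i) · rec² (2 * suc i)) + ∑ o (λ i → sign (suc (2 * i)) · rec² (suc (2 * i)))
    ≡⟨ cong₂ _+_
        (trans (Sum.fold-cong e λ i _ → trans (cong₂ _·_ (sign-2* (suc i)) (rec²-2* (suc i))) (ℚ.*-identityˡ (¼ · rec² (suc i)))) (∑-scale e ¼ (λ i → rec² (suc i))))
        (trans (Sum.fold-cong o λ i _ → cong (_· rec² (suc (2 * i))) (sign-suc-2* i)) (∑-scale o (- 1ℚ) (λ i → rec² (suc (2 * i))))) ⟩
  ¼ · H² e + (- 1ℚ) · odds                          ≡⟨ lemma (H² e) odds ⟩
  ½ · H² e - (¼ · H² e + odds)                      ≡⟨ cong (λ z → ½ · H² e - z) (sym H²-split) ⟩
  ½ · H² e - H² n                                   ∎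
  where
  open ≡-Reasoning
  odds = ∑ o (λ i → rec² (suc (2 * i)))
  H²-split : H² n ≡ ¼ · H² e + odds
  H²-split = trans (∑-halves hs rec²) (cong (_+ odds) (trans (Sum.fold-cong e λ i _ → rec²-2* (suc i)) (∑-scale e ¼ (λ i → rec² (suc i)))))
  lemma : ∀ x y → ¼ · x + (- 1ℚ) · y ≡ ½ · x - (¼ · x + y)
  lemma = solve-∀ ℚ-ring

telescope : ∀ n (G : ℕ → ℚ) → ∑ n (λ d → sign d · (G (suc d) + G d)) ≡ G 0 - sign n · G n
telescope zero    G = lemma (G 0)
  where
  lemma : ∀ x → 0ℚ ≡ x - 1ℚ · x
  lemma = solve-∀ ℚ-ring
telescope (suc n) G = trans (cong (_+ sign n · (G (suc n) + G n)) (telescope n G)) (lemma (G 0) (sign n) (G n) (G (suc n)))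
  where
  lemma : ∀ x s y z → (x - s · y) + s · (z + y) ≡ x - (- 1ℚ · s) · z
  lemma = solve-∀ ℚ-ring

-- Power sums modulo p and the values of E and U at p - 3

module PowerSums (p : ℕ) (p-prime : Prime p) (M : ℕ) (p≡ : p ≡ suc (2 * M)) (3<p : 3 < p) where
  open FractionalHarmonic p p-prime M p≡ 3<p

  ∤-! : ∀ {n} → n < p → ¬ p ∣ n !
  ∤-! {zero}  _   = p∤1
  ∤-! {suc n} n<p = ∤-* (∤-< n<p) (∤-! (ℕ.<-trans (ℕ.n<1+n n) n<p))

  ∣-C : ∀ {k} → 0 < k → k < p → p ∣ p C k
  ∣-C {k} 0<k k<p with euclidsLemma (p C k) (k ! * (p ∸ k) !) p-prime (subst (p ∣_) (sym (C-factorial (ℕ.<⇒≤ k<p))) (n∣n! p))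
    where
    n∣n! : ∀ n .{{_ : NonZero n}} → n ∣ n !
    n∣n! (suc n) = ℕ.m∣m*n (n !)
  ... | inj₁ p∣C = p∣C
  ... | inj₂ p∣! = ⊥-elim (∤-* (∤-! k<p) (∤-! (ℕ.∸-monoʳ-< 0<k (ℕ.<⇒≤ k<p))) p∣!)

  ι~0 : ∀ {n} → p ∣ n → ι n ~[ 1 ] 0ℚ
  ι~0 (divides k refl) = ~-trans (~-reflexive (trans (ι-* k p) (ℚ.*-comm (ι k) P)))
    (~-trans (~-P· (~-refl {x = ι k})) (by (Small-resp (lemma P (ι k)) (Small-P· (Int⇒Small (Int-ι k))))))
    where
    lemma : ∀ P x → P · x - 0ℚ ≡ P · x
    lemma = solve-∀ ℚ-ring

  -- Induction on a: `B` with b = 1 on the sequence a^m is (a + 1)^p, and p divides its inner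
  -- binomial coefficients.
  fermat : ∀ a → ι a ^ℚ p ~[ 1 ] ι a
  fermat zero    = ~-reflexive (trans (cong (λ n → ι 0 ^ℚ n) p≡) (trans (cong (_· ι 0 ^ℚ (2 * M)) ι-0) (trans (ℚ.*-zeroˡ (ι 0 ^ℚ (2 * M))) (sym ι-0))))
  fermat (suc a) = begin
    ι (suc a) ^ℚ p                                ≡⟨ cong (_^ℚ p) (trans (ι-suc a) (ℚ.+-comm 1ℚ (ι a))) ⟩
    (ι a + 1ℚ) ^ℚ p                               ≡⟨ sym (ℚ.*-identityˡ ((ι a + 1ℚ) ^ℚ p)) ⟩
    1ℚ · (ι a + 1ℚ) ^ℚ p                          ≡⟨ sym (B-geometric 1ℚ (ι a) 1ℚ p) ⟩
    B 1ℚ (λ m → 1ℚ · ι a ^ℚ m) p                  ≡⟨ B-binomial 1ℚ (λ m → 1ℚ · ι a ^ℚ m) p ⟩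
    ∑ p f + f p                                   ≡⟨ cong (λ n → ∑ n f + f p) p≡ ⟩
    ∑ (suc (2 * M)) f + f p                       ≡⟨ cong (_+ f p) (Sum.fold-front (2 * M) f) ⟩
    (f 0 + ∑ (2 * M) (λ i → f (suc i))) + f p     ≈⟨ ~-+ (~-+ (~-reflexive f-first) middle~0) (~-reflexive f-last) ⟩
    (ι a ^ℚ p + 0ℚ) + 1ℚ                          ≡⟨ cong (_+ 1ℚ) (ℚ.+-identityʳ (ι a ^ℚ p)) ⟩
    ι a ^ℚ p + 1ℚ                                 ≈⟨ ~-+ (fermat a) (~-refl {x = 1ℚ}) ⟩
    ι a + 1ℚ                                      ≡⟨ trans (ℚ.+-comm (ι a) 1ℚ) (sym (ι-suc a)) ⟩
    ι (suc a)                                     ∎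
    where
    open ~-Reasoning 1
    f : ℕ → ℚ
    f k = ι (p C k) · 1ℚ ^ℚ k · (1ℚ · ι a ^ℚ (p ∸ k))
    f-first : f 0 ≡ ι a ^ℚ p
    f-first = trans (cong (λ z → z · 1ℚ · (1ℚ · ι a ^ℚ p)) (ι≡/1 1)) (lemma (ι a ^ℚ p))
      where
      lemma : ∀ x → 1ℚ · 1ℚ · (1ℚ · x) ≡ x
      lemma = solve-∀ ℚ-ring
    f-last : f p ≡ 1ℚ
    f-last = trans (cong₂ (λ c k → ι c · 1ℚ ^ℚ p · (1ℚ · ι a ^ℚ k)) (nCn≡1 p) (ℕ.n∸n≡0 p))
      (cong₂ (λ x y → x · y · (1ℚ · 1ℚ)) (ι≡/1 1) (1^ℚ p))
    middle~0 : ∑ (2 * M) (λ i → f (suc i)) ~[ 1 ] 0ℚ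
    middle~0 = ~-trans (~-∑ (2 * M) {g = λ i → 0ℚ · 0ℚ} λ i i<2M → ~-trans
        (~-reflexive (ℚ.*-assoc (ι (p C suc i)) (1ℚ ^ℚ suc i) (1ℚ · ι a ^ℚ (p ∸ suc i))))
        (~-trans (~-·ʳ (Int-· (Int-^ (suc i) Int-1) (Int-· Int-1 (Int-^ (p ∸ suc i) (Int-ι a)))) (ι~0 (∣-C z<s (subst (suc i <_) (sym p≡) (s<s i<2M)))))
          (~-reflexive (ℚ.*-zeroˡ (1ℚ ^ℚ suc i · (1ℚ · ι a ^ℚ (p ∸ suc i)))))))
      (~-reflexive (trans (∑-scale (2 * M) 0ℚ (λ _ → 0ℚ)) (ℚ.*-zeroˡ (∑ (2 * M) (λ _ → 0ℚ)))))

  N : ℕ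
  N = p ∸ 3

  N+2 : suc (suc N) ≡ 2 * M
  N+2 = ℕ.suc-injective (trans (ℕ.m+[n∸m]≡n (ℕ.<⇒≤ 3<p)) p≡)

  -- Multiplied by a³, both sides become a modulo p.
  ι^N : ∀ {a} → ¬ p ∣ a → ι a ^ℚ N ~[ 1 ] rec² a
  ι^N {a} p∤a = ~-cancel-ι {n = a} p∤a (~-cancel-ι {n = a} p∤a (~-cancel-ι {n = a} p∤a
    (~-trans (~-reflexive (cong (λ n → ι a ^ℚ n) (trans (cong suc N+2) (sym p≡))))
      (~-trans (fermat a) (~-reflexive (sym (trans (lemma (ι a) (rec a))
        (trans (cong (λ z → ι a · z · z) (ι·rec a {{∤⇒NonZero p∤a}})) (trans (ℚ.*-identityʳ (ι a · 1ℚ)) (ℚ.*-identityʳ (ι a)))))))))))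
    where
    lemma : ∀ a r → a · (a · (a · (r · r))) ≡ a · (a · r) · (a · r)
    lemma = solve-∀ ℚ-ring

  sign-N : sign N ≡ 1ℚ
  sign-N = trans (lemma (sign N)) (trans (cong sign N+2) (sign-2* M))
    where
    lemma : ∀ x → x ≡ - 1ℚ · (- 1ℚ · x)
    lemma = solve-∀ ℚ-ring

  0^N : ∀ {x} → Int x → x ~[ 1 ] 0ℚ → x ^ℚ N ~[ 1 ] 0ℚ
  0^N {x} ix x~0 = power N (ℕ.m<n⇒0<n∸m 3<p)
    where
    power : ∀ n → 0 < n → x ^ℚ n ~[ 1 ] 0ℚ
    power (suc n) _ = ~-trans (~-·ʳ (Int-^ n ix) x~0) (~-reflexive (ℚ.*-zeroˡ (x ^ℚ n)))

  alternating : ℕ → ℕ → ℚ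
  alternating μ n = ∑ n λ i → sign (suc i) · ι (μ * suc i) ^ℚ N

  Int-sign : ∀ n → Int (sign n)
  Int-sign n = Int-^ n (Int-neg Int-1)

  -- The sum is recentred at the index l where μ l + e is divisible by p.
  recentre : ∀ μ e l r κ → l ℕ.+ suc r ≡ p → μ * l ℕ.+ e ≡ κ * p →
    ∑ p (λ d → sign d · ι (μ * d ℕ.+ e) ^ℚ N) ~[ 1 ] sign l · (alternating μ l + alternating μ r)
  recentre μ e l r κ l+1+r≡p μl+e≡κp = begin
    ∑ p f                                                             ≡⟨ cong (λ n → ∑ n f) (sym l+1+r≡p) ⟩
    ∑ (l ℕ.+ suc r) f                                                 ≡⟨ Sum.fold-++ l (suc r) f ⟩
    ∑ l f + ∑ (suc r) (λ i → f (l ℕ.+ i))                             ≡⟨ cong (λ z → ∑ l f + z) (Sum.fold-front r (λ i → f (l ℕ.+ i))) ⟩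
    ∑ l f + (f (l ℕ.+ 0) + ∑ r (λ i → f (l ℕ.+ suc i)))               ≈⟨ ~-+ left (~-+ centre right) ⟩
    sign l · alternating μ l + (0ℚ + sign l · alternating μ r)        ≡⟨ lemma (sign l) (alternating μ l) (alternating μ r) ⟩
    sign l · (alternating μ l + alternating μ r)                      ∎
    where
    open ~-Reasoning 1
    f : ℕ → ℚ
    f d = sign d · ι (μ * d ℕ.+ e) ^ℚ N
    lemma : ∀ s x y → s · x + (0ℚ + s · y) ≡ s · (x + y)
    lemma = solve-∀ ℚ-ring
    p∣ : p ∣ μ * l ℕ.+ e
    p∣ = divides κ μl+e≡κp
    -- The base is divisible by p here, and p > 3 makes the exponent N positive.
    centre : f (l ℕ.+ 0) ~[ 1 ] 0ℚ
    centre = ~-trans (~-reflexive (cong f (ℕ.+-identityʳ l)))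
      (~-trans (~-·ˡ (Int-sign l) (0^N (Int-ι (μ * l ℕ.+ e)) (ι~0 p∣))) (~-reflexive (ℚ.*-zeroʳ (sign l))))
    right : ∑ r (λ i → f (l ℕ.+ suc i)) ~[ 1 ] sign l · alternating μ r
    right = ~-trans (~-∑ r {g = λ i → sign l · (sign (suc i) · ι (μ * suc i) ^ℚ N)} λ i _ →
        ~-trans (~-reflexive (trans (cong (_· ι (μ * (l ℕ.+ suc i) ℕ.+ e) ^ℚ N) (^ℚ-+ (- 1ℚ) l (suc i)))
            (ℚ.*-assoc (sign l) (sign (suc i)) (ι (μ * (l ℕ.+ suc i) ℕ.+ e) ^ℚ N))))
          (~-·ˡ (Int-sign l) (~-·ˡ (Int-sign (suc i)) (~-^ N (Int-ι _) (Int-ι _) (shift i)))))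
      (~-reflexive (∑-scale r (sign l) (λ i → sign (suc i) · ι (μ * suc i) ^ℚ N)))
      where
      distrib : ∀ μ l i e → μ * (l ℕ.+ i) ℕ.+ e ≡ (μ * l ℕ.+ e) ℕ.+ μ * i
      distrib = ℕRing.solve-∀
      shift : ∀ i → ι (μ * (l ℕ.+ suc i) ℕ.+ e) ~[ 1 ] ι (μ * suc i)
      shift i = ~-trans (~-reflexive (trans (cong ι (distrib μ l (suc i) e)) (ι-+ (μ * l ℕ.+ e) (μ * suc i))))
        (~-trans (~-+ (ι~0 p∣) (~-refl {x = ι (μ * suc i)})) (~-reflexive (ℚ.+-identityˡ (ι (μ * suc i)))))
    -- At l - j the base is -μ j modulo p. As N is even, its power is that of μ j, and the signs of
    -- l - j and l + j agree.
    left : ∑ l f ~[ 1 ] sign l · alternating μ l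
    left = ~-trans (∑-flip~ l {g = λ j → sign l · (sign j · ι (μ * j) ^ℚ N)} λ i j _ i+j≡l →
        ~-trans (~-·ˡ (Int-sign i) (~-^ N (Int-ι _) (Int-neg (Int-ι (μ * j))) (shift i j i+j≡l)))
          (~-reflexive (trans (cong (sign i ·_) (trans (neg-^ℚ (ι (μ * j)) N) (trans (cong (_· ι (μ * j) ^ℚ N) sign-N) (ℚ.*-identityˡ (ι (μ * j) ^ℚ N)))))
            (trans (cong (_· ι (μ * j) ^ℚ N) (sign-shift i j i+j≡l)) (ℚ.*-assoc (sign l) (sign j) (ι (μ * j) ^ℚ N))))))
      (~-reflexive (∑-scale l (sign l) (λ i → sign (suc i) · ι (μ * suc i) ^ℚ N)))
      where
      distrib : ∀ μ i j e → (μ * i ℕ.+ e) ℕ.+ μ * j ≡ μ * (i ℕ.+ j) ℕ.+ e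
      distrib = ℕRing.solve-∀
      shift : ∀ i j → i ℕ.+ j ≡ l → ι (μ * i ℕ.+ e) ~[ 1 ] - ι (μ * j)
      shift i j i+j≡l = ~-trans (~-reflexive (ι-difference (trans (distrib μ i j e) (cong (λ n → μ * n ℕ.+ e) i+j≡l))))
        (~-trans (~-- (ι~0 p∣) (~-refl {x = ι (μ * j)})) (~-reflexive (ℚ.+-identityˡ (- ι (μ * j)))))
      sign-shift : ∀ i j → i ℕ.+ j ≡ l → sign i ≡ sign l · sign j
      sign-shift i j refl = trans (trans (sym (ℚ.*-identityʳ (sign i))) (cong (sign i ·_) (sym (sign² j))))
        (trans (sym (ℚ.*-assoc (sign i) (sign j) (sign j))) (cong (_· sign j) (sym (^ℚ-+ (- 1ℚ) i j))))

  alternating~ : ∀ {μ n e o} → ¬ p ∣ μ → n ≤ 2 * M → Halves n e o →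
    alternating μ n ~[ 1 ] rec² μ · (½ · H² e - H² n)
  alternating~ {μ} {n} p∤μ n≤2M hs = ~-trans (~-∑ n {g = λ i → rec² μ · (sign (suc i) · rec² (suc i))} λ i i<n →
      ~-trans (~-·ˡ (Int-sign (suc i)) (ι^N (∤-* p∤μ (∤-suc (ℕ.≤-trans i<n n≤2M)))))
        (~-reflexive (trans (cong (λ z → sign (suc i) · (z · z)) (rec-* μ (suc i))) (lemma (sign (suc i)) (rec μ) (rec (suc i))))))
    (~-reflexive (trans (∑-scale n (rec² μ) (λ i → sign (suc i) · rec² (suc i))) (cong (rec² μ ·_) (alternating-rec² hs))))
    where
    lemma : ∀ s x y → s · ((x · y) · (x · y)) ≡ (x · x) · (s · (y · y))
    lemma = solve-∀ ℚ-ring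

  Int-B : ∀ {c} → Int c → ∀ n {s} → (∀ m → Int (s m)) → Int (B c s n)
  Int-B ic zero    is = is 0
  Int-B ic (suc n) is = Int-B ic n λ m → Int-+ (is (suc m)) (Int-· ic (is m))

  B-cong~ : ∀ {c} → Int c → ∀ n {s t} → (∀ m → s m ~[ 1 ] t m) → B c s n ~[ 1 ] B c t n
  B-cong~ ic zero    eq = eq 0
  B-cong~ ic (suc n) eq = B-cong~ ic n λ m → ~-+ (eq (suc m)) (~-·ˡ ic (eq m))

  -- `B c s n` is a polynomial in c with p-integral coefficients; this is the source of the
  -- p-periodicity.
  B~ : ∀ {c c'} → Int c → Int c' → c ~[ 1 ] c' → ∀ n {s} → (∀ m → Int (s m)) → B c s n ~[ 1 ] B c' s n
  B~ ic ic' c~c' zero        is = ~-refl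
  B~ ic ic' c~c' (suc n) {s} is = ~-trans
    (B~ ic ic' c~c' n λ m → Int-+ (is (suc m)) (Int-· ic (is m)))
    (B-cong~ ic' n λ m → ~-+ (~-refl {x = s (suc m)}) (~-·ʳ (is m) c~c'))

  sign-p : sign p ≡ - 1ℚ
  sign-p = trans (cong sign p≡) (sign-suc-2* M)

  -- Since p is odd, an alternating telescoping sum over a full period leaves twice the initial value.
  period : ∀ μ c → ∑ p (λ d → sign d · (B (ι (μ * suc d)) (ŝ c) N + B (ι (μ * d)) (ŝ c) N)) ~[ 1 ] 2ℚ · ŝ c N
  period μ c = begin
    ∑ p (λ d → sign d · (G (suc d) + G d))     ≡⟨ telescope p G ⟩
    G 0 - sign p · G p                         ≡⟨ cong (λ z → G 0 - z · G p) sign-p ⟩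
    G 0 - (- 1ℚ) · G p                         ≈⟨ ~-- (at-multiple 0 (p ℕ.∣0)) (~-·ˡ (Int-neg Int-1) (at-multiple p ℕ.∣-refl)) ⟩
    ŝ c N - (- 1ℚ) · ŝ c N                     ≡⟨ lemma (ŝ c N) ⟩
    2ℚ · ŝ c N                                 ∎
    where
    open ~-Reasoning 1
    G : ℕ → ℚ
    G d = B (ι (μ * d)) (ŝ c) N
    lemma : ∀ x → x - (- 1ℚ) · x ≡ 2ℚ · x
    lemma = solve-∀ ℚ-ring
    at-multiple : ∀ d → p ∣ d → G d ~[ 1 ] ŝ c N
    at-multiple d p∣d = ~-trans (B~ (Int-ι (μ * d)) Int-0 (ι~0 (ℕ.∣n⇒∣m*n μ p∣d)) N (λ m → Int-/1 (seqS c m))) (~-reflexive (B-0 (ŝ c) N))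

  -- With step 2 the functional equation reads g(2d + 2) + g(2d) = 2 (2d + 1)^N, and 2 d + 1 = p at
  -- d = M, the centre of the period. So E_N ≡ 2 (-1)^M V, where V ≡ H² e / 8.
  H²-quarter : ∀ {e o} → Halves M e o → H² e ~[ 1 ] 4ℚ · (sign M · ŝ (ℤ.- + 1) N)
  H²-quarter {e} hs = ~-sym (begin
    4ℚ · (sign M · s)                                  ≡⟨ lemma₁ (sign M) s ⟩
    2ℚ · sign M · (2ℚ · s)                             ≈⟨ ~-·ˡ (Int-· (Int-/1 (+ 2)) (Int-sign M)) (~-trans (~-sym (period 2 (ℤ.- + 1))) (~-reflexive functional)) ⟩
    2ℚ · sign M · (2ℚ · A)                             ≈⟨ ~-·ˡ i2s (~-·ˡ (Int-/1 (+ 2)) A~) ⟩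
    2ℚ · sign M · (2ℚ · (sign M · (V + V)))            ≡⟨ lemma₂ (sign M) V ⟩
    (sign M · sign M) · (8ℚ · V)                       ≡⟨ trans (cong (_· (8ℚ · V)) (sign² M)) (ℚ.*-identityˡ (8ℚ · V)) ⟩
    8ℚ · V                                             ≈⟨ ~-·ˡ (Int-/1 (+ 8)) (alternating~ p∤2 (ℕ.m≤m+n M (M ℕ.+ 0)) hs) ⟩
    8ℚ · (rec² 2 · (½ · H² e - H² M))                  ≡⟨ cong (λ z → 8ℚ · (z · z · (½ · H² e - H² M))) (rec≡// 2) ⟩
    8ℚ · (½ · ½ · (½ · H² e - H² M))                   ≡⟨ lemma₃ (H² e) (H² M) ⟩
    H² e - 2ℚ · H² M                                   ≈⟨ ~-- (~-refl {x = H² e}) (~-·ˡ (Int-/1 (+ 2)) H²-M) ⟩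
    H² e - 2ℚ · 0ℚ                                     ≡⟨ lemma₄ (H² e) ⟩
    H² e                                               ∎)
    where
    open ~-Reasoning 1
    8ℚ = + 8 / 1
    s = ŝ (ℤ.- + 1) N
    V = alternating 2 M
    A = ∑ p (λ d → sign d · ι (2 * d ℕ.+ 1) ^ℚ N)
    i2s = Int-· (Int-/1 (+ 2)) (Int-sign M)
    lemma₁ : ∀ σ s → 4ℚ · (σ · s) ≡ 2ℚ · σ · (2ℚ · s)
    lemma₁ = solve-∀ ℚ-ring
    lemma₂ : ∀ σ x → 2ℚ · σ · (2ℚ · (σ · (x + x))) ≡ (σ · σ) · ((+ 8 / 1) · x)
    lemma₂ = solve-∀ ℚ-ring
    lemma₃ : ∀ h m → (+ 8 / 1) · (½ · ½ · (½ · h - m)) ≡ h - 2ℚ · m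
    lemma₃ = solve-∀ ℚ-ring
    lemma₄ : ∀ h → h - 2ℚ · 0ℚ ≡ h
    lemma₄ = solve-∀ ℚ-ring
    A~ : A ~[ 1 ] sign M · (V + V)
    A~ = recentre 2 1 M M 1 (trans (M+1+M M) (sym p≡)) (trans (2M+1 M) (trans (sym p≡) (sym (ℕ.*-identityˡ p))))
      where
      M+1+M : ∀ M → M ℕ.+ suc M ≡ suc (2 * M)
      M+1+M = ℕRing.solve-∀
      2M+1 : ∀ M → 2 * M ℕ.+ 1 ≡ suc (2 * M)
      2M+1 = ℕRing.solve-∀
    functional : ∑ p (λ d → sign d · (B (ι (2 * suc d)) (ŝ (ℤ.- + 1)) N + B (ι (2 * d)) (ŝ (ℤ.- + 1)) N)) ≡ 2ℚ · A
    functional = trans (Sum.fold-cong p λ d _ → trans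
        (cong (sign d ·_) (trans
          (cong₂ (λ x y → B x (ŝ (ℤ.- + 1)) N + B y (ŝ (ℤ.- + 1)) N) (next d) (previous d))
          (E-functional N (ι (2 * d ℕ.+ 1)))))
        (lemma₅ (sign d) (ι (2 * d ℕ.+ 1) ^ℚ N)))
      (∑-scale p 2ℚ (λ d → sign d · ι (2 * d ℕ.+ 1) ^ℚ N))
      where
      lemma₅ : ∀ s x → s · (2ℚ · x) ≡ 2ℚ · (s · x)
      lemma₅ = solve-∀ ℚ-ring
      next : ∀ d → ι (2 * suc d) ≡ 1ℚ + ι (2 * d ℕ.+ 1)
      next d = trans (cong ι (arith d)) (ι-suc (2 * d ℕ.+ 1))
        where
        arith : ∀ d → 2 * suc d ≡ suc (2 * d ℕ.+ 1)
        arith = ℕRing.solve-∀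
      previous : ∀ d → ι (2 * d) ≡ - 1ℚ + ι (2 * d ℕ.+ 1)
      previous d = trans (lemma₆ (ι (2 * d))) (cong (λ z → - 1ℚ + z) (sym (trans (ι-+ (2 * d) 1) (cong (λ z → ι (2 * d) + z) (ι≡/1 1)))))
        where
        lemma₆ : ∀ x → x ≡ - 1ℚ + (x + 1ℚ)
        lemma₆ = solve-∀ ℚ-ring

  -- The Legendre symbol (p/3), read off from the shape of p; it also equals (-1)^n because p is
  -- odd.
  character : ∀ {n} → Third n → ℚ
  character (one _) = 1ℚ
  character (two _) = - 1ℚ

  -- With step 3, g(3d + 3) + g(3d) = (3d + 1)^N + (3d + 2)^N. One of the two bases is divisible by
  -- p at d = n, the other at d = 2 M - n; recentred there, both sums become χ V, so U_N ≡ χ V.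
  H²-third : ∀ {n} (t : Third n) {e o} → Halves n e o → n ℕ.+ o ≡ M → H² n ~[ 1 ] 3ℚ · (character t · ŝ (ℤ.- + 2) N)
  H²-third {n} t {e} hs n+o≡M = ~-sym (~-trans (~-·ˡ (Int-/1 (+ 3)) (~-·ˡ (Int-χ t) s~))
      (~-trans (~-reflexive (lemma₁ (character t) (V t)))
        (~-trans (~-reflexive (trans (cong (_· (3ℚ · V t)) (χ² t)) (ℚ.*-identityˡ (3ℚ · V t))))
          (~-trans (~-·ˡ (Int-/1 (+ 3)) (V~ t)) (~-reflexive (lemma₂ (H² n)))))))
    where
    s = ŝ (ℤ.- + 2) N
    A : ℕ → ℚ
    A e = ∑ p (λ d → sign d · ι (3 * d ℕ.+ e) ^ℚ N)
    lemma₁ : ∀ χ v → 3ℚ · (χ · (χ · v)) ≡ (χ · χ) · (3ℚ · v)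
    lemma₁ = solve-∀ ℚ-ring
    lemma₂ : ∀ h → 3ℚ · (⅓ · h) ≡ h
    lemma₂ = solve-∀ ℚ-ring
    Int-χ : (t : Third n) → Int (character t)
    Int-χ (one _) = Int-1
    Int-χ (two _) = Int-neg Int-1
    χ² : (t : Third n) → character t · character t ≡ 1ℚ
    χ² (one _) = refl
    χ² (two _) = refl
    rest : Third n → ℕ
    rest (one _) = 2 * n
    rest (two _) = suc (2 * n)
    V : Third n → ℚ
    V t = alternating 3 n + alternating 3 (rest t)
    functional : ∑ p (λ d → sign d · (B (ι (3 * suc d)) (ŝ (ℤ.- + 2)) N + B (ι (3 * d)) (ŝ (ℤ.- + 2)) N)) ≡ A 1 + A 2
    functional = trans (Sum.fold-cong p λ d _ → trans
        (cong (sign d ·_) (trans (cong (λ x → B x (ŝ (ℤ.- + 2)) N + B (ι (3 * d)) (ŝ (ℤ.- + 2)) N) (next d))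
          (trans (U-functional₃ N (ι (3 * d))) (cong₂ (λ x y → x ^ℚ N + y ^ℚ N) (next₁ d) (next₂ d)))))
        (ℚ.*-distribˡ-+ (sign d) (ι (3 * d ℕ.+ 1) ^ℚ N) (ι (3 * d ℕ.+ 2) ^ℚ N)))
      (Sum.fold-∙ p (λ d → sign d · ι (3 * d ℕ.+ 1) ^ℚ N) (λ d → sign d · ι (3 * d ℕ.+ 2) ^ℚ N))
      where
      next : ∀ d → ι (3 * suc d) ≡ 3ℚ + ι (3 * d)
      next d = trans (cong ι (ℕ.*-suc 3 d)) (trans (ι-+ 3 (3 * d)) (cong (_+ ι (3 * d)) (ι≡/1 3)))
      next₁ : ∀ d → 1ℚ + ι (3 * d) ≡ ι (3 * d ℕ.+ 1)
      next₁ d = trans (sym (ι-suc (3 * d))) (cong ι (ℕ.+-comm 1 (3 * d)))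
      next₂ : ∀ d → 2ℚ + ι (3 * d) ≡ ι (3 * d ℕ.+ 2)
      next₂ d = trans (cong (_+ ι (3 * d)) (sym (ι≡/1 2))) (trans (sym (ι-+ 2 (3 * d))) (cong ι (ℕ.+-comm 2 (3 * d))))
    2M≡ : (t : Third n) → n ℕ.+ rest t ≡ 2 * M
    2M≡ (one eq) = ℕ.suc-injective (trans (lemma n) (trans (sym eq) p≡))
      where
      lemma : ∀ n → suc (n ℕ.+ 2 * n) ≡ suc (3 * n)
      lemma = ℕRing.solve-∀
    2M≡ (two eq) = ℕ.suc-injective (trans (lemma n) (trans (sym eq) p≡))
      where
      lemma : ∀ n → suc (n ℕ.+ suc (2 * n)) ≡ suc (suc (3 * n))
      lemma = ℕRing.solve-∀
    -- The parity of n is that of `rest t`, since they add up to 2 M.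
    sign-n : (t : Third n) → sign n ≡ character t
    sign-n (one eq) = begin
      sign n                        ≡⟨ sym (ℚ.*-identityʳ (sign n)) ⟩
      sign n · 1ℚ                   ≡⟨ cong (sign n ·_) (sym (sign-2* n)) ⟩
      sign n · sign (2 * n)         ≡⟨ sym (^ℚ-+ (- 1ℚ) n (2 * n)) ⟩
      sign (n ℕ.+ 2 * n)            ≡⟨ cong sign (2M≡ (one eq)) ⟩
      sign (2 * M)                  ≡⟨ sign-2* M ⟩
      1ℚ                            ∎
      where open ≡-Reasoning
    sign-n (two eq) = begin
      sign n                        ≡⟨ lemma (sign n) ⟩
      (sign n · (- 1ℚ)) · (- 1ℚ)    ≡⟨ cong (λ z → (sign n · z) · (- 1ℚ)) (sym (sign-suc-2* n)) ⟩
      (sign n · sign (suc (2 * n))) · (- 1ℚ) ≡⟨ cong (_· (- 1ℚ)) (sym (^ℚ-+ (- 1ℚ) n (suc (2 * n)))) ⟩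
      sign (n ℕ.+ suc (2 * n)) · (- 1ℚ) ≡⟨ cong (λ k → sign k · (- 1ℚ)) (2M≡ (two eq)) ⟩
      sign (2 * M) · (- 1ℚ)         ≡⟨ cong (_· (- 1ℚ)) (sign-2* M) ⟩
      - 1ℚ                          ∎
      where
      open ≡-Reasoning
      lemma : ∀ x → x ≡ (x · (- 1ℚ)) · (- 1ℚ)
      lemma = solve-∀ ℚ-ring
    sign-rest : (t : Third n) → sign (rest t) ≡ character t
    sign-rest (one _) = sign-2* n
    sign-rest (two _) = sign-suc-2* n
    n+1+rest : (t : Third n) → n ℕ.+ suc (rest t) ≡ p
    n+1+rest t = trans (ℕ.+-suc n (rest t)) (trans (cong suc (2M≡ t)) (sym p≡))
    rest+1+n : (t : Third n) → rest t ℕ.+ suc n ≡ p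
    rest+1+n t = trans (ℕ.+-suc (rest t) n) (trans (cong suc (ℕ.+-comm (rest t) n)) (trans (cong suc (2M≡ t)) (sym p≡)))
    at-n : ∀ e κ (t : Third n) → 3 * n ℕ.+ e ≡ κ * p → A e ~[ 1 ] character t · V t
    at-n e κ t eq = ~-trans (recentre 3 e n (rest t) κ (n+1+rest t) eq) (~-reflexive (cong (_· V t) (sign-n t)))
    at-rest : ∀ e κ (t : Third n) → 3 * rest t ℕ.+ e ≡ κ * p → A e ~[ 1 ] character t · V t
    at-rest e κ t eq = ~-trans (recentre 3 e (rest t) n κ (rest+1+n t) eq)
      (~-reflexive (cong₂ _·_ (sign-rest t) (ℚ.+-comm (alternating 3 (rest t)) (alternating 3 n))))
    A₁~ : (t : Third n) → A 1 ~[ 1 ] character t · V t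
    A₁~ (one eq) = at-n 1 1 (one eq) (trans (arith n) (cong (1 *_) (sym eq)))
      where
      arith : ∀ n → 3 * n ℕ.+ 1 ≡ 1 * suc (3 * n)
      arith = ℕRing.solve-∀
    A₁~ (two eq) = at-rest 1 2 (two eq) (trans (arith n) (cong (2 *_) (sym eq)))
      where
      arith : ∀ n → 3 * suc (2 * n) ℕ.+ 1 ≡ 2 * suc (suc (3 * n))
      arith = ℕRing.solve-∀
    A₂~ : (t : Third n) → A 2 ~[ 1 ] character t · V t
    A₂~ (one eq) = at-rest 2 2 (one eq) (trans (arith n) (cong (2 *_) (sym eq)))
      where
      arith : ∀ n → 3 * (2 * n) ℕ.+ 2 ≡ 2 * suc (3 * n)
      arith = ℕRing.solve-∀
    A₂~ (two eq) = at-n 2 1 (two eq) (trans (arith n) (cong (1 *_) (sym eq)))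
      where
      arith : ∀ n → 3 * n ℕ.+ 2 ≡ 1 * suc (suc (3 * n))
      arith = ℕRing.solve-∀
    s~ : s ~[ 1 ] character t · V t
    s~ = ~-cancel-unit {u = 2ℚ} {v = ½} {x = s} {y = character t · V t} Int-½ refl
      (~-trans (~-sym (period 3 (ℤ.- + 2))) (~-trans (~-reflexive functional) (~-trans (~-+ (A₁~ t) (A₂~ t)) (~-reflexive (lemma (character t · V t))))))
      where
      lemma : ∀ x → x + x ≡ 2ℚ · x
      lemma = solve-∀ ℚ-ring
    halves-rest : (t : Third n) → Σ[ o ∈ ℕ ] Halves (rest t) n o
    halves-rest (one _) = n , even n
    halves-rest (two _) = suc n , odd n
    -- The coefficient is (5/2 - 1 + 1/2 + 1)/9 = 1/3, using H² e ≡ 5 H² n and H² (2 M - n) ≡ - H²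
    -- n.
    V~ : (t : Third n) → V t ~[ 1 ] ⅓ · H² n
    V~ t = ~-trans (~-+ (alternating~ p∤3 n≤2M hs) (alternating~ p∤3 rest≤2M (proj₂ (halves-rest t))))
      (~-trans (~-reflexive (cong (λ z → z · z · (½ · H² e - H² n) + z · z · (½ · H² n - H² (rest t))) (rec≡// 3)))
        (~-combine (lemma (H² e) (H² n) (H² (rest t)))
          (~-·ˡ (Int-· (Int-· Int-⅓ Int-⅓) Int-½) (H²-sixth t hs n+o≡M))
          (~-·ˡ (Int-neg (Int-· Int-⅓ Int-⅓)) (H²-complement n (rest t) (2M≡ t)))))
      where
      n≤2M : n ≤ 2 * M
      n≤2M = subst (n ≤_) (2M≡ t) (ℕ.m≤m+n n (rest t))
      rest≤2M : rest t ≤ 2 * M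
      rest≤2M = subst (rest t ≤_) (2M≡ t) (ℕ.m≤n+m (rest t) n)
      lemma : ∀ x y z → (⅓ · ⅓ · (½ · x - y) + ⅓ · ⅓ · (½ · y - z)) - ⅓ · y
        ≡ ((⅓ · ⅓ · ½) · x - (⅓ · ⅓ · ½) · ((+ 5 / 1) · y)) + ((- (⅓ · ⅓)) · z - (- (⅓ · ⅓)) · (- y))
      lemma = solve-∀ ℚ-ring

-- The binomial products as values of w

C-trinomial : ∀ a b → ((a ℕ.+ b) C a) * (a ! * b !) ≡ (a ℕ.+ b) !
C-trinomial a b = trans (cong (λ n → ((a ℕ.+ b) C a) * (a ! * n !)) (sym (ℕ.m+n∸m≡n a b))) (C-factorial (ℕ.m≤m+n a b))

-- These are (3k)!/k!³, (4k)!/(k!² (2k)!) and (6k)!/(k! (2k)! (3k)!); the index is the m of the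
-- argument -1/m.
c₃ c₄ c₆ : ℕ → ℕ
c₃ k = ((2 * k) C k) * ((3 * k) C k)
c₄ k = ((2 * k) C k) * ((4 * k) C (2 * k))
c₆ k = ((3 * k) C k) * ((6 * k) C (3 * k))

C-2k : ∀ k → ((2 * k) C k) * (k ! * k !) ≡ (2 * k) !
C-2k k = subst (λ n → (n C k) * (k ! * k !) ≡ n !) (cong (k ℕ.+_) (sym (ℕ.+-identityʳ k))) (C-trinomial k k)

c₃-factorial : ∀ k → c₃ k * (k ! * k ! * k !) ≡ (3 * k) !
c₃-factorial k = begin
  ((2 * k) C k) * ((3 * k) C k) * (k ! * k ! * k !)       ≡⟨ lemma ((2 * k) C k) ((3 * k) C k) (k !) ⟩
  ((3 * k) C k) * (k ! * (((2 * k) C k) * (k ! * k !)))   ≡⟨ cong (λ z → ((3 * k) C k) * (k ! * z)) (C-2k k) ⟩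
  ((3 * k) C k) * (k ! * (2 * k) !)                       ≡⟨ C-trinomial k (2 * k) ⟩
  (3 * k) !                                               ∎
  where
  open ≡-Reasoning
  lemma : ∀ a b f → a * b * (f * f * f) ≡ b * (f * (a * (f * f)))
  lemma = ℕRing.solve-∀

c₄-factorial : ∀ k → c₄ k * (k ! * k ! * (2 * k) !) ≡ (4 * k) !
c₄-factorial k = begin
  ((2 * k) C k) * ((4 * k) C (2 * k)) * (k ! * k ! * (2 * k) !)
    ≡⟨ lemma ((2 * k) C k) ((4 * k) C (2 * k)) (k !) ((2 * k) !) ⟩
  ((4 * k) C (2 * k)) * ((2 * k) ! * (((2 * k) C k) * (k ! * k !)))
    ≡⟨ cong (λ z → ((4 * k) C (2 * k)) * ((2 * k) ! * z)) (C-2k k) ⟩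
  ((4 * k) C (2 * k)) * ((2 * k) ! * (2 * k) !)
    ≡⟨ subst (λ n → (n C (2 * k)) * ((2 * k) ! * (2 * k) !) ≡ n !) (arith k) (C-trinomial (2 * k) (2 * k)) ⟩
  (4 * k) ! ∎
  where
  open ≡-Reasoning
  lemma : ∀ a b f g → a * b * (f * f * g) ≡ b * (g * (a * (f * f)))
  lemma = ℕRing.solve-∀
  arith : ∀ k → 2 * k ℕ.+ 2 * k ≡ 4 * k
  arith = ℕRing.solve-∀

c₆-factorial : ∀ k → c₆ k * (k ! * (2 * k) ! * (3 * k) !) ≡ (6 * k) !
c₆-factorial k = begin
  ((3 * k) C k) * ((6 * k) C (3 * k)) * (k ! * (2 * k) ! * (3 * k) !)
    ≡⟨ lemma ((3 * k) C k) ((6 * k) C (3 * k)) (k !) ((2 * k) !) ((3 * k) !) ⟩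
  ((6 * k) C (3 * k)) * ((3 * k) ! * (((3 * k) C k) * (k ! * (2 * k) !)))
    ≡⟨ cong (λ z → ((6 * k) C (3 * k)) * ((3 * k) ! * z)) (C-trinomial k (2 * k)) ⟩
  ((6 * k) C (3 * k)) * ((3 * k) ! * (3 * k) !)
    ≡⟨ subst (λ n → (n C (3 * k)) * ((3 * k) ! * (3 * k) !) ≡ n !) (arith k) (C-trinomial (3 * k) (3 * k)) ⟩
  (6 * k) ! ∎
  where
  open ≡-Reasoning
  lemma : ∀ a b f g h → a * b * (f * g * h) ≡ b * (h * (a * (f * g)))
  lemma = ℕRing.solve-∀
  arith : ∀ k → 3 * k ℕ.+ 3 * k ≡ 6 * k
  arith = ℕRing.solve-∀

factorial-2* : ∀ k → (2 * suc k) ! ≡ (2 ℕ.+ 2 * k) * ((1 ℕ.+ 2 * k) * (2 * k) !)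
factorial-2* k = cong _! (ℕ.*-suc 2 k)

factorial-3* : ∀ k → (3 * suc k) ! ≡ (3 ℕ.+ 3 * k) * ((2 ℕ.+ 3 * k) * ((1 ℕ.+ 3 * k) * (3 * k) !))
factorial-3* k = cong _! (ℕ.*-suc 3 k)

factorial-4* : ∀ k → (4 * suc k) ! ≡ (4 ℕ.+ 4 * k) * ((3 ℕ.+ 4 * k) * ((2 ℕ.+ 4 * k) * ((1 ℕ.+ 4 * k) * (4 * k) !)))
factorial-4* k = cong _! (ℕ.*-suc 4 k)

factorial-6* : ∀ k → (6 * suc k) ! ≡ (6 ℕ.+ 6 * k) * ((5 ℕ.+ 6 * k) * ((4 ℕ.+ 6 * k) * ((3 ℕ.+ 6 * k) * ((2 ℕ.+ 6 * k) * ((1 ℕ.+ 6 * k) * (6 * k) !)))))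
factorial-6* k = cong _! (ℕ.*-suc 6 k)

NonZero-* : ∀ {m n} → NonZero m → NonZero n → NonZero (m * n)
NonZero-* {m} {n} m≢0 n≢0 = ℕ.m*n≢0 m n {{m≢0}} {{n≢0}}

-- This and the next two recurrences are quotients of consecutive factorial formulas; the constants
-- 3, 4, 12 are the l for which l m² is 27, 64, 432.
c₃-suc : ∀ k → c₃ (suc k) * (suc k * suc k) ≡ 3 * (suc (3 * k) * (3 * k ℕ.+ 2)) * c₃ k
c₃-suc k = ℕ.*-cancelʳ-≡ _ _ (suc k * (f * f * f)) {{NonZero-* {suc k} {f * f * f} _ (NonZero-* {f * f} {f} (NonZero-* {f} {f} (k ℕ.!≢0) (k ℕ.!≢0)) (k ℕ.!≢0))}} (begin
  c₃ (suc k) * (suc k * suc k) * (suc k * (f * f * f))                 ≡⟨ lemma₁ (c₃ (suc k)) (suc k) f ⟩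
  c₃ (suc k) * (suc k * f * (suc k * f) * (suc k * f))                 ≡⟨ trans (c₃-factorial (suc k)) (factorial-3* k) ⟩
  (3 ℕ.+ 3 * k) * ((2 ℕ.+ 3 * k) * ((1 ℕ.+ 3 * k) * (3 * k) !))        ≡⟨ cong (λ z → (3 ℕ.+ 3 * k) * ((2 ℕ.+ 3 * k) * ((1 ℕ.+ 3 * k) * z))) (sym (c₃-factorial k)) ⟩
  (3 ℕ.+ 3 * k) * ((2 ℕ.+ 3 * k) * ((1 ℕ.+ 3 * k) * (c₃ k * (f * f * f)))) ≡⟨ lemma₂ (c₃ k) k (f * f * f) ⟩
  3 * (suc (3 * k) * (3 * k ℕ.+ 2)) * c₃ k * (suc k * (f * f * f))     ∎)
  where
  open ≡-Reasoning
  f = k !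
  lemma₁ : ∀ c m f → c * (m * m) * (m * (f * f * f)) ≡ c * (m * f * (m * f) * (m * f))
  lemma₁ = ℕRing.solve-∀
  lemma₂ : ∀ c k F → (3 ℕ.+ 3 * k) * ((2 ℕ.+ 3 * k) * ((1 ℕ.+ 3 * k) * (c * F))) ≡ 3 * (suc (3 * k) * (3 * k ℕ.+ 2)) * c * (suc k * F)
  lemma₂ = ℕRing.solve-∀

c₄-suc : ∀ k → c₄ (suc k) * (suc k * suc k) ≡ 4 * (suc (4 * k) * (4 * k ℕ.+ 3)) * c₄ k
c₄-suc k = ℕ.*-cancelʳ-≡ _ _ (u * (f * f * g)) {{NonZero-* {u} {f * f * g} _ (NonZero-* {f * f} {g} (NonZero-* {f} {f} (k ℕ.!≢0) (k ℕ.!≢0)) ((2 * k) ℕ.!≢0))}} (begin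
  c₄ (suc k) * (suc k * suc k) * (u * (f * f * g))                     ≡⟨ lemma₁ (c₄ (suc k)) k f g ⟩
  c₄ (suc k) * (suc k * f * (suc k * f) * ((2 ℕ.+ 2 * k) * ((1 ℕ.+ 2 * k) * g))) ≡⟨ cong (λ z → c₄ (suc k) * (suc k * f * (suc k * f) * z)) (sym (factorial-2* k)) ⟩
  c₄ (suc k) * (suc k * f * (suc k * f) * (2 * suc k) !)               ≡⟨ trans (c₄-factorial (suc k)) (factorial-4* k) ⟩
  (4 ℕ.+ 4 * k) * ((3 ℕ.+ 4 * k) * ((2 ℕ.+ 4 * k) * ((1 ℕ.+ 4 * k) * (4 * k) !)))
    ≡⟨ cong (λ z → (4 ℕ.+ 4 * k) * ((3 ℕ.+ 4 * k) * ((2 ℕ.+ 4 * k) * ((1 ℕ.+ 4 * k) * z)))) (sym (c₄-factorial k)) ⟩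
  (4 ℕ.+ 4 * k) * ((3 ℕ.+ 4 * k) * ((2 ℕ.+ 4 * k) * ((1 ℕ.+ 4 * k) * (c₄ k * (f * f * g)))))
    ≡⟨ lemma₂ (c₄ k) k (f * f * g) ⟩
  4 * (suc (4 * k) * (4 * k ℕ.+ 3)) * c₄ k * (u * (f * f * g))         ∎)
  where
  open ≡-Reasoning
  f = k !
  g = (2 * k) !
  u = (2 ℕ.+ 2 * k) * (1 ℕ.+ 2 * k)
  lemma₁ : ∀ c k f g → c * (suc k * suc k) * ((2 ℕ.+ 2 * k) * (1 ℕ.+ 2 * k) * (f * f * g)) ≡ c * (suc k * f * (suc k * f) * ((2 ℕ.+ 2 * k) * ((1 ℕ.+ 2 * k) * g)))
  lemma₁ = ℕRing.solve-∀
  lemma₂ : ∀ c k F → (4 ℕ.+ 4 * k) * ((3 ℕ.+ 4 * k) * ((2 ℕ.+ 4 * k) * ((1 ℕ.+ 4 * k) * (c * F)))) ≡ 4 * (suc (4 * k) * (4 * k ℕ.+ 3)) * c * ((2 ℕ.+ 2 * k) * (1 ℕ.+ 2 * k) * F)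
  lemma₂ = ℕRing.solve-∀

c₆-suc : ∀ k → c₆ (suc k) * (suc k * suc k) ≡ 12 * (suc (6 * k) * (6 * k ℕ.+ 5)) * c₆ k
c₆-suc k = ℕ.*-cancelʳ-≡ _ _ (u * (f * g * h)) {{NonZero-* {u} {f * g * h} _ (NonZero-* {f * g} {h} (NonZero-* {f} {g} (k ℕ.!≢0) ((2 * k) ℕ.!≢0)) ((3 * k) ℕ.!≢0))}} (begin
  c₆ (suc k) * (suc k * suc k) * (u * (f * g * h))                     ≡⟨ lemma₁ (c₆ (suc k)) k f g h ⟩
  c₆ (suc k) * (suc k * f * ((2 ℕ.+ 2 * k) * ((1 ℕ.+ 2 * k) * g)) * ((3 ℕ.+ 3 * k) * ((2 ℕ.+ 3 * k) * ((1 ℕ.+ 3 * k) * h))))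
    ≡⟨ cong₂ (λ y z → c₆ (suc k) * (suc k * f * y * z)) (sym (factorial-2* k)) (sym (factorial-3* k)) ⟩
  c₆ (suc k) * (suc k * f * (2 * suc k) ! * (3 * suc k) !)             ≡⟨ trans (c₆-factorial (suc k)) (factorial-6* k) ⟩
  (6 ℕ.+ 6 * k) * ((5 ℕ.+ 6 * k) * ((4 ℕ.+ 6 * k) * ((3 ℕ.+ 6 * k) * ((2 ℕ.+ 6 * k) * ((1 ℕ.+ 6 * k) * (6 * k) !)))))
    ≡⟨ cong (λ z → (6 ℕ.+ 6 * k) * ((5 ℕ.+ 6 * k) * ((4 ℕ.+ 6 * k) * ((3 ℕ.+ 6 * k) * ((2 ℕ.+ 6 * k) * ((1 ℕ.+ 6 * k) * z)))))) (sym (c₆-factorial k)) ⟩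
  (6 ℕ.+ 6 * k) * ((5 ℕ.+ 6 * k) * ((4 ℕ.+ 6 * k) * ((3 ℕ.+ 6 * k) * ((2 ℕ.+ 6 * k) * ((1 ℕ.+ 6 * k) * (c₆ k * (f * g * h)))))))
    ≡⟨ lemma₂ (c₆ k) k (f * g * h) ⟩
  12 * (suc (6 * k) * (6 * k ℕ.+ 5)) * c₆ k * (u * (f * g * h))        ∎)
  where
  open ≡-Reasoning
  f = k !
  g = (2 * k) !
  h = (3 * k) !
  -- The 2 is what remains of 2 k + 2 = 2 (k + 1) once k + 1 has gone into the square on the left.
  u = 2 * (1 ℕ.+ 2 * k) * ((3 ℕ.+ 3 * k) * ((2 ℕ.+ 3 * k) * (1 ℕ.+ 3 * k)))
  lemma₁ : ∀ c k f g h → c * (suc k * suc k) * (2 * (1 ℕ.+ 2 * k) * ((3 ℕ.+ 3 * k) * ((2 ℕ.+ 3 * k) * (1 ℕ.+ 3 * k))) * (f * g * h))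
    ≡ c * (suc k * f * ((2 ℕ.+ 2 * k) * ((1 ℕ.+ 2 * k) * g)) * ((3 ℕ.+ 3 * k) * ((2 ℕ.+ 3 * k) * ((1 ℕ.+ 3 * k) * h))))
  lemma₁ = ℕRing.solve-∀
  lemma₂ : ∀ c k F → (6 ℕ.+ 6 * k) * ((5 ℕ.+ 6 * k) * ((4 ℕ.+ 6 * k) * ((3 ℕ.+ 6 * k) * ((2 ℕ.+ 6 * k) * ((1 ℕ.+ 6 * k) * (c * F))))))
    ≡ 12 * (suc (6 * k) * (6 * k ℕ.+ 5)) * c * (2 * (1 ℕ.+ 2 * k) * ((3 ℕ.+ 3 * k) * ((2 ℕ.+ 3 * k) * (1 ℕ.+ 3 * k))) * F)
  lemma₂ = ℕRing.solve-∀

-- c k / D^k = binom(a, k) binom(-1-a, k) for a = -1/m, m = m' + 1, with D = l m².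
module _ (m' l : ℕ) .{{_ : NonZero l}} (c : ℕ → ℕ) (c-0 : c 0 ≡ 1)
  (c-suc : ∀ k → c (suc k) * (suc k * suc k) ≡ l * (suc (suc m' * k) * (suc m' * k ℕ.+ m')) * c k) where
  private
    m D : ℕ
    m = suc m'
    D = l * (m * m)
    r : ℚ
    r = rec m

  -- For a = -1/m the linear factors m k + 1 and m k + m - 1, divided by m, are k - a and k + 1 + a;
  -- so the recurrence is that of w.
  c-w : ∀ k → ι (c k) · rec (D ^ k) ≡ w (- r) k
  c-w zero    = trans (cong₂ (λ x y → x · y) (trans (cong ι c-0) (ι≡/1 1)) (rec≡// 1)) (ℚ.*-identityˡ 1ℚ)
  c-w (suc k) = ι-cancel (suc k) (ι-cancel (suc k) (begin
    K · (K · (ι (c (suc k)) · rec (D * D ^ k)))                ≡⟨ cong (λ z → K · (K · (ι (c (suc k)) · z))) rec-D ⟩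
    K · (K · (ι (c (suc k)) · (rec l · (r · r) · rec (D ^ k)))) ≡⟨ lemma₁ K (ι (c (suc k))) (rec l) r (rec (D ^ k)) ⟩
    ι (c (suc k)) · (K · K) · (rec l · (r · r) · rec (D ^ k))  ≡⟨ cong (_· (rec l · (r · r) · rec (D ^ k))) recurrence ⟩
    ι l · (u · u') · ι (c k) · (rec l · (r · r) · rec (D ^ k)) ≡⟨ lemma₂ (ι l) u u' (ι (c k)) (rec l) r (rec (D ^ k)) ⟩
    (ι l · rec l) · ((u · r) · (u' · r)) · (ι (c k) · rec (D ^ k)) ≡⟨ cong₂ (λ x y → x · ((u · r) · (u' · r)) · y) (ι·rec l) (c-w k) ⟩
    1ℚ · ((u · r) · (u' · r)) · w (- r) k                      ≡⟨ cong₂ (λ x y → 1ℚ · (x · y) · w (- r) k) u·r u'·r ⟩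
    1ℚ · ((ι k - (- r)) · (K + (- r))) · w (- r) k             ≡⟨ lemma₃ (ι k - (- r)) (K + (- r)) (w (- r) k) ⟩
    1ℚ · (1ℚ · (w (- r) k · ((ι k - (- r)) · (K + (- r)) · (1ℚ · 1ℚ))))
      ≡⟨ cong (λ z → 1ℚ · (1ℚ · (w (- r) k · ((ι k - (- r)) · (K + (- r)) · (z · z))))) (sym (ι·rec (suc k))) ⟩
    1ℚ · (1ℚ · (w (- r) k · ((ι k - (- r)) · (K + (- r)) · ((K · K⁻¹) · (K · K⁻¹)))))
      ≡⟨ lemma₄ K K⁻¹ (w (- r) k) ((ι k - (- r)) · (K + (- r))) ⟩
    K · (K · w (- r) (suc k))                                  ∎))
    where
    open ≡-Reasoning
    K K⁻¹ u u' : ℚ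
    K = ι (suc k)
    K⁻¹ = rec (suc k)
    u = ι (suc (m * k))
    u' = ι (m * k ℕ.+ m')
    rec-D : rec (D * D ^ k) ≡ rec l · (r · r) · rec (D ^ k)
    rec-D = trans (rec-* D (D ^ k)) (cong (_· rec (D ^ k)) (trans (rec-* l (m * m)) (cong (rec l ·_) (rec-* m m))))
    recurrence : ι (c (suc k)) · (K · K) ≡ ι l · (u · u') · ι (c k)
    recurrence = trans (sym (trans (ι-* (c (suc k)) (suc k * suc k)) (cong (ι (c (suc k)) ·_) (ι-* (suc k) (suc k)))))
      (trans (cong ι (c-suc k)) (trans (ι-* (l * (suc (m * k) * (m * k ℕ.+ m'))) (c k))
        (cong (_· ι (c k)) (trans (ι-* l (suc (m * k) * (m * k ℕ.+ m'))) (cong (ι l ·_) (ι-* (suc (m * k)) (m * k ℕ.+ m')))))))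
    u·r : u · r ≡ ι k - (- r)
    u·r = trans (cong (_· r) (trans (ι-suc (m * k)) (cong (λ z → 1ℚ + z) (ι-* m k))))
      (trans (lemma₅ (ι m) (ι k) r) (trans (cong (λ z → z · ι k + r) (ι·rec m)) (lemma₆ (ι k) r)))
      where
      lemma₅ : ∀ m k r → (1ℚ + m · k) · r ≡ (m · r) · k + r
      lemma₅ = solve-∀ ℚ-ring
      lemma₆ : ∀ k r → 1ℚ · k + r ≡ k - (- r)
      lemma₆ = solve-∀ ℚ-ring
    u'·r : u' · r ≡ K + (- r)
    u'·r = trans (cong (_· r) (trans (ι-+ (m * k) m') (cong₂ _+_ (ι-* m k) ι-m')))
      (trans (lemma₇ (ι m) (ι k) r) (trans (cong (λ z → z · (1ℚ + ι k) + (- r)) (ι·rec m))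
        (trans (lemma₈ (ι k) r) (cong (_+ (- r)) (sym (ι-suc k))))))
      where
      ι-m' : ι m' ≡ ι m - 1ℚ
      ι-m' = trans (lemma₉ (ι m')) (cong (_- 1ℚ) (sym (ι-suc m')))
        where
        lemma₉ : ∀ x → x ≡ (1ℚ + x) - 1ℚ
        lemma₉ = solve-∀ ℚ-ring
      lemma₇ : ∀ m k r → (m · k + (m - 1ℚ)) · r ≡ (m · r) · (1ℚ + k) + (- r)
      lemma₇ = solve-∀ ℚ-ring
      lemma₈ : ∀ k r → 1ℚ · (1ℚ + k) + (- r) ≡ (1ℚ + k) + (- r)
      lemma₈ = solve-∀ ℚ-ring
    lemma₁ : ∀ K c l r d → K · (K · (c · (l · (r · r) · d))) ≡ c · (K · K) · (l · (r · r) · d)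
    lemma₁ = solve-∀ ℚ-ring
    lemma₂ : ∀ l u u' c l' r d → l · (u · u') · c · (l' · (r · r) · d) ≡ (l · l') · ((u · r) · (u' · r)) · (c · d)
    lemma₂ = solve-∀ ℚ-ring
    lemma₃ : ∀ x y z → 1ℚ · (x · y) · z ≡ 1ℚ · (1ℚ · (z · (x · y · (1ℚ · 1ℚ))))
    lemma₃ = solve-∀ ℚ-ring
    lemma₄ : ∀ K K' z x → 1ℚ · (1ℚ · (z · (x · ((K · K') · (K · K'))))) ≡ K · (K · (z · (x · (K' · K'))))
    lemma₄ = solve-∀ ℚ-ring

  Σ-S : ∀ n → Σ[1… n ] (λ k → c k // (k * D ^ k)) ≡ S n (- r)
  Σ-S n = begin
    foldr _+_ 0ℚ (map (λ k → term (suc k)) (upTo n))   ≡⟨ cong (foldr _+_ 0ℚ) (List.map-upTo (λ k → term (suc k)) n) ⟩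
    foldr _+_ 0ℚ (applyUpTo (λ k → term (suc k)) n)    ≡⟨ ∑-applyUpTo n (λ k → term (suc k)) ⟩
    ∑ n (λ k → term (suc k))                           ≡⟨ Sum.fold-cong n (λ k _ → term-w (suc k)) ⟩
    S n (- r)                                          ∎
    where
    open ≡-Reasoning
    term : ℕ → ℚ
    term k = c k // (k * D ^ k)
    lemma : ∀ x y z → x · (y · z) ≡ x · z · y
    lemma = solve-∀ ℚ-ring
    term-w : ∀ k → term k ≡ w (- r) k · rec k
    term-w k = trans (//-rec (c k) (k * D ^ k)) (trans (cong (ι (c k) ·_) (rec-* k (D ^ k)))
      (trans (lemma (ι (c k)) (rec k) (rec (D ^ k))) (cong (_· rec k) (c-w k))))

halves-sum : ∀ {n e o} → Halves n e o → e ℕ.+ o ≡ n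
halves-sum (even n) = lemma n
  where
  lemma : ∀ n → n ℕ.+ n ≡ 2 * n
  lemma = ℕRing.solve-∀
halves-sum (odd n) = lemma n
  where
  lemma : ∀ n → n ℕ.+ suc n ≡ suc (2 * n)
  lemma = ℕRing.solve-∀

sgn-sign : ∀ n → sgn n / 1 ≡ sign n
sgn-sign n with halves n
... | _ , hs = by-parity hs
  where
  sgn-even : ∀ m → m ℕ.% 2 ≡ 0 → sgn m ≡ + 1
  sgn-even m eq with m ℕ.% 2 | eq
  ... | _ | refl = refl
  sgn-odd : ∀ m → m ℕ.% 2 ≡ 1 → sgn m ≡ ℤ.- + 1
  sgn-odd m eq with m ℕ.% 2 | eq
  ... | _ | refl = refl
  by-parity : ∀ {m e o} → Halves m e o → sgn m / 1 ≡ sign m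
  by-parity (even k) = trans (cong (_/ 1) (sgn-even (2 * k) (trans (cong (ℕ._% 2) (ℕ.*-comm 2 k)) (ℕ.m*n%n≡0 k 2)))) (sym (sign-2* k))
  by-parity (odd k)  = trans (cong (_/ 1) (sgn-odd (suc (2 * k)) (trans (cong (λ m → suc m ℕ.% 2) (ℕ.*-comm 2 k)) (ℕ.[m+kn]%n≡m%n 1 k 2)))) (sym (sign-suc-2* k))

-- Evaluation of S(-1/4), S(-1/3) and S(-1/6)

module Congruences (p : ℕ) (p-prime : Prime p) (M : ℕ) (p≡ : p ≡ suc (2 * M)) (3<p : 3 < p) where
  open FractionalHarmonic p p-prime M p≡ 3<p
  open PowerSums p p-prime M p≡ 3<p

  -- For m = m' + 1 ≥ 2: p is 1 or -1 modulo m, and n = [p/m] in both cases.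
  Residue : ℕ → ℕ → Set
  Residue m' n = p ≡ suc (suc m' * n) ⊎ p ≡ suc m' * n ℕ.+ m'

  -- With t = -1/m, the point n + p t is -1/m or -1 + 1/m, and S is symmetric under a ↦ -1 - a.
  S-residue : ∀ {m' n} → ¬ p ∣ suc m' → Residue m' n → n ≤ M →
    S M (- rec (suc m')) ~[ 2 ] 4ℚ · (P · (- rec (suc m'))) · H² n - 2ℚ · H n
  S-residue {m'} {n} p∤m residue n≤M = ~-trans (~-reflexive (sym (S-α≡ residue))) (Sums.S-α n n≤M)
    where
    m = suc m'
    r : ℚ
    r = rec m
    module Sums = BinomialSum p p-prime M p≡ 3<p (- r) (Int-neg (Int-rec p∤m))
    lemma₁ : ∀ m n r → n + (1ℚ + m · n) · (- r) ≡ n - (m · r) · n - r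
    lemma₁ = solve-∀ ℚ-ring
    lemma₂ : ∀ n r → n - 1ℚ · n - r ≡ - r
    lemma₂ = solve-∀ ℚ-ring
    lemma₃ : ∀ m n r → n + (m · n + (m - 1ℚ)) · (- r) ≡ n - (m · r) · n - (m · r) + r
    lemma₃ = solve-∀ ℚ-ring
    lemma₄ : ∀ n r → n - 1ℚ · n - 1ℚ + r ≡ - 1ℚ - (- r)
    lemma₄ = solve-∀ ℚ-ring
    S-α≡ : Residue m' n → S M (Sums.α n) ≡ S M (- r)
    S-α≡ (inj₁ eq) = cong (S M) (trans
      (cong (λ z → ι n + z · (- r)) (trans (cong ι eq) (trans (ι-suc (m * n)) (cong (λ z → 1ℚ + z) (ι-* m n)))))
      (trans (lemma₁ (ι m) (ι n) r) (trans (cong (λ z → ι n - z · ι n - r) (ι·rec m)) (lemma₂ (ι n) r))))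
    S-α≡ (inj₂ eq) = trans (cong (S M) (trans
      (cong (λ z → ι n + z · (- r)) (trans (cong ι eq) (trans (ι-+ (m * n) m') (cong₂ _+_ (ι-* m n) ι-m'))))
      (trans (lemma₃ (ι m) (ι n) r) (trans (cong (λ z → ι n - z · ι n - z + r) (ι·rec m)) (lemma₄ (ι n) r)))))
      (S-sym M (- r))
      where
      ι-m' : ι m' ≡ ι m - 1ℚ
      ι-m' = trans (lemma₅ (ι m')) (cong (_- 1ℚ) (sym (ι-suc m')))
        where
        lemma₅ : ∀ x → x ≡ (1ℚ + x) - 1ℚ
        lemma₅ = solve-∀ ℚ-ring

  -- The coefficient of p H² e is -1 from S and 1/2 from `H-quarter`; the total -1/2 becomes -2
  -- through H² e ≡ 4 (-1)^M E. The quotient q_p(2) enters through -3 H M.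
  congruence₄ : S M (- rec 4) ~[ 2 ] 6ℚ · q p 2 - P · (3ℚ · q p 2 · q p 2 + 2ℚ · sign M · ŝ (ℤ.- + 1) N)
  congruence₄ with halves M
  ... | _ , hs = by (Small-resp (lemma P (S M (- rec 4)) (H² e) (H e) (H M) (q p 2) (sign M) (ŝ (ℤ.- + 1) N))
    (Small-+ (Small-+ (difference S~) (difference (~-·ˡ (Int-neg (Int-/1 (+ 2))) (H-quarter hs (halves-sum hs)))))
      (Small-+ (difference (~-·ˡ (Int-neg (Int-/1 (+ 3))) H-M)) (difference (~-·ˡ (Int-neg Int-½) (~-P· (H²-quarter hs)))))))
    where
    e = M div 2
    S~ : S M (- rec 4) ~[ 2 ] 4ℚ · (P · (- ¼)) · H² e - 2ℚ · H e
    S~ = subst (λ r → S M (- rec 4) ~[ 2 ] 4ℚ · (P · (- r)) · H² e - 2ℚ · H e) (rec≡// 4)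
      (S-residue {3} p∤4 (residue hs p≡) (subst (e ≤_) (halves-sum hs) (ℕ.m≤m+n e _)))
      where
      residue : ∀ {M e o} → Halves M e o → p ≡ suc (2 * M) → Residue 3 e
      residue (even n) eq = inj₁ (trans eq (arith n))
        where
        arith : ∀ n → suc (2 * (2 * n)) ≡ suc (4 * n)
        arith = ℕRing.solve-∀
      residue (odd n) eq = inj₂ (trans eq (arith n))
        where
        arith : ∀ n → suc (2 * suc (2 * n)) ≡ 4 * n ℕ.+ 3
        arith = ℕRing.solve-∀
    lemma : ∀ P S h² h m q σ s → S - (6ℚ · q - P · (3ℚ · q · q + 2ℚ · σ · s))
      ≡ ((S - (4ℚ · (P · (- ¼)) · h² - 2ℚ · h)) + ((- 2ℚ) · h - (- 2ℚ) · ((+ 3 / 2) · m - ¼ · (P · h²))))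
      + (((- 3ℚ) · m - (- 3ℚ) · (P · (q · q) - 2ℚ · q)) + ((- ½) · (P · h²) - (- ½) · (P · (4ℚ · (σ · s)))))
    lemma = solve-∀ ℚ-ring

  -- What p modulo 6 determines: n = [p/3], its half e = [p/6] and the residue forms for m = 3 and m
  -- = 6.
  record ThirdData : Set where
    field
      {n e o}  : ℕ
      third    : Third n
      hs       : Halves n e o
      n+o≡M    : n ℕ.+ o ≡ M
      residue₃ : Residue 2 n
      residue₆ : Residue 5 e

  p∤6 : ¬ p ∣ 6
  p∤6 = ∤-* {2} {3} p∤2 p∤3

  thirdData : ThirdData
  thirdData with M ℕ.% 3 | ℕ.m≡m%n+[m/n]*n M 3 | ℕ.m%n<n M 3
  ... | 0 | M≡ | _ = record
    { third = one (trans p≡' (arith₁ j)) ; hs = even j ; n+o≡M = trans (arith₂ j) (sym M≡)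
    ; residue₃ = inj₁ (trans p≡' (arith₁ j)) ; residue₆ = inj₁ (trans p≡' (arith₃ j)) }
    where
    j = M div 3
    p≡' : p ≡ suc (2 * (j * 3))
    p≡' = trans p≡ (cong (λ m → suc (2 * m)) M≡)
    arith₁ : ∀ j → suc (2 * (j * 3)) ≡ suc (3 * (2 * j))
    arith₁ = ℕRing.solve-∀
    arith₂ : ∀ j → 2 * j ℕ.+ j ≡ j * 3
    arith₂ = ℕRing.solve-∀
    arith₃ : ∀ j → suc (2 * (j * 3)) ≡ suc (6 * j)
    arith₃ = ℕRing.solve-∀
  -- M = 3 j + 1 would make p = 3 (2 j + 1).
  ... | 1 | M≡ | _ = ⊥-elim (3∤p (divides (suc (2 * j)) (trans p≡ (trans (cong (λ m → suc (2 * m)) M≡) (arith j)))))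
    where
    j = M div 3
    arith : ∀ j → suc (2 * suc (j * 3)) ≡ suc (2 * j) * 3
    arith = ℕRing.solve-∀
    3∤p : ¬ 3 ∣ p
    3∤p 3∣p with prime⇒irreducible p-prime 3∣p
    ... | inj₁ ()
    ... | inj₂ refl = ℕ.<-irrefl refl 3<p
  ... | 2 | M≡ | _ = record
    { third = two (trans p≡' (arith₁ j)) ; hs = odd j ; n+o≡M = trans (arith₂ j) (sym M≡)
    ; residue₃ = inj₂ (trans p≡' (arith₄ j)) ; residue₆ = inj₂ (trans p≡' (arith₃ j)) }
    where
    j = M div 3
    p≡' : p ≡ suc (2 * suc (suc (j * 3)))
    p≡' = trans p≡ (cong (λ m → suc (2 * m)) M≡)
    arith₁ : ∀ j → suc (2 * suc (suc (j * 3))) ≡ suc (suc (3 * suc (2 * j)))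
    arith₁ = ℕRing.solve-∀
    arith₂ : ∀ j → suc (2 * j) ℕ.+ suc j ≡ suc (suc (j * 3))
    arith₂ = ℕRing.solve-∀
    arith₃ : ∀ j → suc (2 * suc (suc (j * 3))) ≡ 6 * j ℕ.+ 5
    arith₃ = ℕRing.solve-∀
    arith₄ : ∀ j → suc (2 * suc (suc (j * 3))) ≡ 3 * suc (2 * j) ℕ.+ 2
    arith₄ = ℕRing.solve-∀
  ... | suc (suc (suc _)) | _ | s≤s (s≤s (s≤s ()))

  open ThirdData thirdData

  χ : ℚ
  χ = character third

  leg3-χ : leg3 p / 1 ≡ χ
  leg3-χ = by-residue third
    where
    leg3-1 : p ℕ.% 3 ≡ 1 → leg3 p ≡ + 1
    leg3-1 eq with p ℕ.% 3 | eq
    ... | _ | refl = refl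
    leg3-2 : p ℕ.% 3 ≡ 2 → leg3 p ≡ ℤ.- + 1
    leg3-2 eq with p ℕ.% 3 | eq
    ... | _ | refl = refl
    by-residue : (t : Third n) → leg3 p / 1 ≡ character t
    by-residue (one eq) = cong (_/ 1) (leg3-1 (trans (cong (ℕ._% 3) (trans eq (cong suc (ℕ.*-comm 3 n)))) (ℕ.[m+kn]%n≡m%n 1 n 3)))
    by-residue (two eq) = cong (_/ 1) (leg3-2 (trans (cong (ℕ._% 3) (trans eq (cong (λ k → suc (suc k)) (ℕ.*-comm 3 n)))) (ℕ.[m+kn]%n≡m%n 2 n 3)))

  n≤M : n ≤ M
  n≤M = subst (n ≤_) n+o≡M (ℕ.m≤m+n n o)

  e≤M : e ≤ M
  e≤M = ℕ.≤-trans (subst (e ≤_) (halves-sum hs) (ℕ.m≤m+n e o)) n≤M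

  P·H²-third : P · H² n ~[ 2 ] P · (3ℚ · (χ · ŝ (ℤ.- + 2) N))
  P·H²-third = ~-P· (H²-third third hs n+o≡M)

  -- The coefficient of p H² n is -4/3 from S and 2/3 from `H-third`; H² n ≡ 3 χ U turns the total
  -- -2/3 into -2.
  congruence₃ : S M (- rec 3) ~[ 2 ] 3ℚ · q p 3 - P · ((+ 3 / 2) · q p 3 · q p 3 + 2ℚ · χ · ŝ (ℤ.- + 2) N)
  congruence₃ = by (Small-resp (lemma P (S M (- rec 3)) (H² n) (H n) (q p 3) χ (ŝ (ℤ.- + 2) N))
    (Small-+ (Small-+ (difference S~) (difference (~-·ˡ (Int-neg (Int-/1 (+ 2))) (H-third third))))
      (difference (~-·ˡ (Int-neg (Int-· (Int-/1 (+ 2)) Int-⅓)) P·H²-third))))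
    where
    S~ : S M (- rec 3) ~[ 2 ] 4ℚ · (P · (- ⅓)) · H² n - 2ℚ · H n
    S~ = subst (λ r → S M (- rec 3) ~[ 2 ] 4ℚ · (P · (- r)) · H² n - 2ℚ · H n) (rec≡// 3) (S-residue {2} p∤3 residue₃ n≤M)
    lemma : ∀ P S h² h q χ s → S - (3ℚ · q - P · ((+ 3 / 2) · q · q + 2ℚ · χ · s))
      ≡ ((S - (4ℚ · (P · (- ⅓)) · h² - 2ℚ · h))
        + ((- 2ℚ) · h - (- 2ℚ) · ((- (+ 3 / 2)) · q + P · ((+ 3 / 4) · (q · q) - ⅓ · h²))))
      + ((- (2ℚ · ⅓)) · (P · h²) - (- (2ℚ · ⅓)) · (P · (3ℚ · (χ · s))))
    lemma = solve-∀ ℚ-ring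

  -- The coefficient of p H² n is -10/3 from S through H² e ≡ 5 H² n, 1 from `H-sixth` and 2/3 from
  -- `H-third`, in total -5/3, hence -5 χ U. The part -2 H M brings in q_p(2).
  congruence₆ : S M (- rec 6) ~[ 2 ]
    4ℚ · q p 2 + 3ℚ · q p 3 - P · (2ℚ · q p 2 · q p 2 + (+ 3 / 2) · q p 3 · q p 3 + (+ 5 / 1) · χ · ŝ (ℤ.- + 2) N)
  congruence₆ = by (Small-resp
    (lemma P (S M (- rec 6)) (H² e) (H e) (H² n) (H n) (H M) (q p 2) (q p 3) χ (ŝ (ℤ.- + 2) N))
    (Small-+ (Small-+ (Small-+ (difference S~) (difference (~-·ˡ i-2 (H-sixth third hs n+o≡M))))
        (Small-+ (difference (~-·ˡ i-2 H-M)) (difference (~-·ˡ i-2 (H-third third)))))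
      (Small-+ (difference (~-·ˡ (Int-neg (Int-· (Int-/1 (+ 2)) Int-⅓)) (~-P· (H²-sixth third hs n+o≡M))))
        (difference (~-·ˡ (Int-neg (Int-· (Int-/1 (+ 5)) Int-⅓)) P·H²-third)))))
    where
    i-2 = Int-neg (Int-/1 (+ 2))
    S~ : S M (- rec 6) ~[ 2 ] 4ℚ · (P · (- (+ 1 / 6))) · H² e - 2ℚ · H e
    S~ = subst (λ r → S M (- rec 6) ~[ 2 ] 4ℚ · (P · (- r)) · H² e - 2ℚ · H e) (rec≡// 6) (S-residue {5} p∤6 residue₆ e≤M)
    lemma : ∀ P S g² g h² h m q₂ q₃ χ s →
      S - (4ℚ · q₂ + 3ℚ · q₃ - P · (2ℚ · q₂ · q₂ + (+ 3 / 2) · q₃ · q₃ + (+ 5 / 1) · χ · s))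
      ≡ (((S - (4ℚ · (P · (- (+ 1 / 6))) · g² - 2ℚ · g)) + ((- 2ℚ) · g - (- 2ℚ) · (h + m - ½ · (P · h²))))
        + (((- 2ℚ) · m - (- 2ℚ) · (P · (q₂ · q₂) - 2ℚ · q₂))
          + ((- 2ℚ) · h - (- 2ℚ) · ((- (+ 3 / 2)) · q₃ + P · ((+ 3 / 4) · (q₃ · q₃) - ⅓ · h²)))))
      + (((- (2ℚ · ⅓)) · (P · g²) - (- (2ℚ · ⅓)) · (P · ((+ 5 / 1) · h²)))
        + ((- ((+ 5 / 1) · ⅓)) · (P · h²) - (- ((+ 5 / 1) · ⅓)) · (P · (3ℚ · (χ · s)))))
    lemma = solve-∀ ℚ-ring

-- Passage to the stated form

/1-product : ∀ {x y} a b c → b / 1 ≡ x → c / 1 ≡ y → (a ×ℤ b ×ℤ c) / 1 ≡ (a / 1) · x · y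
/1-product a b c refl refl = trans (/1-* (a ×ℤ b) c) (cong (_· (c / 1)) (/1-* a b))

odd-prime : ∀ {p} → Prime p → 3 < p → Σ[ M ∈ ℕ ] p ≡ suc (2 * M)
odd-prime {p} p-prime 3<p with halves p
... | _ , hs = by-parity hs refl
  where
  by-parity : ∀ {n e o} → Halves n e o → n ≡ p → Σ[ M ∈ ℕ ] p ≡ suc (2 * M)
  by-parity (odd k)  eq = k , sym eq
  by-parity (even k) eq with prime⇒irreducible p-prime (divides k (trans (sym eq) (ℕ.*-comm 2 k)))
  ... | inj₁ ()
  ... | inj₂ refl = ⊥-elim (ℕ.<⇒≱ 3<p (s≤s (s≤s z≤n)))

theorem2p2 : (p : ℕ) → .{{_ : NonZero p}} → Prime p → p > 3 →
    (Σ[1… (p ∸ 1) div 2 ] (λ k → (((2 * k) C k) * ((4 * k) C (2 * k))) // (k * 64 ^ k))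
    ≡ ℕ→ℚ 6 · q p 2
    - ℕ→ℚ p · (ℕ→ℚ 3 · q p 2 · q p 2
    + (+ 2 ×ℤ sgn ((p ∸ 1) div 2) ×ℤ E (p ∸ 3)) / 1)
    [mod p ^ 2 ])
    × (Σ[1… (p ∸ 1) div 2 ] (λ k → (((2 * k) C k) * ((3 * k) C k)) // (k * 27 ^ k))
    ≡ ℕ→ℚ 3 · q p 3
    - ℕ→ℚ p · ((3 // 2) · q p 3 · q p 3
    + (+ 2 ×ℤ leg3 p ×ℤ U (p ∸ 3)) / 1)
    [mod p ^ 2 ])
    × (Σ[1… (p ∸ 1) div 2 ] (λ k → (((3 * k) C k) * ((6 * k) C (3 * k))) // (k * 432 ^ k))
    ≡ ℕ→ℚ 4 · q p 2 + ℕ→ℚ 3 · q p 3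
    - ℕ→ℚ p · (ℕ→ℚ 2 · q p 2 · q p 2
    + (3 // 2) · q p 3 · q p 3
    + (+ 5 ×ℤ leg3 p ×ℤ U (p ∸ 3)) / 1)
    [mod p ^ 2 ])
theorem2p2 p {{p≢0}} p-prime 3<p =
    -- The product l m² evaluates to the stated base 64, and to 27 and 432 in the other two cases,
    -- so the summands match as they stand.
    congruent (Σ-S 3 4 c₄ refl c₄-suc half)
      (cong₂ (λ x y → 6ℚ · q₂ - x · (3ℚ · q₂ · q₂ + y)) (sym (ι≡/1 p))
        (/1-product (+ 2) (sgn half) (E (p ∸ 3)) (trans (sgn-sign half) (cong sign half≡M)) refl))
      congruence₄
  , congruent (Σ-S 2 3 c₃ refl c₃-suc half)
      (cong₂ (λ x y → 3ℚ · q₃ - x · ((+ 3 / 2) · q₃ · q₃ + y)) (sym (ι≡/1 p))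
        (/1-product (+ 2) (leg3 p) (U (p ∸ 3)) leg3-χ refl))
      congruence₃
  , congruent (Σ-S 5 12 c₆ refl c₆-suc half)
      (cong₂ (λ x y → 4ℚ · q₂ + 3ℚ · q₃ - x · (2ℚ · q₂ · q₂ + (+ 3 / 2) · q₃ · q₃ + y)) (sym (ι≡/1 p))
        (/1-product (+ 5) (leg3 p) (U (p ∸ 3)) leg3-χ refl))
      congruence₆
  where
  M = proj₁ (odd-prime p-prime 3<p)
  p≡ = proj₂ (odd-prime p-prime 3<p)
  open Local p p-prime using (_~[_]_; ~⇒≡[mod²])
  open Congruences p p-prime M p≡ 3<p using (congruence₃; congruence₄; congruence₆; leg3-χ)
  half = (p ∸ 1) div 2
  q₂ = q p {{p≢0}} 2
  q₃ = q p {{p≢0}} 3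
  half≡M : half ≡ M
  half≡M = trans (cong (λ n → (n ∸ 1) div 2) p≡) (trans (cong (_div 2) (ℕ.*-comm 2 M)) (ℕ.m*n/n≡m M 2))
  congruent : ∀ {x y a z} → x ≡ S half a → y ≡ z → S M a ~[ 2 ] z → x ≡ y [mod p ^ 2 ]
  congruent {a = a} refl refl s = subst (λ n → S n a ≡ _ [mod p ^ 2 ]) (sym half≡M) (~⇒≡[mod²] s)
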